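{- Let $\tau\in\mathbf C$ with $\operatorname{Im}\tau>0$ and, with $q=e^{\pi i\tau}$, let $$C(x,y|\tau)=e^{2ix}e^{2iy}\sum_{k,\ell\in\mathbf Z}q^{2(\ell^2+\ell k+k^2+k+\ell+1/3)}e^{2ix(2\ell+k)}e^{2iy(2k+\ell)}.$$ Then for all $x,y\in\mathbf C$, $$C^3(x,y|\tau)-C^3(-x,-y|\tau)=C^3(x+\pi/3,y|\tau)-C^3(-x-\pi/3,-y|\tau).$$
   Context: Real powers of $q$ are defined by $q^r=e^{\pi i r\tau}$. $C^3(x,y|\tau)$ denotes $(C(x,y|\tau))^3$. -}

module Defs where

open import Data.Nat as ℕ using (ℕ; zero; suc; _!)
import Data.Nat.Properties as ℕP
open import Data.Integer as ℤ using (ℤ; +_)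
import Data.Integer.Properties as ℤP
open import Data.Rational as ℚ using (ℚ; 0ℚ; 1ℚ; ½)
import Data.Rational.Properties as ℚP
import Data.Rational.Unnormalised as ℚᵘ
import Data.Rational.Unnormalised.Properties as ℚᵘP
open import Data.Rational.Solver using (module +-*-Solver)
open import Data.Product using (∃; _×_; _,_; proj₁; proj₂)
open import Data.Sum using (inj₁; inj₂)
open import Data.List using (List; []; _∷_)
open import Data.List.Membership.Propositional using (_∈_)
open import Data.List.Relation.Unary.Unique.Propositional using (Unique)
open import Relation.Binary.PropositionalEquality
  using (_≡_; refl; sym; trans; cong; cong₂; subst; subst₂)

Eventually : (ℕ → Set) → Set
Eventually P = ∃ λ N → ∀ n → N ℕ.≤ n → P n

IsCauchy : (ℕ → ℚ) → Set
IsCauchy s = ∀ ε → 0ℚ ℚ.< ε →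
  ∃ λ N → ∀ m n → N ℕ.≤ m → N ℕ.≤ n → ℚ.∣ s m ℚ.- s n ∣ ℚ.≤ ε

module RationalLemmas where
  open import Data.Rational using (_+_; _*_; _-_; -_; _≤_; _<_; _≥_; ∣_∣; Positive; NonNegative; 1/_; _/_)
  open ℚP.≤-Reasoning

  half : ℕ → ℚ
  half zero    = 1ℚ
  half (suc n) = ½ * half n

  0≤1 : 0ℚ ≤ 1ℚ
  0≤1 = ℚP.nonNegative⁻¹ 1ℚ

  0<1 : 0ℚ < 1ℚ
  0<1 = ℚP.positive⁻¹ 1ℚ

  *-nonneg : ∀ {p q} → 0ℚ ≤ p → 0ℚ ≤ q → 0ℚ ≤ p * q
  *-nonneg {p} {q} 0≤p 0≤q =
    ℚP.nonNegative⁻¹ (p * q) {{ℚP.nonNeg*nonNeg⇒nonNeg p {{ℚ.nonNegative 0≤p}} q {{ℚ.nonNegative 0≤q}}}}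

  *-pos : ∀ {p q} → 0ℚ < p → 0ℚ < q → 0ℚ < p * q
  *-pos {p} {q} 0<p 0<q =
    ℚP.positive⁻¹ (p * q) {{ℚP.pos*pos⇒pos p {{ℚ.positive 0<p}} q {{ℚ.positive 0<q}}}}

  +-nonneg : ∀ {p q} → 0ℚ ≤ p → 0ℚ ≤ q → 0ℚ ≤ p + q
  +-nonneg {p} {q} 0≤p 0≤q =
    ℚP.≤-trans (ℚP.≤-reflexive (sym (ℚP.+-identityˡ 0ℚ))) (ℚP.+-mono-≤ 0≤p 0≤q)

  *-monoˡ : ∀ {r p q} → 0ℚ ≤ r → p ≤ q → r * p ≤ r * q
  *-monoˡ {r} 0≤r = ℚP.*-monoˡ-≤-nonNeg r {{ℚ.nonNegative 0≤r}}

  *-mono : ∀ {p q r s} → 0ℚ ≤ p → 0ℚ ≤ s → p ≤ q → r ≤ s → p * r ≤ q * s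
  *-mono {p} {q} {r} {s} 0≤p 0≤s p≤q r≤s =
    ℚP.≤-trans (*-monoˡ 0≤p r≤s) (ℚP.*-monoʳ-≤-nonNeg s {{ℚ.nonNegative 0≤s}} p≤q)

  half-pos : ∀ n → 0ℚ < half n
  half-pos zero    = 0<1
  half-pos (suc n) = *-pos (ℚP.positive⁻¹ ½) (half-pos n)

  ½pos : ∀ {ε} → 0ℚ < ε → 0ℚ < ½ * ε
  ½pos = *-pos (ℚP.positive⁻¹ ½)

  ½+½ : ∀ ε → ½ * ε + ½ * ε ≡ ε
  ½+½ ε = trans (sym (ℚP.*-distribʳ-+ ε ½ ½)) (ℚP.*-identityˡ ε)

  p≤p+q : ∀ {p q} → 0ℚ ≤ q → p ≤ p + q
  p≤p+q {p} {q} 0≤q = begin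
    p       ≡⟨ sym (ℚP.+-identityʳ p) ⟩
    p + 0ℚ  ≤⟨ ℚP.+-monoʳ-≤ p 0≤q ⟩
    p + q   ∎

  p≤q+p : ∀ {p q} → 0ℚ ≤ q → p ≤ q + p
  p≤q+p {p} {q} 0≤q = ℚP.≤-trans (p≤p+q 0≤q) (ℚP.≤-reflexive (ℚP.+-comm p q))

  0≤q-p : ∀ {p q} → p ≤ q → 0ℚ ≤ q - p
  0≤q-p {p} {q} p≤q = begin
    0ℚ     ≡⟨ sym (ℚP.+-inverseʳ p) ⟩
    p - p  ≤⟨ ℚP.+-monoˡ-≤ (- p) p≤q ⟩
    q - p  ∎

  ∣-∣≤ : ∀ {p q} → p ≤ q → - p ≤ q → ∣ p ∣ ≤ q
  ∣-∣≤ {p} p≤q -p≤q with ℚP.∣p∣≡p∨∣p∣≡-p p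
  ... | inj₁ e = ℚP.≤-trans (ℚP.≤-reflexive e) p≤q
  ... | inj₂ e = ℚP.≤-trans (ℚP.≤-reflexive e) -p≤q

  dist-sym : ∀ p q → ∣ p - q ∣ ≡ ∣ q - p ∣
  dist-sym p q = trans (cong ∣_∣ eq) (ℚP.∣-p∣≡∣p∣ (q - p))
    where
    open +-*-Solver
    eq : p - q ≡ - (q - p)
    eq = solve 2 (λ a b → a :- b := :- (b :- a)) refl p q

  triangle : ∀ p q r → ∣ p - r ∣ ≤ ∣ p - q ∣ + ∣ q - r ∣
  triangle p q r = begin
    ∣ p - r ∣              ≡⟨ cong ∣_∣ (solve 3 (λ a b c → a :- c := (a :- b) :+ (b :- c)) refl p q r) ⟩
    ∣ (p - q) + (q - r) ∣  ≤⟨ ℚP.∣p+q∣≤∣p∣+∣q∣ (p - q) (q - r) ⟩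
    ∣ p - q ∣ + ∣ q - r ∣  ∎
    where open +-*-Solver

  ∣∣p∣-∣q∣∣≤∣p-q∣ : ∀ p q → ∣ ∣ p ∣ - ∣ q ∣ ∣ ≤ ∣ p - q ∣
  ∣∣p∣-∣q∣∣≤∣p-q∣ p q = ∣-∣≤ (bound p q) (begin
    - (∣ p ∣ - ∣ q ∣)  ≡⟨ solve 2 (λ a b → :- (a :- b) := b :- a) refl ∣ p ∣ ∣ q ∣ ⟩
    ∣ q ∣ - ∣ p ∣      ≤⟨ bound q p ⟩
    ∣ q - p ∣          ≡⟨ dist-sym q p ⟩
    ∣ p - q ∣          ∎)
    where
    open +-*-Solver
    bound : ∀ a b → ∣ a ∣ - ∣ b ∣ ≤ ∣ a - b ∣
    bound a b = begin
      ∣ a ∣ - ∣ b ∣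
        ≡⟨ cong (λ t → ∣ t ∣ - ∣ b ∣) (solve 2 (λ a b → a := (a :- b) :+ b) refl a b) ⟩
      ∣ (a - b) + b ∣ - ∣ b ∣
        ≤⟨ ℚP.+-monoˡ-≤ (- ∣ b ∣) (ℚP.∣p+q∣≤∣p∣+∣q∣ (a - b) b) ⟩
      (∣ a - b ∣ + ∣ b ∣) - ∣ b ∣
        ≡⟨ solve 2 (λ a b → (a :+ b) :- b := a) refl ∣ a - b ∣ ∣ b ∣ ⟩
      ∣ a - b ∣ ∎

  recip : ℕ → ℚ
  recip n = + 1 / suc n

  recip-pos : ∀ n → 0ℚ < recip n
  recip-pos n = ℚP.positive⁻¹ (recip n) {{ℚP.normalize-pos 1 (suc n)}}

  recip≃ : ∀ n → ℚ.toℚᵘ (recip n) ℚᵘ.≃ ℚᵘ.mkℚᵘ (+ 1) n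
  recip≃ n = ℚP.toℚᵘ-fromℚᵘ (ℚᵘ.mkℚᵘ (+ 1) n)

  recip-anti : ∀ {m n} → m ℕ.≤ n → recip n ≤ recip m
  recip-anti {m} {n} m≤n = ℚP.toℚᵘ-cancel-≤
    (ℚᵘP.≤-respˡ-≃ (ℚᵘP.≃-sym (recip≃ n)) (ℚᵘP.≤-respʳ-≃ (ℚᵘP.≃-sym (recip≃ m))
      (ℚᵘ.*≤* (subst₂ ℤ._≤_ (sym (ℤP.*-identityˡ (+ suc m))) (sym (ℤP.*-identityˡ (+ suc n)))
        (ℤ.+≤+ (ℕ.s≤s m≤n))))))

  archimedean : ∀ ε → 0ℚ < ε → Eventually λ n → recip n ≤ ε
  archimedean ε 0<ε = N , λ n N≤n → ℚP.≤-trans (recip-anti N≤n) recipN≤ε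
    where
    N = ℚ.denominator-1 ε
    go : ∀ p → 0ℚ < p → ℚᵘ.mkℚᵘ (+ 1) (ℚ.denominator-1 p) ℚᵘ.≤ ℚ.toℚᵘ p
    go (ℚ.mkℚ (+ 0) d c) 0<p with ℚ.positive 0<p
    ... | ()
    go (ℚ.mkℚ (+ suc k) d c) 0<p =
      ℚᵘ.*≤* (ℤP.*-monoʳ-≤-nonNeg (+ suc d) {+ 1} {+ suc k} (ℤ.+≤+ (ℕ.s≤s ℕ.z≤n)))
    go (ℚ.mkℚ (ℤ.-[1+ k ]) d c) 0<p with ℚ.positive 0<p
    ... | ()
    recipN≤ε : recip N ≤ ε
    recipN≤ε = ℚP.toℚᵘ-cancel-≤ (ℚᵘP.≤-respˡ-≃ (ℚᵘP.≃-sym (recip≃ N)) (go ε 0<ε))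

  half≤recip : ∀ n → half n ≤ recip n
  half≤recip zero    = ℚP.≤-refl
  half≤recip (suc n) = ℚP.≤-trans (*-monoˡ (ℚP.nonNegative⁻¹ ½) (half≤recip n)) step
    where
    lhs≃ : ℚ.toℚᵘ (½ * recip n) ℚᵘ.≃ ℚᵘ.mkℚᵘ (+ 1) 1 ℚᵘ.* ℚᵘ.mkℚᵘ (+ 1) n
    lhs≃ = ℚᵘP.≃-trans (ℚP.toℚᵘ-homo-* ½ (recip n)) (ℚᵘP.*-congˡ {ℚᵘ.mkℚᵘ (+ 1) 1} (recip≃ n))
    step : ½ * recip n ≤ recip (suc n)
    step = ℚP.toℚᵘ-cancel-≤
      (ℚᵘP.≤-respˡ-≃ (ℚᵘP.≃-sym lhs≃) (ℚᵘP.≤-respʳ-≃ (ℚᵘP.≃-sym (recip≃ (suc n)))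
        (ℚᵘ.*≤* (subst₂ ℤ._≤_ (sym (ℤP.*-identityˡ (+ suc (suc n))))
                               (sym (ℤP.*-identityˡ (+ suc (n ℕ.+ suc (n ℕ.+ 0)))))
          (ℤ.+≤+ (ℕ.s≤s (subst (suc n ℕ.≤_) (sym (ℕP.+-suc n (n ℕ.+ 0)))
                                 (ℕ.s≤s (ℕP.m≤m+n n (n ℕ.+ 0))))))))))

  shrink : ∀ B ε → 0ℚ ≤ B → 0ℚ < ε → ∃ λ δ → 0ℚ < δ × B * δ ≤ ε
  shrink B ε 0≤B 0<ε = δ , *-pos 0<ε (ℚP.positive⁻¹ _ {{ℚP.1/pos⇒pos B+1}}) , bound
    where
    B+1 = B + 1ℚ
    0<B+1 : 0ℚ < B+1
    0<B+1 = ℚP.<-≤-trans 0<1 (p≤q+p 0≤B)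
    instance
      pos : Positive B+1
      pos = ℚ.positive 0<B+1
      nz : ℚ.NonZero B+1
      nz = ℚP.pos⇒nonZero B+1
    δ = ε * (1/ B+1)
    0≤δ : 0ℚ ≤ δ
    0≤δ = ℚP.<⇒≤ (*-pos 0<ε (ℚP.positive⁻¹ _ {{ℚP.1/pos⇒pos B+1}}))
    bound : B * δ ≤ ε
    bound = begin
      B * δ                   ≤⟨ ℚP.*-monoʳ-≤-nonNeg δ {{ℚ.nonNegative 0≤δ}} (p≤p+q {B} {1ℚ} 0≤1) ⟩
      B+1 * (ε * (1/ B+1))    ≡⟨ solve 3 (λ a b c → a :* (b :* c) := b :* (a :* c)) refl B+1 ε (1/ B+1) ⟩
      ε * (B+1 * (1/ B+1))    ≡⟨ cong (ε *_) (ℚP.*-inverseʳ B+1) ⟩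
      ε * 1ℚ                  ≡⟨ ℚP.*-identityʳ ε ⟩
      ε                       ∎
      where open +-*-Solver

  scaled-recip : ∀ B ε → 0ℚ ≤ B → 0ℚ < ε → Eventually λ n → B * recip n ≤ ε
  scaled-recip B ε 0≤B 0<ε =
    let δ , 0<δ , Bδ≤ε = shrink B ε 0≤B 0<ε
        N , below = archimedean δ 0<δ
    in N , λ n N≤n → ℚP.≤-trans (*-monoˡ 0≤B (below n N≤n)) Bδ≤ε

  telescope : ∀ (s u : ℕ → ℚ) K →
              (∀ n → K ℕ.≤ n → ∣ s (suc n) - s n ∣ ≤ u n - u (suc n)) →
              ∀ m j → K ℕ.≤ m → ∣ s (j ℕ.+ m) - s m ∣ ≤ u m - u (j ℕ.+ m)
  telescope s u K step m zero    K≤m = ℚP.≤-reflexive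
    (trans (cong ∣_∣ (ℚP.+-inverseʳ (s m))) (sym (ℚP.+-inverseʳ (u m))))
  telescope s u K step m (suc j) K≤m = begin
    ∣ s (suc (j ℕ.+ m)) - s m ∣
      ≤⟨ triangle (s (suc (j ℕ.+ m))) (s (j ℕ.+ m)) (s m) ⟩
    ∣ s (suc (j ℕ.+ m)) - s (j ℕ.+ m) ∣ + ∣ s (j ℕ.+ m) - s m ∣
      ≤⟨ ℚP.+-mono-≤ (step (j ℕ.+ m) (ℕP.≤-trans K≤m (ℕP.m≤n+m m j))) (telescope s u K step m j K≤m) ⟩
    (u (j ℕ.+ m) - u (suc (j ℕ.+ m))) + (u m - u (j ℕ.+ m))
      ≡⟨ solve 3 (λ a b c → (a :- b) :+ (c :- a) := c :- b) refl (u (j ℕ.+ m)) (u (suc (j ℕ.+ m))) (u m) ⟩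
    u m - u (suc (j ℕ.+ m)) ∎
    where open +-*-Solver

  telescope-cauchy : ∀ (s u : ℕ → ℚ) K →
    (∀ n → K ℕ.≤ n → ∣ s (suc n) - s n ∣ ≤ u n - u (suc n)) → (∀ n → 0ℚ ≤ u n) →
    ∀ ε M → K ℕ.≤ M → u M ≤ ½ * ε →
    ∀ m n → M ℕ.≤ m → M ℕ.≤ n → ∣ s m - s n ∣ ≤ ε
  telescope-cauchy s u K step 0≤u ε M K≤M small m n M≤m M≤n = begin
    ∣ s m - s n ∣                  ≤⟨ triangle (s m) (s M) (s n) ⟩
    ∣ s m - s M ∣ + ∣ s M - s n ∣  ≤⟨ ℚP.+-mono-≤ (near m M≤m) (ℚP.≤-trans (ℚP.≤-reflexive (dist-sym (s M) (s n))) (near n M≤n)) ⟩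
    ½ * ε + ½ * ε                  ≡⟨ ½+½ ε ⟩
    ε                              ∎
    where
    near : ∀ a → M ℕ.≤ a → ∣ s a - s M ∣ ≤ ½ * ε
    near a M≤a = begin
      ∣ s a - s M ∣                  ≡⟨ cong (λ t → ∣ s t - s M ∣) (sym (ℕP.m∸n+n≡m M≤a)) ⟩
      ∣ s ((a ℕ.∸ M) ℕ.+ M) - s M ∣  ≤⟨ telescope s u K step M (a ℕ.∸ M) K≤M ⟩
      u M - u ((a ℕ.∸ M) ℕ.+ M)      ≤⟨ ℚP.+-monoʳ-≤ (u M) (ℚP.neg-antimono-≤ (0≤u ((a ℕ.∸ M) ℕ.+ M))) ⟩
      u M - 0ℚ                       ≡⟨ ℚP.+-identityʳ (u M) ⟩
      u M                            ≤⟨ small ⟩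
      ½ * ε                          ∎

  cauchy-bounded : ∀ s → IsCauchy s → ∃ λ B → 0ℚ ≤ B × Eventually λ n → ∣ s n ∣ ≤ B
  cauchy-bounded s c with c 1ℚ 0<1
  ... | N , close = B , +-nonneg 0≤1 (ℚP.0≤∣p∣ (s N)) , N , bound
    where
    B = 1ℚ + ∣ s N ∣
    bound : ∀ n → N ℕ.≤ n → ∣ s n ∣ ≤ B
    bound n N≤n = begin
      ∣ s n ∣                 ≡⟨ cong ∣_∣ (solve 2 (λ a b → a := (a :- b) :+ b) refl (s n) (s N)) ⟩
      ∣ (s n - s N) + s N ∣   ≤⟨ ℚP.∣p+q∣≤∣p∣+∣q∣ (s n - s N) (s N) ⟩
      ∣ s n - s N ∣ + ∣ s N ∣ ≤⟨ ℚP.+-monoˡ-≤ ∣ s N ∣ (close n N N≤n ℕP.≤-refl) ⟩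
      B                       ∎
      where open +-*-Solver

  const-cauchy : ∀ p → IsCauchy λ _ → p
  const-cauchy p ε 0<ε = 0 , λ _ _ _ _ →
    ℚP.≤-trans (ℚP.≤-reflexive (cong ∣_∣ (ℚP.+-inverseʳ p))) (ℚP.<⇒≤ 0<ε)

  neg-cauchy : ∀ s → IsCauchy s → IsCauchy λ n → - s n
  neg-cauchy s c ε 0<ε with c ε 0<ε
  ... | N , close = N , λ m n N≤m N≤n → ℚP.≤-trans
        (ℚP.≤-reflexive (trans (cong ∣_∣ (solve 2 (λ a b → (:- a) :- (:- b) := b :- a) refl (s m) (s n)))
                               (dist-sym (s n) (s m))))
        (close m n N≤m N≤n)
    where open +-*-Solver

  abs-cauchy : ∀ s → IsCauchy s → IsCauchy λ n → ∣ s n ∣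
  abs-cauchy s c ε 0<ε with c ε 0<ε
  ... | N , close = N , λ m n N≤m N≤n →
        ℚP.≤-trans (∣∣p∣-∣q∣∣≤∣p-q∣ (s m) (s n)) (close m n N≤m N≤n)

  add-cauchy : ∀ s t → IsCauchy s → IsCauchy t → IsCauchy λ n → s n + t n
  add-cauchy s t c d ε 0<ε with c (½ * ε) (½pos 0<ε) | d (½ * ε) (½pos 0<ε)
  ... | N , cs | M , ct = N ℕ.⊔ M , λ m n m≥ n≥ → begin
        ∣ (s m + t m) - (s n + t n) ∣
          ≡⟨ cong ∣_∣ (solve 4 (λ a b c d → (a :+ b) :- (c :+ d) := (a :- c) :+ (b :- d)) refl (s m) (t m) (s n) (t n)) ⟩
        ∣ (s m - s n) + (t m - t n) ∣
          ≤⟨ ℚP.∣p+q∣≤∣p∣+∣q∣ (s m - s n) (t m - t n) ⟩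
        ∣ s m - s n ∣ + ∣ t m - t n ∣
          ≤⟨ ℚP.+-mono-≤ (cs m n (ℕP.m⊔n≤o⇒m≤o N M m≥) (ℕP.m⊔n≤o⇒m≤o N M n≥))
                         (ct m n (ℕP.m⊔n≤o⇒n≤o N M m≥) (ℕP.m⊔n≤o⇒n≤o N M n≥)) ⟩
        ½ * ε + ½ * ε
          ≡⟨ ½+½ ε ⟩
        ε ∎
    where open +-*-Solver

  mul-cauchy : ∀ s t → IsCauchy s → IsCauchy t → IsCauchy λ n → s n * t n
  mul-cauchy s t c d ε 0<ε = N , λ m n m≥ n≥ → begin
        ∣ s m * t m - s n * t n ∣
          ≡⟨ cong ∣_∣ (solve 4 (λ a b c d → a :* b :- c :* d := a :* (b :- d) :+ d :* (a :- c)) refl (s m) (t m) (s n) (t n)) ⟩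
        ∣ s m * (t m - t n) + t n * (s m - s n) ∣
          ≤⟨ ℚP.∣p+q∣≤∣p∣+∣q∣ (s m * (t m - t n)) (t n * (s m - s n)) ⟩
        ∣ s m * (t m - t n) ∣ + ∣ t n * (s m - s n) ∣
          ≡⟨ cong₂ _+_ (ℚP.∣p*q∣≡∣p∣*∣q∣ (s m) (t m - t n)) (ℚP.∣p*q∣≡∣p∣*∣q∣ (t n) (s m - s n)) ⟩
        ∣ s m ∣ * ∣ t m - t n ∣ + ∣ t n ∣ * ∣ s m - s n ∣
          ≤⟨ ℚP.+-mono-≤
               (*-mono (ℚP.0≤∣p∣ (s m)) (ℚP.<⇒≤ 0<α) (sA m (≥₁ m≥)) (ct m n (≥₄ m≥) (≥₄ n≥)))
               (*-mono (ℚP.0≤∣p∣ (t n)) (ℚP.<⇒≤ 0<β) (tB n (≥₂ n≥)) (cs m n (≥₃ m≥) (≥₃ n≥))) ⟩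
        A * α + B * β
          ≤⟨ ℚP.+-mono-≤ Aα Bβ ⟩
        ½ * ε + ½ * ε
          ≡⟨ ½+½ ε ⟩
        ε ∎
    where
    open +-*-Solver
    boundedˢ = cauchy-bounded s c
    boundedᵗ = cauchy-bounded t d
    A   = proj₁ boundedˢ
    0≤A = proj₁ (proj₂ boundedˢ)
    N₁  = proj₁ (proj₂ (proj₂ boundedˢ))
    sA  = proj₂ (proj₂ (proj₂ boundedˢ))
    B   = proj₁ boundedᵗ
    0≤B = proj₁ (proj₂ boundedᵗ)
    N₂  = proj₁ (proj₂ (proj₂ boundedᵗ))
    tB  = proj₂ (proj₂ (proj₂ boundedᵗ))
    shrinkA = shrink A (½ * ε) 0≤A (½pos 0<ε)
    shrinkB = shrink B (½ * ε) 0≤B (½pos 0<ε)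
    α   = proj₁ shrinkA
    0<α = proj₁ (proj₂ shrinkA)
    Aα  = proj₂ (proj₂ shrinkA)
    β   = proj₁ shrinkB
    0<β = proj₁ (proj₂ shrinkB)
    Bβ  = proj₂ (proj₂ shrinkB)
    N₃  = proj₁ (c β 0<β)
    cs  = proj₂ (c β 0<β)
    N₄  = proj₁ (d α 0<α)
    ct  = proj₂ (d α 0<α)
    N₁₂ = N₁ ℕ.⊔ N₂
    N₃₄ = N₃ ℕ.⊔ N₄
    N = N₁₂ ℕ.⊔ N₃₄
    ≥₁ : ∀ {k} → N ℕ.≤ k → N₁ ℕ.≤ k
    ≥₁ h = ℕP.m⊔n≤o⇒m≤o N₁ N₂ (ℕP.m⊔n≤o⇒m≤o N₁₂ N₃₄ h)
    ≥₂ : ∀ {k} → N ℕ.≤ k → N₂ ℕ.≤ k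
    ≥₂ h = ℕP.m⊔n≤o⇒n≤o N₁ N₂ (ℕP.m⊔n≤o⇒m≤o N₁₂ N₃₄ h)
    ≥₃ : ∀ {k} → N ℕ.≤ k → N₃ ℕ.≤ k
    ≥₃ h = ℕP.m⊔n≤o⇒m≤o N₃ N₄ (ℕP.m⊔n≤o⇒n≤o N₁₂ N₃₄ h)
    ≥₄ : ∀ {k} → N ℕ.≤ k → N₄ ℕ.≤ k
    ≥₄ h = ℕP.m⊔n≤o⇒n≤o N₃ N₄ (ℕP.m⊔n≤o⇒n≤o N₁₂ N₃₄ h)

  square-nonneg : ∀ p → 0ℚ ≤ p * p
  square-nonneg p with ℚP.≤-total 0ℚ p
  ... | inj₁ 0≤p = *-nonneg 0≤p 0≤p
  ... | inj₂ p≤0 = ℚP.nonNegative⁻¹ (p * p)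
    {{ℚP.nonPos*nonPos⇒nonPos p {{ℚ.nonPositive p≤0}} p {{ℚ.nonPositive p≤0}}}}

  1+p²-pos : ∀ p → Positive (1ℚ + p * p)
  1+p²-pos p = ℚ.positive (ℚP.<-≤-trans 0<1 (p≤p+q (square-nonneg p)))

  1+p²-nonZero : ∀ p → ℚ.NonZero (1ℚ + p * p)
  1+p²-nonZero p = ℚP.pos⇒nonZero (1ℚ + p * p) {{1+p²-pos p}}

  inv-* : ∀ m n .{{_ : ℕ.NonZero m}} .{{_ : ℕ.NonZero n}} .{{_ : ℕ.NonZero (m ℕ.* n)}} →
          + 1 / (m ℕ.* n) ≡ (+ 1 / m) * (+ 1 / n)
  inv-* (suc m) (suc n) = ℚP.toℚᵘ-injective
    (ℚᵘP.≃-trans (recip≃ (n ℕ.+ m ℕ.* suc n))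
      (ℚᵘP.≃-sym (ℚᵘP.≃-trans (ℚP.toℚᵘ-homo-* (recip m) (recip n)) (ℚᵘP.*-cong (recip≃ m) (recip≃ n)))))

-- Cauchy sequences of rationals carrying a modulus, considered up to _≃ᵣ_; no fixed rate of
-- convergence is imposed, so that the arithmetic operations are pointwise.

record ℝ : Set where
  constructor mkℝ
  field
    seq    : ℕ → ℚ
    cauchy : IsCauchy seq

open ℝ public

module _ where
  open RationalLemmas

  fromℚ : ℚ → ℝ
  fromℚ p = mkℝ (λ _ → p) (const-cauchy p)

  infixl 6 _+ᵣ_ _-ᵣ_
  infixl 7 _*ᵣ_
  infix  8 -ᵣ_

  _+ᵣ_ : ℝ → ℝ → ℝ
  x +ᵣ y = mkℝ (λ n → seq x n ℚ.+ seq y n) (add-cauchy (seq x) (seq y) (cauchy x) (cauchy y))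

  _*ᵣ_ : ℝ → ℝ → ℝ
  x *ᵣ y = mkℝ (λ n → seq x n ℚ.* seq y n) (mul-cauchy (seq x) (seq y) (cauchy x) (cauchy y))

  -ᵣ_ : ℝ → ℝ
  -ᵣ x = mkℝ (λ n → ℚ.- seq x n) (neg-cauchy (seq x) (cauchy x))

  ∣_∣ᵣ : ℝ → ℝ
  ∣ x ∣ᵣ = mkℝ (λ n → ℚ.∣ seq x n ∣) (abs-cauchy (seq x) (cauchy x))

  _-ᵣ_ : ℝ → ℝ → ℝ
  x -ᵣ y = x +ᵣ (-ᵣ y)

0ᵣ : ℝ
0ᵣ = fromℚ 0ℚ

infix 4 _≃ᵣ_ _≤ᵣ_ _<ᵣ_

_≃ᵣ_ : ℝ → ℝ → Set
x ≃ᵣ y = ∀ ε → 0ℚ ℚ.< ε → Eventually λ n → ℚ.∣ seq x n ℚ.- seq y n ∣ ℚ.≤ ε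

_≤ᵣ_ : ℝ → ℝ → Set
x ≤ᵣ y = ∀ ε → 0ℚ ℚ.< ε → Eventually λ n → seq x n ℚ.≤ seq y n ℚ.+ ε

_<ᵣ_ : ℝ → ℝ → Set
x <ᵣ y = ∃ λ ε → 0ℚ ℚ.< ε × Eventually λ n → seq x n ℚ.+ ε ℚ.≤ seq y n

IsCauchyᵣ : (ℕ → ℝ) → Set
IsCauchyᵣ f = ∀ ε → 0ℚ ℚ.< ε →
  ∃ λ N → ∀ m n → N ℕ.≤ m → N ℕ.≤ n → ∣ f m -ᵣ f n ∣ᵣ ≤ᵣ fromℚ ε

-- The n-th approximant of the limit is within 2/(n+1) of every sufficiently late f m.
lim : (f : ℕ → ℝ) → IsCauchyᵣ f → ℝ
lim f c = mkℝ L L-cauchy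
  where
  open RationalLemmas
  M : ℕ → ℕ
  M n = proj₁ (c (recip n) (recip-pos n))
  P : ℕ → ℕ
  P n = proj₁ (cauchy (f (M n)) (recip n) (recip-pos n))
  L : ℕ → ℚ
  L n = seq (f (M n)) (P n)
  near : ∀ n b → M n ℕ.≤ b → ∀ δ → 0ℚ ℚ.< δ →
         Eventually λ p → ℚ.∣ L n ℚ.- seq (f b) p ∣ ℚ.≤ recip n ℚ.+ (recip n ℚ.+ δ)
  near n b M≤b δ 0<δ =
    let Q , close = proj₂ (c (recip n) (recip-pos n)) (M n) b ℕP.≤-refl M≤b δ 0<δ
    in P n ℕ.⊔ Q , λ p p≥ → ℚP.≤-trans
         (triangle (L n) (seq (f (M n)) p) (seq (f b) p))
         (ℚP.+-mono-≤
           (proj₂ (cauchy (f (M n)) (recip n) (recip-pos n)) (P n) p ℕP.≤-refl (ℕP.m⊔n≤o⇒m≤o (P n) Q p≥))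
           (close p (ℕP.m⊔n≤o⇒n≤o (P n) Q p≥)))
  6ℚ : ℚ
  6ℚ = + 6 ℚ./ 1
  L-cauchy : IsCauchy L
  L-cauchy ε 0<ε = K , λ m n K≤m K≤n →
    let b = M m ℕ.⊔ M n
        Qm , close-m = near m b (ℕP.m≤m⊔n (M m) (M n)) r 0<r
        Qn , close-n = near n b (ℕP.m≤n⊔m (M m) (M n)) r 0<r
        p = Qm ℕ.⊔ Qn
        x = seq (f b) p
    in begin
      ℚ.∣ L m ℚ.- L n ∣
        ≤⟨ triangle (L m) x (L n) ⟩
      ℚ.∣ L m ℚ.- x ∣ ℚ.+ ℚ.∣ x ℚ.- L n ∣
        ≡⟨ cong (ℚ.∣ L m ℚ.- x ∣ ℚ.+_) (dist-sym x (L n)) ⟩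
      ℚ.∣ L m ℚ.- x ∣ ℚ.+ ℚ.∣ L n ℚ.- x ∣
        ≤⟨ ℚP.+-mono-≤ (close-m p (ℕP.m≤m⊔n Qm Qn)) (close-n p (ℕP.m≤n⊔m Qm Qn)) ⟩
      (recip m ℚ.+ (recip m ℚ.+ r)) ℚ.+ (recip n ℚ.+ (recip n ℚ.+ r))
        ≤⟨ ℚP.+-mono-≤ (3r m K≤m) (3r n K≤n) ⟩
      (r ℚ.+ (r ℚ.+ r)) ℚ.+ (r ℚ.+ (r ℚ.+ r))
        ≡⟨ solve 1 (λ r → (r :+ (r :+ r)) :+ (r :+ (r :+ r)) := con 6ℚ :* r) refl r ⟩
      6ℚ ℚ.* r
        ≤⟨ proj₂ small K ℕP.≤-refl ⟩
      ε ∎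
    where
    open ℚP.≤-Reasoning
    open +-*-Solver
    small = scaled-recip 6ℚ ε (ℚP.nonNegative⁻¹ 6ℚ) 0<ε
    K = proj₁ small
    r = recip K
    0<r = recip-pos K
    3r : ∀ m → K ℕ.≤ m → recip m ℚ.+ (recip m ℚ.+ r) ℚ.≤ r ℚ.+ (r ℚ.+ r)
    3r m K≤m = ℚP.+-mono-≤ (recip-anti K≤m) (ℚP.+-monoˡ-≤ r (recip-anti K≤m))

-- π = ∫₀¹ 4/(1+t²) dt, as the limit of left Riemann sums with 2ᵏ equal steps

Σ< : ℕ → (ℕ → ℚ) → ℚ
Σ< zero    g = 0ℚ
Σ< (suc n) g = Σ< n g ℚ.+ g n

4/1+t² : ℚ → ℚ
4/1+t² t = (+ 4 ℚ./ 1) ℚ.÷ (1ℚ ℚ.+ t ℚ.* t)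
  where instance _ = RationalLemmas.1+p²-nonZero t

dyadic : ℕ → ℕ → ℚ
dyadic k j = (+ j ℚ./ 1) ℚ.* RationalLemmas.half k

riemannSum : ℕ → ℚ
riemannSum k = RationalLemmas.half k ℚ.* Σ< (2 ℕ.^ k) (λ j → 4/1+t² (dyadic k j))

module RiemannSumLemmas where
  open RationalLemmas
  open import Data.Rational using (_+_; _*_; _-_; -_; _≤_; _<_; ∣_∣; Positive; 1/_; _/_; _÷_)
  open ℚP.≤-Reasoning

  4ℚ : ℚ
  4ℚ = + 4 / 1

  0≤4 : 0ℚ ≤ 4ℚ
  0≤4 = ℚP.nonNegative⁻¹ 4ℚ

  1/-anti : ∀ a b (pa : Positive a) (pb : Positive b) → a ≤ b →
            (1/ b) {{ℚP.pos⇒nonZero b {{pb}}}} ≤ (1/ a) {{ℚP.pos⇒nonZero a {{pa}}}}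
  1/-anti a b pa pb a≤b = ℚP.*-cancelʳ-≤-pos b {{pb}} (begin
    b⁻¹ * b  ≡⟨ ℚP.*-inverseˡ b {{nb}} ⟩
    1ℚ       ≡⟨ sym (ℚP.*-inverseˡ a {{na}}) ⟩
    a⁻¹ * a  ≤⟨ *-monoˡ (ℚP.<⇒≤ (ℚP.positive⁻¹ a⁻¹ {{ℚP.1/pos⇒pos a {{pa}}}})) a≤b ⟩
    a⁻¹ * b  ∎)
    where
    na : ℚ.NonZero a
    na = ℚP.pos⇒nonZero a {{pa}}
    nb : ℚ.NonZero b
    nb = ℚP.pos⇒nonZero b {{pb}}
    a⁻¹ = (1/ a) {{na}}
    b⁻¹ = (1/ b) {{nb}}

  f : ℚ → ℚ
  f = 4/1+t²

  f-anti : ∀ {s t} → 0ℚ ≤ s → s ≤ t → f t ≤ f s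
  f-anti {s} {t} 0≤s s≤t = *-monoˡ 0≤4
    (1/-anti (1ℚ + s * s) (1ℚ + t * t) (1+p²-pos s) (1+p²-pos t)
      (ℚP.+-monoʳ-≤ 1ℚ (*-mono 0≤s (ℚP.≤-trans 0≤s s≤t) s≤t s≤t)))

  f-nonneg : ∀ t → 0ℚ ≤ f t
  f-nonneg t = *-nonneg 0≤4 (ℚP.<⇒≤
    (ℚP.positive⁻¹ ((1/ (1ℚ + t * t)) {{1+p²-nonZero t}}) {{ℚP.1/pos⇒pos (1ℚ + t * t) {{1+p²-pos t}}}}))

  Σ-even-odd : ∀ g n → Σ< (2 ℕ.* n) g ≡ Σ< n (λ j → g (2 ℕ.* j) + g (suc (2 ℕ.* j)))
  Σ-even-odd g zero    = refl
  Σ-even-odd g (suc n) = trans (cong (λ k → Σ< k g) (ℕP.*-suc 2 n))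
    (trans (ℚP.+-assoc (Σ< (2 ℕ.* n) g) (g (2 ℕ.* n)) (g (suc (2 ℕ.* n))))
      (cong (_+ (g (2 ℕ.* n) + g (suc (2 ℕ.* n)))) (Σ-even-odd g n)))

  -- If h j lies in the interval from a (j+1) to a j, replacing half of Σ (a + a) by Σ (a + h)
  -- changes the sum by at most a 0 - a n.
  Σ-interlace : ∀ (a h : ℕ → ℚ) n → (∀ j → h j ≤ a j) → (∀ j → a (suc j) ≤ h j) →
    (0ℚ ≤ Σ< n (λ j → a j + a j) - Σ< n (λ j → a j + h j)) ×
    (Σ< n (λ j → a j + a j) - Σ< n (λ j → a j + h j) ≤ a 0 - a n)
  Σ-interlace a h zero h≤a a≤h = ℚP.≤-refl , ℚP.≤-reflexive (sym (ℚP.+-inverseʳ (a 0)))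
  Σ-interlace a h (suc n) h≤a a≤h =
    let lo , hi = Σ-interlace a h n h≤a a≤h
        S = Σ< n (λ j → a j + a j)
        T = Σ< n (λ j → a j + h j)
        eq : (S + (a n + a n)) - (T + (a n + h n)) ≡ (S - T) + (a n - h n)
        eq = solve 4 (λ s t a h → (s :+ (a :+ a)) :- (t :+ (a :+ h)) := (s :- t) :+ (a :- h))
               refl S T (a n) (h n)
    in ℚP.≤-trans (+-nonneg lo (0≤q-p (h≤a n))) (ℚP.≤-reflexive (sym eq)) , (begin
      (S + (a n + a n)) - (T + (a n + h n))  ≡⟨ eq ⟩
      (S - T) + (a n - h n)
        ≤⟨ ℚP.+-mono-≤ hi (ℚP.+-monoʳ-≤ (a n) (ℚP.neg-antimono-≤ (a≤h n))) ⟩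
      (a 0 - a n) + (a n - a (suc n))
        ≡⟨ solve 3 (λ x y z → (x :- y) :+ (y :- z) := x :- z) refl (a 0) (a n) (a (suc n)) ⟩
      a 0 - a (suc n) ∎)
    where open +-*-Solver

  fromℕ≃ : ∀ n → ℚ.toℚᵘ (+ n / 1) ℚᵘ.≃ ℚᵘ.mkℚᵘ (+ n) 0
  fromℕ≃ n = ℚP.toℚᵘ-fromℚᵘ (ℚᵘ.mkℚᵘ (+ n) 0)

  fromℕ-mono : ∀ {m n} → m ℕ.≤ n → + m / 1 ≤ + n / 1
  fromℕ-mono {m} {n} m≤n = ℚP.toℚᵘ-cancel-≤
    (ℚᵘP.≤-respˡ-≃ (ℚᵘP.≃-sym (fromℕ≃ m)) (ℚᵘP.≤-respʳ-≃ (ℚᵘP.≃-sym (fromℕ≃ n))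
      (ℚᵘ.*≤* (ℤP.*-monoʳ-≤-nonNeg (+ 1) {+ m} {+ n} (ℤ.+≤+ m≤n)))))

  fromℕ-double : ∀ n → + (2 ℕ.* n) / 1 ≡ (+ 2 / 1) * (+ n / 1)
  fromℕ-double n = ℚP.toℚᵘ-injective
    (ℚᵘP.≃-trans (fromℕ≃ (2 ℕ.* n))
      (ℚᵘP.≃-sym (ℚᵘP.≃-trans (ℚP.toℚᵘ-homo-* (+ 2 / 1) (+ n / 1))
        (ℚᵘP.≃-trans (ℚᵘP.*-congˡ {ℚᵘ.mkℚᵘ (+ 2) 0} (fromℕ≃ n))
          (ℚᵘ.*≡* (cong (ℤ._* + 1) (sym (ℤP.pos-* 2 n))))))))

  dyadic-nonneg : ∀ k j → 0ℚ ≤ dyadic k j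
  dyadic-nonneg k j = *-nonneg (fromℕ-mono {0} {j} ℕ.z≤n) (ℚP.<⇒≤ (half-pos k))

  dyadic-mono : ∀ k {i j} → i ℕ.≤ j → dyadic k i ≤ dyadic k j
  dyadic-mono k i≤j = ℚP.*-monoʳ-≤-nonNeg (half k) {{ℚ.nonNegative (ℚP.<⇒≤ (half-pos k))}} (fromℕ-mono i≤j)

  dyadic-double : ∀ k j → dyadic (suc k) (2 ℕ.* j) ≡ dyadic k j
  dyadic-double k j = trans (cong (_* half (suc k)) (fromℕ-double j))
    (solve 2 (λ j h → (con (+ 2 / 1) :* j) :* (con ½ :* h) := j :* h) refl (+ j / 1) (half k))
    where open +-*-Solver

  Σ-cong : ∀ n {g h : ℕ → ℚ} → (∀ j → g j ≡ h j) → Σ< n g ≡ Σ< n h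
  Σ-cong zero    eq = refl
  Σ-cong (suc n) eq = cong₂ _+_ (Σ-cong n eq) (eq n)

  Σ-double : ∀ n (g : ℕ → ℚ) → Σ< n (λ j → g j + g j) ≡ Σ< n g + Σ< n g
  Σ-double zero    g = refl
  Σ-double (suc n) g = trans (cong (_+ (g n + g n)) (Σ-double n g))
    (solve 2 (λ s x → (s :+ s) :+ (x :+ x) := (s :+ x) :+ (s :+ x)) refl (Σ< n g) (g n))
    where open +-*-Solver

  u : ℕ → ℚ
  u k = 4ℚ * half k

  step : ∀ k → ∣ riemannSum (suc k) - riemannSum k ∣ ≤ u k - u (suc k)
  step k = begin
    ∣ riemannSum (suc k) - riemannSum k ∣
      ≡⟨ dist-sym (riemannSum (suc k)) (riemannSum k) ⟩
    ∣ riemannSum k - riemannSum (suc k) ∣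
      ≡⟨ cong ∣_∣ eq ⟩
    ∣ half (suc k) * D ∣
      ≡⟨ ℚP.0≤p⇒∣p∣≡p (*-nonneg 0≤h (proj₁ bounds)) ⟩
    half (suc k) * D
      ≤⟨ *-monoˡ 0≤h (ℚP.≤-trans (proj₂ bounds) a0-an≤4) ⟩
    half (suc k) * 4ℚ
      ≡⟨ solve 1 (λ h → (con ½ :* h) :* con 4ℚ := con 4ℚ :* h :- con 4ℚ :* (con ½ :* h)) refl (half k) ⟩
    u k - u (suc k) ∎
    where
    open +-*-Solver
    n = 2 ℕ.^ k
    a h : ℕ → ℚ
    a j = f (dyadic k j)
    h j = f (dyadic (suc k) (suc (2 ℕ.* j)))
    0≤h : 0ℚ ≤ half (suc k)
    0≤h = ℚP.<⇒≤ (half-pos (suc k))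
    h≤a : ∀ j → h j ≤ a j
    h≤a j = subst (λ t → h j ≤ f t) (dyadic-double k j)
      (f-anti (dyadic-nonneg (suc k) (2 ℕ.* j)) (dyadic-mono (suc k) (ℕP.n≤1+n (2 ℕ.* j))))
    a≤h : ∀ j → a (suc j) ≤ h j
    a≤h j = subst (λ t → f t ≤ h j) (dyadic-double k (suc j))
      (f-anti (dyadic-nonneg (suc k) (suc (2 ℕ.* j)))
        (dyadic-mono (suc k) (subst (suc (2 ℕ.* j) ℕ.≤_) (sym (ℕP.*-suc 2 j)) (ℕP.n≤1+n (suc (2 ℕ.* j))))))
    D = Σ< n (λ j → a j + a j) - Σ< n (λ j → a j + h j)
    bounds = Σ-interlace a h n h≤a a≤h
    a0≤4 : a 0 ≤ 4ℚ
    a0≤4 = f-anti ℚP.≤-refl (dyadic-nonneg k 0)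
    a0-an≤4 : a 0 - a n ≤ 4ℚ
    a0-an≤4 = begin
      a 0 - a n  ≤⟨ ℚP.+-mono-≤ a0≤4 (ℚP.neg-antimono-≤ (f-nonneg (dyadic k n))) ⟩
      4ℚ - 0ℚ    ≡⟨ ℚP.+-identityʳ 4ℚ ⟩
      4ℚ         ∎
    fine : Σ< (2 ℕ.^ suc k) (λ j → f (dyadic (suc k) j)) ≡ Σ< n (λ j → a j + h j)
    fine = trans (Σ-even-odd (λ j → f (dyadic (suc k) j)) n)
      (Σ-cong n (λ j → cong (λ t → f t + h j) (dyadic-double k j)))
    eq : riemannSum k - riemannSum (suc k) ≡ half (suc k) * D
    eq = trans (cong (λ t → riemannSum k - half (suc k) * t) fine)
      (trans (solve 3 (λ h s t → h :* s :- (con ½ :* h) :* t := (con ½ :* h) :* ((s :+ s) :- t))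
                refl (half k) (Σ< n a) (Σ< n (λ j → a j + h j)))
        (cong (λ t → half (suc k) * (t - Σ< n (λ j → a j + h j))) (sym (Σ-double n a))))

  riemannSum-cauchy : IsCauchy riemannSum
  riemannSum-cauchy ε 0<ε =
    let M , small = scaled-recip 4ℚ (½ * ε) 0≤4 (½pos 0<ε)
    in M , telescope-cauchy riemannSum u 0 (λ k _ → step k) (λ k → *-nonneg 0≤4 (ℚP.<⇒≤ (half-pos k))) ε M ℕ.z≤n
         (ℚP.≤-trans (*-monoˡ 0≤4 (half≤recip M)) (small M ℕP.≤-refl))

π : ℝ
π = mkℝ riemannSum RiemannSumLemmas.riemannSum-cauchy

record ℂ : Set where
  constructor _+i_
  field
    re : ℝ
    im : ℝ

open ℂ public

infix 4 _≃_

_≃_ : ℂ → ℂ → Set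
z ≃ w = re z ≃ᵣ re w × im z ≃ᵣ im w

fromℝ : ℝ → ℂ
fromℝ x = x +i 0ᵣ

fromℤ : ℤ → ℂ
fromℤ n = fromℝ (fromℚ (n ℚ./ 1))

i : ℂ
i = 0ᵣ +i fromℚ 1ℚ

infixl 6 _+_ _-_
infixl 7 _*_
infix  8 -_
infixr 9 _^_

_+_ : ℂ → ℂ → ℂ
z + w = (re z +ᵣ re w) +i (im z +ᵣ im w)

_*_ : ℂ → ℂ → ℂ
z * w = (re z *ᵣ re w -ᵣ im z *ᵣ im w) +i (re z *ᵣ im w +ᵣ im z *ᵣ re w)

-_ : ℂ → ℂ
- z = (-ᵣ re z) +i (-ᵣ im z)

_-_ : ℂ → ℂ → ℂ
z - w = z + (- w)

_^_ : ℂ → ℕ → ℂ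
z ^ zero  = fromℤ (+ 1)
z ^ suc n = z * z ^ n

1/_! : ℕ → ℚ
1/ k ! = + 1 ℚ./ (k !)
  where instance _ = k ℕP.!≢0

expTerm : ℂ → ℕ → ℂ
expTerm z k = fromℝ (fromℚ (1/ k !)) * z ^ k

expPartialSum : ℂ → ℕ → ℂ
expPartialSum z zero    = fromℤ (+ 0)
expPartialSum z (suc n) = expPartialSum z n + expTerm z n

module ExpLemmas where
  open RationalLemmas
  open import Data.Rational as Q using (_≤_; _<_; ∣_∣)
  open ℚP.≤-Reasoning

  size : ℂ → ℕ → ℚ
  size z p = ∣ seq (re z) p ∣ Q.+ ∣ seq (im z) p ∣

  size-nonneg : ∀ z p → 0ℚ ≤ size z p
  size-nonneg z p = +-nonneg (ℚP.0≤∣p∣ (seq (re z) p)) (ℚP.0≤∣p∣ (seq (im z) p))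

  re≤size : ∀ z p → ∣ seq (re z) p ∣ ≤ size z p
  re≤size z p = p≤p+q (ℚP.0≤∣p∣ (seq (im z) p))

  im≤size : ∀ z p → ∣ seq (im z) p ∣ ≤ size z p
  im≤size z p = p≤q+p (ℚP.0≤∣p∣ (seq (re z) p))

  size-* : ∀ z w p → size (z * w) p ≤ size z p Q.* size w p
  size-* z w p = begin
    ∣ a Q.* c Q.- b Q.* d ∣ Q.+ ∣ a Q.* d Q.+ b Q.* c ∣
      ≤⟨ ℚP.+-mono-≤ (ℚP.∣p-q∣≤∣p∣+∣q∣ (a Q.* c) (b Q.* d)) (ℚP.∣p+q∣≤∣p∣+∣q∣ (a Q.* d) (b Q.* c)) ⟩
    (∣ a Q.* c ∣ Q.+ ∣ b Q.* d ∣) Q.+ (∣ a Q.* d ∣ Q.+ ∣ b Q.* c ∣)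
      ≡⟨ cong₂ Q._+_ (cong₂ Q._+_ (ℚP.∣p*q∣≡∣p∣*∣q∣ a c) (ℚP.∣p*q∣≡∣p∣*∣q∣ b d))
                     (cong₂ Q._+_ (ℚP.∣p*q∣≡∣p∣*∣q∣ a d) (ℚP.∣p*q∣≡∣p∣*∣q∣ b c)) ⟩
    (∣ a ∣ Q.* ∣ c ∣ Q.+ ∣ b ∣ Q.* ∣ d ∣) Q.+ (∣ a ∣ Q.* ∣ d ∣ Q.+ ∣ b ∣ Q.* ∣ c ∣)
      ≡⟨ solve 4 (λ a b c d → (a :* c :+ b :* d) :+ (a :* d :+ b :* c) := (a :+ b) :* (c :+ d))
           refl (∣ a ∣) (∣ b ∣) (∣ c ∣) (∣ d ∣) ⟩
    (∣ a ∣ Q.+ ∣ b ∣) Q.* (∣ c ∣ Q.+ ∣ d ∣) ∎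
    where
    open +-*-Solver
    a = seq (re z) p
    b = seq (im z) p
    c = seq (re w) p
    d = seq (im w) p

  -- bound B k = Bᵏ/k!
  bound : ℚ → ℕ → ℚ
  bound B zero    = 1ℚ
  bound B (suc k) = (B Q.* recip k) Q.* bound B k

  bound-nonneg : ∀ {B} → 0ℚ ≤ B → ∀ k → 0ℚ ≤ bound B k
  bound-nonneg 0≤B zero    = 0≤1
  bound-nonneg 0≤B (suc k) = *-nonneg (*-nonneg 0≤B (ℚP.<⇒≤ (recip-pos k))) (bound-nonneg 0≤B k)

  1/!-suc : ∀ k → 1/ suc k ! ≡ recip k Q.* 1/ k !
  1/!-suc k = inv-* (suc k) (k !) {{_}} {{k ℕP.!≢0}} {{suc k ℕP.!≢0}}

  1/!-nonneg : ∀ k → 0ℚ ≤ 1/ k !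
  1/!-nonneg zero    = 0≤1
  1/!-nonneg (suc k) = ℚP.≤-trans (*-nonneg (ℚP.<⇒≤ (recip-pos k)) (1/!-nonneg k))
                                  (ℚP.≤-reflexive (sym (1/!-suc k)))

  1/!*size^≤bound : ∀ z p B → 0ℚ ≤ B → size z p ≤ B → ∀ k → 1/ k ! Q.* size (z ^ k) p ≤ bound B k
  1/!*size^≤bound z p B 0≤B z≤B zero    = ℚP.≤-refl
  1/!*size^≤bound z p B 0≤B z≤B (suc k) = begin
    1/ suc k ! Q.* size (z * z ^ k) p
      ≤⟨ *-monoˡ (1/!-nonneg (suc k)) (ℚP.≤-trans (size-* z (z ^ k) p)
           (ℚP.*-monoʳ-≤-nonNeg (size (z ^ k) p) {{Q.nonNegative (size-nonneg (z ^ k) p)}} z≤B)) ⟩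
    1/ suc k ! Q.* (B Q.* size (z ^ k) p)
      ≡⟨ cong (Q._* (B Q.* size (z ^ k) p)) (1/!-suc k) ⟩
    (recip k Q.* 1/ k !) Q.* (B Q.* size (z ^ k) p)
      ≡⟨ solve 4 (λ r q b s → (r :* q) :* (b :* s) := (b :* r) :* (q :* s)) refl
           (recip k) (1/ k !) B (size (z ^ k) p) ⟩
    (B Q.* recip k) Q.* (1/ k ! Q.* size (z ^ k) p)
      ≤⟨ *-monoˡ (*-nonneg 0≤B (ℚP.<⇒≤ (recip-pos k))) (1/!*size^≤bound z p B 0≤B z≤B k) ⟩
    bound B (suc k) ∎
    where open +-*-Solver

  size-expTerm : ∀ z p B → 0ℚ ≤ B → size z p ≤ B → ∀ k → size (expTerm z k) p ≤ bound B k
  size-expTerm z p B 0≤B z≤B k = begin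
    size (expTerm z k) p
      ≤⟨ size-* (fromℝ (fromℚ (1/ k !))) (z ^ k) p ⟩
    (∣ 1/ k ! ∣ Q.+ 0ℚ) Q.* size (z ^ k) p
      ≡⟨ cong (Q._* size (z ^ k) p) (trans (ℚP.+-identityʳ ∣ 1/ k ! ∣) (ℚP.0≤p⇒∣p∣≡p (1/!-nonneg k))) ⟩
    1/ k ! Q.* size (z ^ k) p
      ≤⟨ 1/!*size^≤bound z p B 0≤B z≤B k ⟩
    bound B k ∎

  series-cauchy : ∀ B → 0ℚ ≤ B → ∀ ε → 0ℚ < ε →
    ∃ λ M → ∀ (s : ℕ → ℚ) → (∀ k → ∣ s (suc k) Q.- s k ∣ ≤ bound B k) →
            ∀ m n → M ℕ.≤ m → M ℕ.≤ n → ∣ s m Q.- s n ∣ ≤ ε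
  series-cauchy B 0≤B ε 0<ε = J ℕ.+ K , λ s s≤ →
    telescope-cauchy s u K (λ n K≤n → ℚP.≤-trans (s≤ n) (drop n K≤n)) 0≤u ε (J ℕ.+ K) (ℕP.m≤n+m K J) small
    where
    open +-*-Solver
    b = bound B
    u : ℕ → ℚ
    u n = b n Q.+ b n
    0≤u : ∀ n → 0ℚ ≤ u n
    0≤u n = +-nonneg (bound-nonneg 0≤B n) (bound-nonneg 0≤B n)
    ratio = scaled-recip B ½ 0≤B (ℚP.positive⁻¹ ½)
    K = proj₁ ratio
    halve : ∀ n → K ℕ.≤ n → b (suc n) ≤ ½ Q.* b n
    halve n K≤n = ℚP.*-monoʳ-≤-nonNeg (b n) {{Q.nonNegative (bound-nonneg 0≤B n)}} (proj₂ ratio n K≤n)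
    drop : ∀ n → K ℕ.≤ n → b n ≤ u n Q.- u (suc n)
    drop n K≤n = begin
      b n
        ≡⟨ solve 1 (λ x → x := (x :+ x) :- (con ½ :* x :+ con ½ :* x)) refl (b n) ⟩
      u n Q.- (½ Q.* b n Q.+ ½ Q.* b n)
        ≤⟨ ℚP.+-monoʳ-≤ (u n) (ℚP.neg-antimono-≤ (ℚP.+-mono-≤ (halve n K≤n) (halve n K≤n))) ⟩
      u n Q.- u (suc n) ∎
    decay : ∀ j → b (j ℕ.+ K) ≤ b K Q.* half j
    decay zero    = ℚP.≤-reflexive (sym (ℚP.*-identityʳ (b K)))
    decay (suc j) = begin
      b (suc (j ℕ.+ K))       ≤⟨ halve (j ℕ.+ K) (ℕP.m≤n+m K j) ⟩
      ½ Q.* b (j ℕ.+ K)       ≤⟨ *-monoˡ (ℚP.nonNegative⁻¹ ½) (decay j) ⟩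
      ½ Q.* (b K Q.* half j)  ≡⟨ solve 2 (λ x y → con ½ :* (x :* y) := x :* (con ½ :* y)) refl (b K) (half j) ⟩
      b K Q.* half (suc j)    ∎
    tail = scaled-recip (u K) (½ Q.* ε) (0≤u K) (½pos 0<ε)
    J = proj₁ tail
    small : u (J ℕ.+ K) ≤ ½ Q.* ε
    small = begin
      u (J ℕ.+ K)                         ≤⟨ ℚP.+-mono-≤ (decay J) (decay J) ⟩
      b K Q.* half J Q.+ b K Q.* half J   ≡⟨ sym (ℚP.*-distribʳ-+ (half J) (b K) (b K)) ⟩
      u K Q.* half J                      ≤⟨ *-monoˡ (0≤u K) (half≤recip J) ⟩
      u K Q.* recip J                     ≤⟨ proj₂ tail J ℕP.≤-refl ⟩
      ½ Q.* ε                             ∎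

  size-bounded : ∀ z → ∃ λ B → 0ℚ ≤ B × Eventually λ p → size z p ≤ B
  size-bounded z =
    let B₁ , 0≤B₁ , N₁ , b₁ = cauchy-bounded (seq (re z)) (cauchy (re z))
        B₂ , 0≤B₂ , N₂ , b₂ = cauchy-bounded (seq (im z)) (cauchy (im z))
    in B₁ Q.+ B₂ , +-nonneg 0≤B₁ 0≤B₂ , N₁ ℕ.⊔ N₂ , λ p p≥ →
         ℚP.+-mono-≤ (b₁ p (ℕP.m⊔n≤o⇒m≤o N₁ N₂ p≥)) (b₂ p (ℕP.m⊔n≤o⇒n≤o N₁ N₂ p≥))

  cancel : ∀ a b → (a Q.+ b) Q.- a ≡ b
  cancel = solve 2 (λ a b → (a :+ b) :- a := b) refl
    where open +-*-Solver

  re-cauchy : ∀ z → IsCauchyᵣ λ n → re (expPartialSum z n)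
  re-cauchy z ε 0<ε =
    let B , 0≤B , P , z≤B = size-bounded z
        M , close = series-cauchy B 0≤B ε 0<ε
    in M , λ m n M≤m M≤n δ 0<δ → P , λ p P≤p → ℚP.≤-trans
         (close (λ k → seq (re (expPartialSum z k)) p)
           (λ k → ℚP.≤-trans
              (ℚP.≤-reflexive (cong ∣_∣ (cancel (seq (re (expPartialSum z k)) p) (seq (re (expTerm z k)) p))))
              (ℚP.≤-trans (re≤size (expTerm z k) p) (size-expTerm z p B 0≤B (z≤B p P≤p) k)))
           m n M≤m M≤n)
         (p≤p+q (ℚP.<⇒≤ 0<δ))

  im-cauchy : ∀ z → IsCauchyᵣ λ n → im (expPartialSum z n)
  im-cauchy z ε 0<ε =
    let B , 0≤B , P , z≤B = size-bounded z
        M , close = series-cauchy B 0≤B ε 0<ε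
    in M , λ m n M≤m M≤n δ 0<δ → P , λ p P≤p → ℚP.≤-trans
         (close (λ k → seq (im (expPartialSum z k)) p)
           (λ k → ℚP.≤-trans
              (ℚP.≤-reflexive (cong ∣_∣ (cancel (seq (im (expPartialSum z k)) p) (seq (im (expTerm z k)) p))))
              (ℚP.≤-trans (im≤size (expTerm z k) p) (size-expTerm z p B 0≤B (z≤B p P≤p) k)))
           m n M≤m M≤n)
         (p≤p+q (ℚP.<⇒≤ 0<δ))

exp : ℂ → ℂ
exp z = lim (λ n → re (expPartialSum z n)) (ExpLemmas.re-cauchy z)
     +i lim (λ n → im (expPartialSum z n)) (ExpLemmas.im-cauchy z)

Σ-over : {A : Set} → (A → ℂ) → List A → ℂ
Σ-over f []       = fromℤ (+ 0)
Σ-over f (a ∷ as) = f a + Σ-over f as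

-- Unordered summation: the sums over finite sets of indices (lists without repetition) converge
-- to s along inclusion. Convergence in ℂ is tested on real and imaginary parts.
HasSum : {A : Set} → (A → ℂ) → ℂ → Set
HasSum {A} f s = ∀ ε → 0ℚ ℚ.< ε → ∃ λ (F : List A) → ∀ (G : List A) → Unique G →
  (∀ {a} → a ∈ F → a ∈ G) →
  ∣ re (Σ-over f G) -ᵣ re s ∣ᵣ ≤ᵣ fromℚ ε × ∣ im (Σ-over f G) -ᵣ im s ∣ᵣ ≤ᵣ fromℚ ε

q^ : ℂ → ℝ → ℂ
q^ τ r = exp (fromℝ π * i * fromℝ r * τ)

2i : ℂ
2i = fromℤ (+ 2) * i

π/3 : ℂ
π/3 = fromℝ (π *ᵣ fromℚ (+ 1 ℚ./ 3))

C-exponent : ℤ → ℤ → ℚ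
C-exponent k ℓ = (+ 2 ℚ./ 1) ℚ.*
  ((ℓ ℤ.* ℓ ℤ.+ ℓ ℤ.* k ℤ.+ k ℤ.* k ℤ.+ k ℤ.+ ℓ) ℚ./ 1 ℚ.+ + 1 ℚ./ 3)

C-term : ℂ → ℂ → ℂ → ℤ × ℤ → ℂ
C-term τ x y (k , ℓ) =
  q^ τ (fromℚ (C-exponent k ℓ))
    * exp (2i * x * fromℤ (+ 2 ℤ.* ℓ ℤ.+ k))
    * exp (2i * y * fromℤ (+ 2 ℤ.* k ℤ.+ ℓ))

-- C is the function (x , y) ↦ C(x,y|τ). Limits being unique, this determines each value C x y up to _≃_.
IsC : ℂ → (ℂ → ℂ → ℂ) → Set
IsC τ C = ∀ x y → ∃ λ S → HasSum (C-term τ x y) S × C x y ≃ exp (2i * x) * exp (2i * y) * S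

{-
With E(k,ℓ) = q^(2(ℓ²+ℓk+k²+k+ℓ+1/3)) e^(2ix(2ℓ+k+1)) e^(2iy(2k+ℓ+1)), the cube of C(x,y|τ) is the sum
of the products E(k₁,ℓ₁) E(k₂,ℓ₂) E(k₃,ℓ₃) over all triples of lattice points. Let d = Σ ℓ - Σ k.
Shifting x by π/3 multiplies the product by e^(-2πid/3), so it has no effect if 3 divides d. For
the other triples there is an explicit involution φ which keeps the exponent of q and negates the
exponents of e^(2ix) and e^(2iy). Hence the triples with d not divisible by 3 contribute nothing to
C³(x,y) - C³(-x,-y), for any x, and those with d divisible by 3 contribute the same to both sides.

The sum converges absolutely because the real part of the exponent of a term is at most
M - 2(|k| + |ℓ|) for some M, by completing squares. Everything about exp comes from its series:
exp(z + w) = exp z exp w is the comparison of two exhaustions of ℕ × ℕ, by squares and by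
triangles, and exp(2πi) = 1 holds because for κ = ±i the function (1 + κt) exp(-∫₀ᵗ κ/(1+κs) ds)
is constant up to the error of its Riemann sums.
-}

module Submission where

open import Level using (0ℓ)
open import Algebra.Bundles using (CommutativeRing)
open import Algebra.Structures using (IsMagma; IsSemigroup; IsMonoid; IsGroup; IsAbelianGroup; IsRing; IsCommutativeRing)
import Algebra.Properties.Ring as RingProperties
import Algebra.Solver.Ring as RingSolver
import Algebra.Solver.Ring.AlmostCommutativeRing as ACR
open import Data.Empty using (⊥; ⊥-elim)
open import Data.Nat as ℕ using (ℕ; zero; suc)
import Data.Nat.Properties as ℕP
open import Data.Integer as ℤ using (ℤ; +_; -[1+_])
import Data.Integer.Properties as ℤP
import Data.Integer.DivMod as ℤD
open import Data.Integer.Solver using () renaming (module +-*-Solver to ℤ-Solver)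
open import Data.Fin using (Fin; zero; suc; toℕ; fromℕ<)
open import Data.Fin.Properties using (toℕ-fromℕ<; toℕ-injective; all?)
open import Data.Rational as ℚ using (ℚ; 0ℚ; 1ℚ; ½)
import Data.Rational.Properties as ℚP
import Data.Rational.Unnormalised as ℚᵘ
import Data.Rational.Unnormalised.Properties as ℚᵘP
open import Data.Rational.Solver using () renaming (module +-*-Solver to ℚ-Solver)
open import Data.Maybe using (Maybe; just; nothing)
open import Data.Product using (∃; _×_; _,_; proj₁; proj₂)
open import Data.Sum using (_⊎_; inj₁; inj₂)
open import Data.List using (List; []; _∷_; _++_; map; downFrom; cartesianProduct)
import Data.List.Properties as ListP
open import Data.List.Membership.Propositional using (_∈_)
open import Data.List.Membership.Propositional.Properties
open import Data.List.Relation.Unary.Any using (here; there)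
open import Data.List.Relation.Unary.All as All using (All; []; _∷_)
open import Data.List.Relation.Unary.AllPairs using ([]; _∷_)
open import Data.List.Relation.Unary.Unique.Propositional using (Unique)
import Data.List.Relation.Unary.Unique.Propositional.Properties as UniqueP
open import Data.List.Relation.Binary.Permutation.Propositional using (_↭_; ↭-refl; ↭-trans; prep; refl; swap; trans)
open import Data.List.Relation.Binary.Permutation.Propositional.Properties using (∈-resp-↭; shift)
open import Function using (_∘_; id; case_of_; _|>_)
open import Relation.Binary.Structures using (IsEquivalence)
open import Relation.Nullary using (¬_; yes; no)
open import Relation.Nullary.Decidable using (toWitness)
open import Relation.Binary.PropositionalEquality as ≡ using (_≡_; cong; cong₂; subst; subst₂)
open import Defs using (Eventually; IsCauchy; module RationalLemmas; module ExpLemmas; module RiemannSumLemmas; riemannSum; dyadic; 4/1+t²; Σ<; C-exponent)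
open RationalLemmas

-- Put a = k + 1/3 and b = ℓ + 1/3. The exponent of q in E(k,ℓ) is then a² + b² + (a+b)², the norm
-- form of the hexagonal lattice, and the other two exponents are linear in (a,b). Negating (a,b)
-- would exchange (x,y) with (-x,-y), but it does not preserve ℤ + 1/3. A triple leaves more room:
-- negate only its centroid, and rotate the three deviations from the centroid by 60°. This keeps
-- the total of the norms and negates the two linear weights, which see only the centroid. The new
-- points lie in the shifted lattice exactly when the direction of rotation fits: one direction for
-- d ≡ 1, the opposite one for d ≡ 2 mod 3. For 3 dividing d neither works, and these are the
-- triples on which the shift by π/3 is invisible. The map changes the sign of d, so doing it twice
-- rotates back.

private variable
  A B : Set

-- Finite sums

module FiniteSums (R : CommutativeRing 0ℓ 0ℓ) where
  open CommutativeRing R renaming (refl to ≈-refl; sym to ≈-sym; trans to ≈-trans)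
  open RingProperties ring using (-‿+-comm; -0#≈0#)

  private variable
    f g : A → Carrier

  Σ : (A → Carrier) → List A → Carrier
  Σ f []       = 0#
  Σ f (a ∷ as) = f a + Σ f as

  Σ-cong : (∀ a → f a ≈ g a) → ∀ as → Σ f as ≈ Σ g as
  Σ-cong f≈g []       = ≈-refl
  Σ-cong f≈g (a ∷ as) = +-cong (f≈g a) (Σ-cong f≈g as)

  Σ-++ : ∀ (f : A → Carrier) as bs → Σ f (as ++ bs) ≈ Σ f as + Σ f bs
  Σ-++ f []       bs = ≈-sym (+-identityˡ _)
  Σ-++ f (a ∷ as) bs = ≈-trans (+-congˡ (Σ-++ f as bs)) (≈-sym (+-assoc _ _ _))

  Σ-↭ : ∀ (f : A → Carrier) {as bs} → as ↭ bs → Σ f as ≈ Σ f bs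
  Σ-↭ f refl          = ≈-refl
  Σ-↭ f (prep a p)    = +-congˡ (Σ-↭ f p)
  Σ-↭ f (swap a b p)  = ≈-trans (≈-sym (+-assoc _ _ _))
    (≈-trans (+-cong (+-comm _ _) (Σ-↭ f p)) (+-assoc _ _ _))
  Σ-↭ f (trans p q)   = ≈-trans (Σ-↭ f p) (Σ-↭ f q)

  Σ-map : ∀ (f : B → Carrier) (φ : A → B) as → Σ f (map φ as) ≡ Σ (f ∘ φ) as
  Σ-map f φ []       = ≡.refl
  Σ-map f φ (a ∷ as) = cong (λ s → f (φ a) + s) (Σ-map f φ as)

  Σ-* : ∀ c (f : A → Carrier) as → Σ (λ a → c * f a) as ≈ c * Σ f as
  Σ-* c f []       = ≈-sym (zeroʳ c)
  Σ-* c f (a ∷ as) = ≈-trans (+-congˡ (Σ-* c f as)) (≈-sym (distribˡ _ _ _))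

  Σ-+ : ∀ (f g : A → Carrier) as → Σ (λ a → f a + g a) as ≈ Σ f as + Σ g as
  Σ-+ f g []       = ≈-sym (+-identityˡ _)
  Σ-+ f g (a ∷ as) = ≈-trans (+-congˡ (Σ-+ f g as)) (≈-trans (+-assoc _ _ _)
    (≈-trans (+-congˡ (≈-trans (≈-sym (+-assoc _ _ _)) (≈-trans (+-congʳ (+-comm _ _)) (+-assoc _ _ _))))
      (≈-sym (+-assoc _ _ _))))

  Σ-neg : ∀ (f : A → Carrier) as → Σ (λ a → - f a) as ≈ - Σ f as
  Σ-neg f []       = ≈-sym -0#≈0#
  Σ-neg f (a ∷ as) = ≈-trans (+-congˡ (Σ-neg f as)) (-‿+-comm _ _)

  Σ-× : ∀ (f : A → Carrier) (g : B → Carrier) as bs →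
    Σ (λ (a , b) → f a * g b) (cartesianProduct as bs) ≈ Σ f as * Σ g bs
  Σ-× f g []       bs = ≈-sym (zeroˡ _)
  Σ-× f g (a ∷ as) bs = ≈-trans (Σ-++ _ (map (a ,_) bs) (cartesianProduct as bs))
    (≈-trans (+-cong (≈-trans (reflexive (Σ-map _ (a ,_) bs)) (Σ-* (f a) g bs)) (Σ-× f g as bs))
      (≈-sym (distribʳ _ _ _)))

-- Finite index sets and exhaustions

infix 4 _⊆_

_⊆_ : List A → List A → Set
as ⊆ bs = ∀ {a} → a ∈ as → a ∈ bs

-- Sums do not depend on the order of the list, so the sums over `G` and `F` differ by the sum over
-- `H`. Every tail estimate goes through this.
complement : ∀ {F G : List A} → Unique F → F ⊆ G → ∃ λ H → G ↭ F ++ H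
complement {F = []}    []        F⊆G = _ , ↭-refl
complement {F = x ∷ F} (x∉F ∷ u) F⊆G with ∈-∃++ (F⊆G (here ≡.refl))
... | ys , zs , ≡.refl =
  -- By uniqueness `x` is not in `F`, so the entries of `F` survive when this occurrence of `x` is
  -- removed from `G`.
  let H , p = complement u (λ {a} a∈F → drop-head (λ { ≡.refl → All.lookup x∉F a∈F ≡.refl }) (∈-resp-↭ σ (F⊆G (there a∈F))))
  in H , ↭-trans σ (prep x p)
  where
  σ = shift x ys zs
  drop-head : ∀ {a} → ¬ a ≡ x → a ∈ x ∷ ys ++ zs → a ∈ ys ++ zs
  drop-head a≢x (here a≡x) = ⊥-elim (a≢x a≡x)
  drop-head a≢x (there a∈) = a∈

record Exhaustion (A : Set) : Set where
  field
    stage  : ℕ → List A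
    unique : ∀ n → Unique (stage n)
    mono   : ∀ {m n} → m ℕ.≤ n → stage m ⊆ stage n
    covers : ∀ a → ∃ λ n → a ∈ stage n

  -- The stages are cofinal among finite lists; this turns unordered sums into limits of sequences.
  covers-list : ∀ G → ∃ λ n → G ⊆ stage n
  covers-list []      = 0 , λ ()
  covers-list (a ∷ G) =
    let m , a∈ = covers a
        n , G⊆ = covers-list G
    in m ℕ.⊔ n , λ where
      (here ≡.refl) → mono (ℕP.m≤m⊔n m n) a∈
      (there b∈)    → mono (ℕP.m≤n⊔m m n) (G⊆ b∈)

open Exhaustion

infixr 4 _⊗_

-- The stages are rectangles, so that `Σ-×` factors the sum of a product over a stage.
_⊗_ : Exhaustion A → Exhaustion B → Exhaustion (A × B)
(E ⊗ E′) .stage n = cartesianProduct (stage E n) (stage E′ n)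
(E ⊗ E′) .unique n = UniqueP.cartesianProduct⁺ (unique E n) (unique E′ n)
(E ⊗ E′) .mono {m} {n} m≤n ab∈ =
  let a∈ , b∈ = ∈-cartesianProduct⁻ (stage E m) (stage E′ m) ab∈
  in ∈-cartesianProduct⁺ (mono E m≤n a∈) (mono E′ m≤n b∈)
(E ⊗ E′) .covers (a , b) =
  let m , a∈ = covers E a
      n , b∈ = covers E′ b
  in m ℕ.⊔ n , ∈-cartesianProduct⁺ (mono E (ℕP.m≤m⊔n m n) a∈) (mono E′ (ℕP.m≤n⊔m m n) b∈)

nested⇒mono : (K : ℕ → List A) → (∀ n → K n ⊆ K (suc n)) → ∀ {m n} → m ℕ.≤ n → K m ⊆ K n
nested⇒mono K step {m} {n} m≤n with ℕP.m≤n⇒m<n∨m≡n m≤n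
... | inj₂ ≡.refl = id
... | inj₁ (ℕ.s≤s m≤n′) = step _ ∘ nested⇒mono K step m≤n′

downFrom-exhaustion : Exhaustion ℕ
downFrom-exhaustion .stage n  = downFrom n
downFrom-exhaustion .unique n = UniqueP.downFrom⁺ n
downFrom-exhaustion .mono     = nested⇒mono downFrom (λ n → there)
downFrom-exhaustion .covers n = suc n , here ≡.refl

-- Summable rational majorants

module ℚΣ = FiniteSums ℚP.+-*-commutativeRing

NonNegative : (A → ℚ) → Set
NonNegative b = ∀ a → 0ℚ ℚ.≤ b a

Σ-nonneg : ∀ {b : A → ℚ} → NonNegative b → ∀ as → 0ℚ ℚ.≤ ℚΣ.Σ b as
Σ-nonneg 0≤b []       = ℚP.≤-refl
Σ-nonneg 0≤b (a ∷ as) = +-nonneg (0≤b a) (Σ-nonneg 0≤b as)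

Σ-⊆ : ∀ {b : A → ℚ} → NonNegative b → ∀ {F G} → Unique F → F ⊆ G → ℚΣ.Σ b F ℚ.≤ ℚΣ.Σ b G
Σ-⊆ {b = b} 0≤b {F} {G} u F⊆G =
  let H , σ = complement u F⊆G
  in ℚP.≤-trans (p≤p+q (Σ-nonneg 0≤b H))
       (ℚP.≤-reflexive (≡.sym (≡.trans (ℚΣ.Σ-↭ b σ) (ℚΣ.Σ-++ b F H))))

-- The norm used below is only a relation to rational bounds, so there is no series of norms to add
-- up. Absolute convergence means being dominated by such a rational `b`.
record Summable (E : Exhaustion A) (b : A → ℚ) : Set where
  field
    nonneg : NonNegative b
    cauchyΣ : IsCauchy λ n → ℚΣ.Σ b (stage E n)

open Summable

⊗-summable : ∀ {E : Exhaustion A} {E′ : Exhaustion B} {b c} → Summable E b → Summable E′ c →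
  Summable (E ⊗ E′) λ (x , y) → b x ℚ.* c y
⊗-summable sb sc .nonneg (x , y) = *-nonneg (nonneg sb x) (nonneg sc y)
⊗-summable {E = E} {E′} {b} {c} sb sc .cauchyΣ ε 0<ε =
  let N , close = mul-cauchy (λ n → ℚΣ.Σ b (stage E n)) (λ n → ℚΣ.Σ c (stage E′ n)) (cauchyΣ sb) (cauchyΣ sc) ε 0<ε
      eq = λ n → ≡.sym (ℚΣ.Σ-× b c (stage E n) (stage E′ n))
  in N , λ m n N≤m N≤n → subst₂ (λ s t → ℚ.∣ s ℚ.- t ∣ ℚ.≤ ε) (eq m) (eq n) (close m n N≤m N≤n)

p≤∣p∣ : ∀ p → p ℚ.≤ ℚ.∣ p ∣
p≤∣p∣ p with ℚP.≤-total 0ℚ p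
... | inj₁ 0≤p = ℚP.≤-reflexive (≡.sym (ℚP.0≤p⇒∣p∣≡p 0≤p))
... | inj₂ p≤0 = ℚP.≤-trans p≤0 (ℚP.0≤∣p∣ p)

-- All of `G` lies in some later stage, and the terms are nonnegative, so the sum over `H` is at
-- most the difference of two partial sums along the exhaustion.
tail-bound : ∀ {E : Exhaustion A} {b} → Summable E b → ∀ ε → 0ℚ ℚ.< ε →
  Eventually λ n → ∀ {G H} → Unique G → G ↭ stage E n ++ H → ℚΣ.Σ b H ℚ.≤ ε
tail-bound {E = E} {b} sb ε 0<ε =
  let N , close = cauchyΣ sb ε 0<ε
  in N , λ n N≤n {G} {H} uG σ →
    let m , G⊆ = covers-list E G
        S  = ℚΣ.Σ b
        Kn = stage E n
        M  = m ℕ.⊔ n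
        KM = stage E M
        eq : S G ≡ S Kn ℚ.+ S H
        eq = ≡.trans (ℚΣ.Σ-↭ b σ) (ℚΣ.Σ-++ b Kn H)
    in begin
      S H                      ≡⟨ solve 2 (λ k h → h := (k :+ h) :- k) ≡.refl (S Kn) (S H) ⟩
      (S Kn ℚ.+ S H) ℚ.- S Kn  ≡⟨ cong (ℚ._- S Kn) (≡.sym eq) ⟩
      S G ℚ.- S Kn             ≤⟨ ℚP.+-monoˡ-≤ (ℚ.- S Kn) (Σ-⊆ (nonneg sb) uG (mono E (ℕP.m≤m⊔n m n) ∘ G⊆)) ⟩
      S KM ℚ.- S Kn            ≤⟨ p≤∣p∣ (S KM ℚ.- S Kn) ⟩
      ℚ.∣ S KM ℚ.- S Kn ∣      ≤⟨ close M n (ℕP.≤-trans N≤n (ℕP.m≤n⊔m m n)) N≤n ⟩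
      ε                        ∎
  where
  open ℚP.≤-Reasoning
  open ℚ-Solver

-- Normed rings with rational bounds

record IsNormedRing {C : Set} (_≈_ : C → C → Set) (_+_ _*_ : C → C → C) (-_ : C → C) (0# 1# : C)
                    (ι : ℚ → C) (‖_‖≤_ : C → ℚ → Set) : Set where
  field
    isCommutativeRing : IsCommutativeRing _≈_ _+_ _*_ -_ 0# 1#
    ι-+   : ∀ p q → ι (p ℚ.+ q) ≈ (ι p + ι q)
    ι-*   : ∀ p q → ι (p ℚ.* q) ≈ (ι p * ι q)
    ι-neg : ∀ p → ι (ℚ.- p) ≈ (- ι p)
    ι-0   : ι 0ℚ ≈ 0#
    ι-1   : ι 1ℚ ≈ 1#
    ‖‖-cong   : ∀ {x y q} → x ≈ y → ‖ x ‖≤ q → ‖ y ‖≤ q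
    ‖‖-mono   : ∀ {x p q} → p ℚ.≤ q → ‖ x ‖≤ p → ‖ x ‖≤ q
    ‖‖-nonneg : ∀ {x q} → ‖ x ‖≤ q → 0ℚ ℚ.≤ q
    ‖‖-+ : ∀ {x y p q} → ‖ x ‖≤ p → ‖ y ‖≤ q → ‖ x + y ‖≤ (p ℚ.+ q)
    ‖‖-* : ∀ {x y p q} → ‖ x ‖≤ p → ‖ y ‖≤ q → ‖ x * y ‖≤ (p ℚ.* q)
    ‖ι‖  : ∀ p → ‖ ι p ‖≤ ℚ.∣ p ∣
    ‖‖-closed : ∀ {x q} → (∀ δ → 0ℚ ℚ.< δ → ‖ x ‖≤ (q ℚ.+ δ)) → ‖ x ‖≤ q
    ‖‖-zero   : ∀ {x} → ‖ x ‖≤ 0ℚ → x ≈ 0#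
    bounded   : ∀ x → ∃ λ q → ‖ x ‖≤ q
    complete  : ∀ (s : ℕ → C) →
      (∀ ε → 0ℚ ℚ.< ε → ∃ λ N → ∀ m n → N ℕ.≤ m → N ℕ.≤ n → ‖ s m + (- s n) ‖≤ ε) →
      ∃ λ l → ∀ ε → 0ℚ ℚ.< ε → Eventually λ n → ‖ s n + (- l) ‖≤ ε

record NormedRing : Set₁ where
  infix 4 _≈_ ‖_‖≤_
  infixl 6 _+_
  infixl 7 _*_
  infix 8 -_
  field
    {Carrier} : Set
    {_≈_}  : Carrier → Carrier → Set
    {_+_}  : Carrier → Carrier → Carrier
    {_*_}  : Carrier → Carrier → Carrier
    { -_}   : Carrier → Carrier
    {0#}   : Carrier
    {1#}   : Carrier
    {ι}    : ℚ → Carrier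
    {‖_‖≤_} : Carrier → ℚ → Set
    isNormedRing : IsNormedRing _≈_ _+_ _*_ -_ 0# 1# ι ‖_‖≤_
  open IsNormedRing isNormedRing public hiding (isCommutativeRing)

  commutativeRing : CommutativeRing 0ℓ 0ℓ
  commutativeRing = record { isCommutativeRing = IsNormedRing.isCommutativeRing isNormedRing }

  open CommutativeRing commutativeRing public
    hiding (Carrier; _≈_; _+_; _*_; -_; 0#; 1#; zero)
    renaming (refl to ≈-refl; sym to ≈-sym; trans to ≈-trans)

  Cauchy : (ℕ → Carrier) → Set
  Cauchy s = ∀ ε → 0ℚ ℚ.< ε → ∃ λ N → ∀ m n → N ℕ.≤ m → N ℕ.≤ n → ‖ s m - s n ‖≤ ε

  infix 4 _⟶_

  _⟶_ : (ℕ → Carrier) → Carrier → Set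
  s ⟶ l = ∀ ε → 0ℚ ℚ.< ε → Eventually λ n → ‖ s n - l ‖≤ ε

  cauchy⇒convergent : ∀ s → Cauchy s → ∃ λ l → s ⟶ l
  cauchy⇒convergent = complete

  ι-morphism : ℚP.+-*-rawRing ACR.-Raw-AlmostCommutative⟶ ACR.fromCommutativeRing commutativeRing
  ι-morphism = record { ⟦_⟧ = ι ; +-homo = ι-+ ; *-homo = ι-* ; -‿homo = ι-neg ; 0-homo = ι-0 ; 1-homo = ι-1 }

  coefficient-≟ : ∀ p q → Maybe (ι p ≈ ι q)
  coefficient-≟ p q with p ℚP.≟ q
  ... | yes p≡q = just (reflexive (cong ι p≡q))
  ... | no _    = nothing

  module Solver = RingSolver ℚP.+-*-rawRing (ACR.fromCommutativeRing commutativeRing) ι-morphism coefficient-≟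

  ‖‖-≡ : ∀ {x p q} → p ≡ q → ‖ x ‖≤ p → ‖ x ‖≤ q
  ‖‖-≡ ≡.refl h = h

-- Limits and unordered sums

module Limits (R : NormedRing) where
  open NormedRing R
  open FiniteSums commutativeRing public
  open Solver

  private variable
    x y z : Carrier
    s t : ℕ → Carrier

  ‖neg‖ : ∀ {q} → ‖ x ‖≤ q → ‖ - x ‖≤ q
  ‖neg‖ {x} {q} h = ‖‖-cong (solve 1 (λ x → con (ℚ.- 1ℚ) :* x := :- x) ≈-refl x)
    (‖‖-≡ (ℚP.*-identityˡ q) (‖‖-* (‖ι‖ (ℚ.- 1ℚ)) h))

  ‖-‖ : ∀ {p q} → ‖ x ‖≤ p → ‖ y ‖≤ q → ‖ x - y ‖≤ (p ℚ.+ q)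
  ‖-‖ a b = ‖‖-+ a (‖neg‖ b)

  dist-swap : ∀ {q} → ‖ x - y ‖≤ q → ‖ y - x ‖≤ q
  dist-swap {x} {y} h = ‖‖-cong (solve 2 (λ x y → :- (x :- y) := y :- x) ≈-refl x y) (‖neg‖ h)

  dist-trans : ∀ {p q} → ‖ x - y ‖≤ p → ‖ y - z ‖≤ q → ‖ x - z ‖≤ (p ℚ.+ q)
  dist-trans {x} {y} {z} a b =
    ‖‖-cong (solve 3 (λ x y z → (x :- y) :+ (y :- z) := x :- z) ≈-refl x y z) (‖‖-+ a b)

  ‖0‖ : ‖ 0# ‖≤ 0ℚ
  ‖0‖ = ‖‖-cong ι-0 (‖ι‖ 0ℚ)

  x-y≈0⇒x≈y : x - y ≈ 0# → x ≈ y
  x-y≈0⇒x≈y {x} {y} e = ≈-trans (solve 2 (λ x y → x := (x :- y) :+ y) ≈-refl x y)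
    (≈-trans (+-congʳ e) (+-identityˡ y))

  ≈⇒‖-‖ : x ≈ y → ‖ x - y ‖≤ 0ℚ
  ≈⇒‖-‖ {x} {y} e = ‖‖-cong (≈-sym (≈-trans (+-congʳ e) (-‿inverseʳ y))) ‖0‖

  ‖‖-small : (∀ ε → 0ℚ ℚ.< ε → ‖ x - y ‖≤ ε) → x ≈ y
  ‖‖-small h = x-y≈0⇒x≈y (‖‖-zero (‖‖-closed λ δ 0<δ →
    ‖‖-≡ (≡.sym (ℚP.+-identityˡ δ)) (h δ 0<δ)))

  halves : ∀ {ε} → ‖ x ‖≤ (½ ℚ.* ε ℚ.+ ½ ℚ.* ε) → ‖ x ‖≤ ε
  halves {ε = ε} = ‖‖-≡ (½+½ ε)

  ⟶-unique : s ⟶ x → s ⟶ y → x ≈ y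
  ⟶-unique a b = ‖‖-small λ ε 0<ε →
    let M , p = a _ (½pos 0<ε)
        N , q = b _ (½pos 0<ε)
    in halves (dist-trans (dist-swap (p (M ℕ.⊔ N) (ℕP.m≤m⊔n M N))) (q (M ℕ.⊔ N) (ℕP.m≤n⊔m M N)))

  ⟶-cong-from : ∀ N → (∀ n → N ℕ.≤ n → s n ≈ t n) → s ⟶ x → t ⟶ x
  ⟶-cong-from N e a ε 0<ε =
    let M , p = a ε 0<ε
    in M ℕ.⊔ N , λ n h → ‖‖-cong (+-congʳ (e n (ℕP.m⊔n≤o⇒n≤o M N h))) (p n (ℕP.m⊔n≤o⇒m≤o M N h))

  ⟶-cong : (∀ n → s n ≈ t n) → s ⟶ x → t ⟶ x
  ⟶-cong e = ⟶-cong-from 0 λ n _ → e n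

  ⟶-resp : x ≈ y → s ⟶ x → s ⟶ y
  ⟶-resp e a ε 0<ε =
    let M , p = a ε 0<ε
    in M , λ n h → ‖‖-cong (+-congˡ (-‿cong e)) (p n h)

  ⟶-const : ∀ x → (λ _ → x) ⟶ x
  ⟶-const x ε 0<ε = 0 , λ n _ → ‖‖-mono (ℚP.<⇒≤ 0<ε) (≈⇒‖-‖ ≈-refl)

  ⟶-+ : s ⟶ x → t ⟶ y → (λ n → s n + t n) ⟶ (x + y)
  ⟶-+ {s} {x} {t} {y} a b ε 0<ε =
    let M , p = a _ (½pos 0<ε)
        N , q = b _ (½pos 0<ε)
    in M ℕ.⊔ N , λ n h → halves (‖‖-cong
         (solve 4 (λ s x t y → (s :- x) :+ (t :- y) := (s :+ t) :- (x :+ y)) ≈-refl (s n) x (t n) y)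
         (‖‖-+ (p n (ℕP.m⊔n≤o⇒m≤o M N h)) (q n (ℕP.m⊔n≤o⇒n≤o M N h))))

  ⟶-* : s ⟶ x → t ⟶ y → (λ n → s n * t n) ⟶ (x * y)
  ⟶-* {s} {x} {t} {y} a b ε 0<ε =
    let X , ‖x‖ = bounded x
        Y , ‖y‖ = bounded y
        0≤Y+1 = +-nonneg (‖‖-nonneg ‖y‖) 0≤1
        α , 0<α , Xα = shrink X (½ ℚ.* ε) (‖‖-nonneg ‖x‖) (½pos 0<ε)
        -- From `L` on, t is within 1 of y, so `Y + 1` bounds it.
        β , 0<β , Yβ = shrink (Y ℚ.+ 1ℚ) (½ ℚ.* ε) 0≤Y+1 (½pos 0<ε)
        M , p = a β 0<β
        N , q = b α 0<α
        L , r = b 1ℚ 0<1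
        ML = M ℕ.⊔ L
    in ML ℕ.⊔ N , λ n h →
       let h₁ = ℕP.m⊔n≤o⇒m≤o ML N h in
       halves (‖‖-mono (ℚP.+-mono-≤ Yβ Xα) (‖‖-cong
         (solve 4 (λ s x t y → (y :+ (t :- y)) :* (s :- x) :+ x :* (t :- y) := s :* t :- x :* y) ≈-refl (s n) x (t n) y)
         (‖‖-+ (‖‖-* (‖‖-+ ‖y‖ (r n (ℕP.m⊔n≤o⇒n≤o M L h₁))) (p n (ℕP.m⊔n≤o⇒m≤o M L h₁)))
               (‖‖-* ‖x‖ (q n (ℕP.m⊔n≤o⇒n≤o ML N h))))))

  ⟶-bounded : ∀ {q N} → (∀ n → N ℕ.≤ n → ‖ s n ‖≤ q) → s ⟶ x → ‖ x ‖≤ q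
  ⟶-bounded {s} {x} {q} {N} b a = ‖‖-closed λ δ 0<δ →
    let M , p = a δ 0<δ
        n = M ℕ.⊔ N
    in ‖‖-cong (solve 2 (λ s x → s :- (s :- x) := x) ≈-refl (s n) x)
         (‖-‖ (b n (ℕP.m≤n⊔m M N)) (p n (ℕP.m≤m⊔n M N)))

  HasSum : (A → Carrier) → Carrier → Set
  HasSum {A} f x = ∀ ε → 0ℚ ℚ.< ε → ∃ λ (F : List A) → ∀ G → Unique G → F ⊆ G → ‖ Σ f G - x ‖≤ ε

  Dominated : (A → Carrier) → (A → ℚ) → Set
  Dominated f b = ∀ a → ‖ f a ‖≤ b a

  private variable
    f g : A → Carrier
    b : A → ℚ
    E : Exhaustion A

  ‖Σ‖ : Dominated f b → ∀ as → ‖ Σ f as ‖≤ ℚΣ.Σ b as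
  ‖Σ‖ d []       = ‖0‖
  ‖Σ‖ d (a ∷ as) = ‖‖-+ (d a) (‖Σ‖ d as)

  -- By `complement` the difference is a sum over indices outside the stage, which `tail-bound`
  -- controls.
  near-stage : Summable E b → Dominated f b → ∀ ε → 0ℚ ℚ.< ε →
    Eventually λ n → ∀ {G} → Unique G → stage E n ⊆ G → ‖ Σ f G - Σ f (stage E n) ‖≤ ε
  near-stage {E = E} {b} {f} sb d ε 0<ε =
    let N , tail≤ε = tail-bound sb ε 0<ε
    in N , λ n N≤n uG K⊆G →
      let H , σ = complement (unique E n) K⊆G
          eq = ≈-trans (+-congʳ (≈-trans (Σ-↭ f σ) (Σ-++ f (stage E n) H)))
                 (solve 2 (λ k h → (k :+ h) :- k := h) ≈-refl (Σ f (stage E n)) (Σ f H))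
      in ‖‖-cong (≈-sym eq) (‖‖-mono (tail≤ε n N≤n uG σ) (‖Σ‖ d H))

  -- With a majorant, convergence along one exhaustion already gives the unordered sum, and
  -- `hasSum⇒lim` then gives the same limit along any other exhaustion.
  lim⇒hasSum : Summable E b → Dominated f b → (λ n → Σ f (stage E n)) ⟶ x → HasSum f x
  lim⇒hasSum {E = E} sb d lim ε 0<ε =
    let M , p = near-stage {E = E} sb d _ (½pos 0<ε)
        N , q = lim _ (½pos 0<ε)
        n = M ℕ.⊔ N
    in stage E n , λ G uG K⊆G → halves (dist-trans (p n (ℕP.m≤m⊔n M N) uG K⊆G) (q n (ℕP.m≤n⊔m M N)))

  hasSum⇒lim : (E : Exhaustion A) → HasSum f x → (λ n → Σ f (stage E n)) ⟶ x
  hasSum⇒lim E h ε 0<ε =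
    let F , close = h ε 0<ε
        N , F⊆ = covers-list E F
    in N , λ n N≤n → close (stage E n) (unique E n) (mono E N≤n ∘ F⊆)

  sum-exists : Summable E b → Dominated f b → ∃ λ x → HasSum f x
  sum-exists {E = E} {b} {f} sb d =
    let x , lim = cauchy⇒convergent (λ n → Σ f (stage E n)) λ ε 0<ε →
                    let N , p = near-stage {E = E} sb d _ (½pos 0<ε)
                        near = λ n N≤n → p N ℕP.≤-refl (unique E n) (mono E N≤n)
                    in N , λ m n N≤m N≤n → halves (dist-trans (near m N≤m) (dist-swap (near n N≤n)))
    in x , lim⇒hasSum {E = E} {f = f} sb d lim

  hasSum-cong : (∀ a → f a ≈ g a) → HasSum f x → HasSum g x
  hasSum-cong e h ε 0<ε =
    let F , close = h ε 0<ε
    in F , λ G uG F⊆G → ‖‖-cong (+-congʳ (Σ-cong e G)) (close G uG F⊆G)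

  hasSum-resp : x ≈ y → HasSum f x → HasSum f y
  hasSum-resp e h ε 0<ε =
    let F , close = h ε 0<ε
    in F , λ G uG F⊆G → ‖‖-cong (+-congˡ (-‿cong e)) (close G uG F⊆G)

  hasSum-+ : HasSum f x → HasSum g y → HasSum (λ a → f a + g a) (x + y)
  hasSum-+ {f = f} {x} {g} {y} h k ε 0<ε =
    let F , p = h _ (½pos 0<ε)
        F′ , q = k _ (½pos 0<ε)
    in F ++ F′ , λ G uG F⊆G → halves (‖‖-cong
         (≈-trans (solve 4 (λ s x t y → (s :- x) :+ (t :- y) := (s :+ t) :- (x :+ y)) ≈-refl (Σ f G) x (Σ g G) y)
                  (+-congʳ (≈-sym (Σ-+ f g G))))
         (‖‖-+ (p G uG (F⊆G ∘ ∈-++⁺ˡ)) (q G uG (F⊆G ∘ ∈-++⁺ʳ F))))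

  hasSum-neg : HasSum f x → HasSum (λ a → - f a) (- x)
  hasSum-neg {f = f} {x} h ε 0<ε =
    let F , p = h ε 0<ε
    in F , λ G uG F⊆G → ‖‖-cong
         (≈-trans (solve 2 (λ s x → :- (s :- x) := (:- s) :- (:- x)) ≈-refl (Σ f G) x)
                  (+-congʳ (≈-sym (Σ-neg f G))))
         (‖neg‖ (p G uG F⊆G))

  hasSum-- : HasSum f x → HasSum g y → HasSum (λ a → f a - g a) (x - y)
  hasSum-- h k = hasSum-+ h (hasSum-neg k)

  hasSum-* : ∀ c → HasSum f x → HasSum (λ a → c * f a) (c * x)
  hasSum-* {f = f} {x} c h ε 0<ε =
    let B , ‖c‖ = bounded c
        δ , 0<δ , Bδ = shrink B ε (‖‖-nonneg ‖c‖) 0<ε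
        F , p = h δ 0<δ
    in F , λ G uG F⊆G → ‖‖-mono Bδ (‖‖-cong
         (≈-trans (solve 3 (λ c s x → c :* (s :- x) := c :* s :- c :* x) ≈-refl c (Σ f G) x)
                  (+-congʳ (≈-sym (Σ-* c f G))))
         (‖‖-* ‖c‖ (p G uG F⊆G)))

  hasSum-zero : Exhaustion A → {f : A → Carrier} → (∀ a → f a ≈ 0#) → HasSum f x → x ≈ 0#
  hasSum-zero E f≈0 h = ⟶-unique (⟶-cong (λ n → Σ-zero (stage E n)) (hasSum⇒lim E h)) (⟶-const 0#)
    where
    Σ-zero : ∀ as → Σ _ as ≈ 0#
    Σ-zero []       = ≈-refl
    Σ-zero (a ∷ as) = ≈-trans (+-cong (f≈0 a) (Σ-zero as)) (+-identityˡ 0#)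

  -- Summing `f ∘ φ` over `G` is summing `f` over `map φ G`, which contains `F` as soon as `G`
  -- contains `map φ F`, because `φ` undoes itself.
  hasSum-involution : (φ : A → A) → (∀ a → φ (φ a) ≡ a) → HasSum f x → HasSum (f ∘ φ) x
  hasSum-involution {f = f} φ inv h ε 0<ε =
    let F , p = h ε 0<ε
    in map φ F , λ G uG φF⊆G → subst (λ t → ‖ t - _ ‖≤ ε) (Σ-map f φ G)
         (p (map φ G)
            (UniqueP.map⁺ (λ {a} {b} e → ≡.trans (≡.sym (inv a)) (≡.trans (cong φ e) (inv b))) uG)
            (λ {a} a∈F → subst (_∈ map φ G) (inv a) (∈-map⁺ φ (φF⊆G (∈-map⁺ φ a∈F)))))

  -- Over rectangles the partial sums are products of partial sums; the product majorant upgrades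
  -- this limit to an unordered sum.
  hasSum-⊗ : ∀ {A B : Set} {E : Exhaustion A} {E′ : Exhaustion B} {b : A → ℚ} {c : B → ℚ} {f : A → Carrier} {g : B → Carrier} →
    Summable E b → Summable E′ c → Dominated f b → Dominated g c →
    HasSum f x → HasSum g y → HasSum (λ (u , v) → f u * g v) (x * y)
  hasSum-⊗ {E = E} {E′} {f = f} {g} sb sc df dg h k = lim⇒hasSum (⊗-summable sb sc) (λ (u , v) → ‖‖-* (df u) (dg v))
    (⟶-cong (λ n → ≈-sym (Σ-× f g (stage E n) (stage E′ n))) (⟶-* (hasSum⇒lim E h) (hasSum⇒lim E′ k)))

  -- zᵏ/k! with neither powers nor factorials, which suits the inductions on k.
  expTerm : Carrier → ℕ → Carrier
  expTerm z zero    = 1#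
  expTerm z (suc k) = ι (recip k) * (z * expTerm z k)

-- Integers as rationals; diagonals of ℕ × ℕ

fromℤ/1 : ℤ → ℚ
fromℤ/1 n = n ℚ./ 1

private
  /1≃ : ∀ n → ℚ.toℚᵘ (fromℤ/1 n) ℚᵘ.≃ ℚᵘ.mkℚᵘ n 0
  /1≃ n = ℚP.toℚᵘ-fromℚᵘ (ℚᵘ.mkℚᵘ n 0)

/1-+ : ∀ m n → fromℤ/1 (m ℤ.+ n) ≡ fromℤ/1 m ℚ.+ fromℤ/1 n
/1-+ m n = ℚP.toℚᵘ-injective (ℚᵘP.≃-trans (/1≃ (m ℤ.+ n))
  (ℚᵘP.≃-sym (ℚᵘP.≃-trans (ℚP.toℚᵘ-homo-+ (fromℤ/1 m) (fromℤ/1 n))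
    (ℚᵘP.≃-trans (ℚᵘP.+-cong (/1≃ m) (/1≃ n))
      (ℚᵘ.*≡* (cong (ℤ._* (+ 1)) (cong₂ ℤ._+_ (ℤP.*-identityʳ m) (ℤP.*-identityʳ n))))))))

/1-* : ∀ m n → fromℤ/1 (m ℤ.* n) ≡ fromℤ/1 m ℚ.* fromℤ/1 n
/1-* m n = ℚP.toℚᵘ-injective (ℚᵘP.≃-trans (/1≃ (m ℤ.* n))
  (ℚᵘP.≃-sym (ℚᵘP.≃-trans (ℚP.toℚᵘ-homo-* (fromℤ/1 m) (fromℤ/1 n))
    (ℚᵘP.*-cong (/1≃ m) (/1≃ n)))))

suc*recip : ∀ n → fromℤ/1 (+ suc n) ℚ.* recip n ≡ 1ℚ
suc*recip n = ℚP.toℚᵘ-injective (ℚᵘP.≃-trans (ℚP.toℚᵘ-homo-* (fromℤ/1 (+ suc n)) (recip n))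
  (ℚᵘP.≃-trans (ℚᵘP.*-cong (/1≃ (+ suc n)) (recip≃ n))
    (ℚᵘ.*≡* (≡.trans (cong (ℤ._* (+ 1)) (ℤP.*-identityʳ (+ suc n)))
      (≡.trans (ℤP.*-comm (+ suc n) (+ 1)) (cong (λ d → + 1 ℤ.* + suc d) (≡.sym (ℕP.+-identityʳ n))))))))

∣p∣≡p : ∀ {p} → 0ℚ ℚ.≤ p → ℚ.∣ p ∣ ≡ p
∣p∣≡p = ℚP.0≤p⇒∣p∣≡p

diagonal : ℕ → List (ℕ × ℕ)
diagonal zero    = (0 , 0) ∷ []
diagonal (suc n) = (0 , suc n) ∷ map (λ (i , j) → suc i , j) (diagonal n)

-- `diagonal` peels off the pair with first entry 0; this peels off the pair with second entry 0. In
-- the recursion for (z+w)ⁿ/n! the factor i kills the one and the factor j kills the other.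
diagonal-snoc : ∀ n → diagonal (suc n) ≡ map (λ (i , j) → i , suc j) (diagonal n) ++ (suc n , 0) ∷ []
diagonal-snoc zero    = ≡.refl
diagonal-snoc (suc n) = cong ((0 , suc (suc n)) ∷_) (begin
  map S₁ (diagonal (suc n))                        ≡⟨ cong (map S₁) (diagonal-snoc n) ⟩
  map S₁ (map S₂ (diagonal n) ++ (suc n , 0) ∷ []) ≡⟨ ListP.map-++ S₁ (map S₂ (diagonal n)) _ ⟩
  map S₁ (map S₂ (diagonal n)) ++ _ ∷ []           ≡⟨ cong (_++ (suc (suc n) , 0) ∷ []) (ListP.map-∘ (diagonal n)) ⟨
  map (λ (i , j) → suc i , suc j) (diagonal n) ++ _ ∷ [] ≡⟨ cong (_++ (suc (suc n) , 0) ∷ []) (ListP.map-∘ (diagonal n)) ⟩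
  map S₂ (map S₁ (diagonal n)) ++ _ ∷ []           ∎)
  where
  open ≡.≡-Reasoning
  S₁ S₂ : ℕ × ℕ → ℕ × ℕ
  S₁ (i , j) = suc i , j
  S₂ (i , j) = i , suc j

∈-diagonal⁻ : ∀ n {i j} → (i , j) ∈ diagonal n → i ℕ.+ j ≡ n
∈-diagonal⁻ zero    (here ≡.refl) = ≡.refl
∈-diagonal⁻ (suc n) (here ≡.refl) = ≡.refl
∈-diagonal⁻ (suc n) (there p) with ∈-map⁻ _ p
... | (i , j) , q , ≡.refl = cong suc (∈-diagonal⁻ n q)

∈-diagonal⁺ : ∀ i j → (i , j) ∈ diagonal (i ℕ.+ j)
∈-diagonal⁺ zero    zero    = here ≡.refl
∈-diagonal⁺ zero    (suc j) = here ≡.refl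
∈-diagonal⁺ (suc i) j       = there (∈-map⁺ _ (∈-diagonal⁺ i j))

diagonal-unique : ∀ n → Unique (diagonal n)
diagonal-unique zero    = [] ∷ []
diagonal-unique (suc n) = All.tabulate (λ p e → first≢0 p (cong proj₁ e)) ∷
  UniqueP.map⁺ (λ { ≡.refl → ≡.refl }) (diagonal-unique n)
  where
  first≢0 : ∀ {x} → x ∈ map (λ (i , j) → suc i , j) (diagonal n) → ¬ 0 ≡ proj₁ x
  first≢0 p e with ∈-map⁻ _ p
  first≢0 p () | (i , j) , q , ≡.refl

triangle-exhaustion : Exhaustion (ℕ × ℕ)
triangle-exhaustion = record
  { stage  = T
  ; unique = T-unique
  ; mono   = nested⇒mono T (λ n → ∈-++⁺ʳ (diagonal n))
  ; covers = λ (i , j) → suc (i ℕ.+ j) , ∈-++⁺ˡ (∈-diagonal⁺ i j)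
  }
  where
  T : ℕ → List (ℕ × ℕ)
  T zero    = []
  T (suc n) = diagonal n ++ T n
  ∈-T⁻ : ∀ n {i j} → (i , j) ∈ T n → i ℕ.+ j ℕ.< n
  ∈-T⁻ (suc n) p with ∈-++⁻ (diagonal n) p
  ... | inj₁ q = ℕP.≤-reflexive (cong suc (∈-diagonal⁻ n q))
  ... | inj₂ q = ℕP.m≤n⇒m≤1+n (∈-T⁻ n q)
  T-unique : ∀ n → Unique (T n)
  T-unique zero    = []
  T-unique (suc n) = UniqueP.++⁺ (diagonal-unique n) (T-unique n)
    λ (p , q) → ℕP.<-irrefl (∈-diagonal⁻ n p) (∈-T⁻ n q)

open ExpLemmas using (bound; bound-nonneg; series-cauchy)

bound-summable : ∀ {B} → 0ℚ ℚ.≤ B → Summable downFrom-exhaustion (bound B)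
bound-summable 0≤B .Summable.nonneg = bound-nonneg 0≤B
bound-summable {B} 0≤B .Summable.cauchyΣ ε 0<ε =
  let M , close = series-cauchy B 0≤B ε 0<ε
  in M , close (λ n → ℚΣ.Σ (bound B) (downFrom n)) λ k → ℚP.≤-reflexive
       (≡.trans (cong ℚ.∣_∣ (solve 2 (λ b s → (b :+ s) :- s := b) ≡.refl (bound B k) _))
         (∣p∣≡p (bound-nonneg 0≤B k)))
  where open ℚ-Solver

-- Axioms for the complex numbers

-- The properties of ℂ that the proof needs, stated for arbitrary operations so that terms do not
-- unfold to Cauchy sequences and their moduli.
record IsComplexField {C : Set} (_≈_ : C → C → Set) (_+_ _*_ : C → C → C) (-_ : C → C) (0# 1# : C)
                      (ι : ℚ → C) (‖_‖≤_ : C → ℚ → Set) (exp : C → C) (J Π : C) : Set where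
  field
    isNormedRing : IsNormedRing _≈_ _+_ _*_ -_ 0# 1# ι ‖_‖≤_
    expTerm expPartialSum : C → ℕ → C
    expTerm-0   : ∀ z → expTerm z 0 ≈ 1#
    expTerm-suc : ∀ z k → expTerm z (suc k) ≈ (ι (recip k) * (z * expTerm z k))
    expPartialSum-0   : ∀ z → expPartialSum z 0 ≈ 0#
    expPartialSum-suc : ∀ z n → expPartialSum z (suc n) ≈ (expPartialSum z n + expTerm z n)
    exp-limit : ∀ z ε → 0ℚ ℚ.< ε → Eventually λ n → ‖ expPartialSum z n + (- exp z) ‖≤ ε
    J*J : (J * J) ≈ (- 1#)
    ‖J‖ : ‖ J ‖≤ 1ℚ
    Π-limit : ∀ ε → 0ℚ ℚ.< ε → Eventually λ n → ‖ ι (riemannSum n) + (- Π) ‖≤ ε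
    conj : C → C
    conj-cong : ∀ {x y} → x ≈ y → conj x ≈ conj y
    conj-+ : ∀ x y → conj (x + y) ≈ (conj x + conj y)
    conj-* : ∀ x y → conj (x * y) ≈ (conj x * conj y)
    conj-ι : ∀ p → conj (ι p) ≈ ι p
    conj-J : conj J ≈ (- J)
    ‖conj‖ : ∀ {x q} → ‖ x ‖≤ q → ‖ conj x ‖≤ q
    -- The norm of ℂ will be |re| + |im|; modulus at most 1 bounds each part by 1, hence the
    -- constant 2.
    ‖‖-conj-1 : ∀ x → ‖ x * conj x ‖≤ 1ℚ → ‖ x ‖≤ (+ 2 ℚ./ 1)

  -- Stands in for being real: inequalities are proved for the rationals `ρ n` and passed to the
  -- limit. The bound `L` supplies constants that do not depend on n.
  Approximable : C → Set
  Approximable u = ∃ λ (ρ : ℕ → ℚ) →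
    (∀ ε → 0ℚ ℚ.< ε → Eventually λ n → ‖ ι (ρ n) + (- u) ‖≤ ε) × ∃ λ L → Eventually λ n → ℚ.∣ ρ n ∣ ℚ.≤ L

  field
    parts : ∀ z → ∃ λ u → ∃ λ v → z ≈ (u + (J * v)) × Approximable u × Approximable v

record ComplexField : Set₁ where
  field
    {Carrier} : Set
    {_≈_}  : Carrier → Carrier → Set
    {_+_}  : Carrier → Carrier → Carrier
    {_*_}  : Carrier → Carrier → Carrier
    { -_}   : Carrier → Carrier
    {0#}   : Carrier
    {1#}   : Carrier
    {ι}    : ℚ → Carrier
    {‖_‖≤_} : Carrier → ℚ → Set
    {exp}  : Carrier → Carrier
    {J}    : Carrier
    {Π}    : Carrier
    isComplexField : IsComplexField _≈_ _+_ _*_ -_ 0# 1# ι ‖_‖≤_ exp J Π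

  open IsComplexField isComplexField public hiding (isNormedRing; expTerm; expPartialSum; Π-limit)

  normedRing : NormedRing
  normedRing = record { isNormedRing = IsComplexField.isNormedRing isComplexField }

  open NormedRing normedRing public hiding (Carrier; _≈_; _+_; _*_; -_; 0#; 1#; ι; ‖_‖≤_; isNormedRing)
  open Limits normedRing public

  infix 4 _≈_ ‖_‖≤_
  infixl 6 _+_
  infixl 7 _*_
  infix 8 -_

  Π-series : (ι ∘ riemannSum) ⟶ Π
  Π-series = IsComplexField.Π-limit isComplexField

  private
    module S = IsComplexField isComplexField

    expTerm-≈ : ∀ z k → S.expTerm z k ≈ expTerm z k
    expTerm-≈ z zero    = expTerm-0 z
    expTerm-≈ z (suc k) = ≈-trans (expTerm-suc z k) (*-congˡ (*-congˡ (expTerm-≈ z k)))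

    expPartialSum-≈ : ∀ z n → S.expPartialSum z n ≈ Σ (expTerm z) (downFrom n)
    expPartialSum-≈ z zero    = expPartialSum-0 z
    expPartialSum-≈ z (suc n) = ≈-trans (expPartialSum-suc z n)
      (≈-trans (+-cong (expPartialSum-≈ z n) (expTerm-≈ z n)) (+-comm _ _))

  exp-series : ∀ z → (λ n → Σ (expTerm z) (downFrom n)) ⟶ exp z
  exp-series z = ⟶-cong (expPartialSum-≈ z) (exp-limit z)

-- The exponential series

module Exponential (C : ComplexField) where
  open ComplexField C
  open Solver

  private variable
    x y z w : Carrier

  expTerm-cong : x ≈ y → ∀ k → expTerm x k ≈ expTerm y k
  expTerm-cong e zero    = ≈-refl
  expTerm-cong e (suc k) = *-congˡ (*-cong e (expTerm-cong e k))

  exp-cong : x ≈ y → exp x ≈ exp y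
  exp-cong {x} {y} e =
    ⟶-unique (⟶-cong (λ n → Σ-cong (expTerm-cong e) (downFrom n)) (exp-series x)) (exp-series y)

  suc*expTerm : ∀ z k → ι (fromℤ/1 (+ suc k)) * expTerm z (suc k) ≈ z * expTerm z k
  suc*expTerm z k = begin
    ι (fromℤ/1 (+ suc k)) * (ι (recip k) * (z * expTerm z k))
      ≈⟨ *-assoc _ _ _ ⟨
    (ι (fromℤ/1 (+ suc k)) * ι (recip k)) * (z * expTerm z k)
      ≈⟨ *-congʳ (ι-* _ _) ⟨
    ι (fromℤ/1 (+ suc k) ℚ.* recip k) * (z * expTerm z k)
      ≈⟨ *-congʳ (reflexive (cong ι (suc*recip k))) ⟩
    ι 1ℚ * (z * expTerm z k)
      ≈⟨ solve 1 (λ t → con 1ℚ :* t := t) ≈-refl _ ⟩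
    z * expTerm z k ∎
    where open import Relation.Binary.Reasoning.Setoid setoid

  Σ-cong-∈ : ∀ {A : Set} {f g : A → Carrier} as → (∀ a → a ∈ as → f a ≈ g a) → Σ f as ≈ Σ g as
  Σ-cong-∈ []       e = ≈-refl
  Σ-cong-∈ (a ∷ as) e = +-cong (e a (here ≡.refl)) (Σ-cong-∈ as (λ b → e b ∘ there))

  module _ (z w : Carrier) where

    product : ℕ × ℕ → Carrier
    product (i , j) = expTerm z i * expTerm w j

    -- Multiplying by n+1 = i+j splits the sum over i+j = n+1 into two, which are z and w times
    -- the sum over i+j = n.
    Σ-diagonal-suc : ∀ n → ι (fromℤ/1 (+ suc n)) * Σ product (diagonal (suc n)) ≈ (z + w) * Σ product (diagonal n)
    Σ-diagonal-suc n = begin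
      ι (fromℤ/1 (+ suc n)) * Σ product (diagonal (suc n))
        ≈⟨ Σ-* _ product (diagonal (suc n)) ⟨
      Σ (λ p → ι (fromℤ/1 (+ suc n)) * product p) (diagonal (suc n))
        ≈⟨ Σ-cong-∈ (diagonal (suc n)) (λ (i , j) p → split i j (∈-diagonal⁻ (suc n) p)) ⟩
      Σ (λ p → left p + right p) (diagonal (suc n))
        ≈⟨ Σ-+ left right (diagonal (suc n)) ⟩
      Σ left (diagonal (suc n)) + Σ right (diagonal (suc n))
        ≈⟨ +-cong Σ-left (≈-trans (reflexive (cong (Σ right) (diagonal-snoc n))) Σ-right) ⟩
      z * Σ product (diagonal n) + w * Σ product (diagonal n)
        ≈⟨ distribʳ _ _ _ ⟨
      (z + w) * Σ product (diagonal n) ∎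
      where
      open import Relation.Binary.Reasoning.Setoid setoid
      left right : ℕ × ℕ → Carrier
      left  (i , j) = (ι (fromℤ/1 (+ i)) * expTerm z i) * expTerm w j
      right (i , j) = expTerm z i * (ι (fromℤ/1 (+ j)) * expTerm w j)
      split : ∀ i j → i ℕ.+ j ≡ suc n → ι (fromℤ/1 (+ suc n)) * product (i , j) ≈ left (i , j) + right (i , j)
      split i j e = ≈-trans
        (*-congʳ (≈-trans (reflexive (cong ι (≡.trans (cong (fromℤ/1 ∘ +_) (≡.sym e)) (/1-+ (+ i) (+ j))))) (ι-+ _ _)))
        (solve 4 (λ i j s t → (i :+ j) :* (s :* t) := (i :* s) :* t :+ s :* (j :* t)) ≈-refl _ _ _ _)
      Σ-left : Σ left (diagonal (suc n)) ≈ z * Σ product (diagonal n)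
      Σ-left = ≈-trans (+-cong
          (solve 2 (λ s t → (con 0ℚ :* s) :* t := con 0ℚ) ≈-refl (expTerm z 0) (expTerm w (suc n)))
          (≈-trans (reflexive (Σ-map left _ (diagonal n))) (≈-trans (Σ-cong (λ (i , j) →
            ≈-trans (*-congʳ (suc*expTerm z i)) (*-assoc _ _ _)) (diagonal n)) (Σ-* z product (diagonal n)))))
        (≈-trans (+-congʳ ι-0) (+-identityˡ _))
      Σ-right : Σ right (map (λ (i , j) → i , suc j) (diagonal n) ++ (suc n , 0) ∷ []) ≈ w * Σ product (diagonal n)
      Σ-right = ≈-trans (Σ-++ right (map _ (diagonal n)) _) (≈-trans (+-cong
          (≈-trans (reflexive (Σ-map right _ (diagonal n))) (≈-trans (Σ-cong (λ (i , j) →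
            ≈-trans (*-congˡ (suc*expTerm w j))
              (solve 3 (λ s w t → s :* (w :* t) := w :* (s :* t)) ≈-refl _ _ _)) (diagonal n)) (Σ-* w product (diagonal n))))
          (≈-trans (+-congʳ (solve 2 (λ s t → s :* (con 0ℚ :* t) := con 0ℚ) ≈-refl (expTerm z (suc n)) (expTerm w 0)))
            (≈-trans (+-congʳ ι-0) (+-identityˡ _))))
        (+-identityʳ _))

    Σ-diagonal : ∀ n → Σ product (diagonal n) ≈ expTerm (z + w) n
    Σ-diagonal zero    = ≈-trans (+-identityʳ _) (*-identityˡ _)
    Σ-diagonal (suc n) = begin
      Σ product (diagonal (suc n))
        ≈⟨ solve 1 (λ s → s := con 1ℚ :* s) ≈-refl _ ⟩
      ι 1ℚ * Σ product (diagonal (suc n))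
        ≈⟨ *-congʳ (reflexive (cong ι (≡.trans (≡.sym (suc*recip n)) (ℚP.*-comm (fromℤ/1 (+ suc n)) (recip n))))) ⟩
      ι (recip n ℚ.* fromℤ/1 (+ suc n)) * Σ product (diagonal (suc n))
        ≈⟨ ≈-trans (*-congʳ (ι-* _ _)) (*-assoc _ _ _) ⟩
      ι (recip n) * (ι (fromℤ/1 (+ suc n)) * Σ product (diagonal (suc n)))
        ≈⟨ *-congˡ (≈-trans (Σ-diagonal-suc n) (*-congˡ (Σ-diagonal n))) ⟩
      expTerm (z + w) (suc n) ∎
      where open import Relation.Binary.Reasoning.Setoid setoid

    Σ-triangle : ∀ n → Σ product (stage triangle-exhaustion n) ≈ Σ (expTerm (z + w)) (downFrom n)
    Σ-triangle zero    = ≈-refl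
    Σ-triangle (suc n) = ≈-trans (Σ-++ product (diagonal n) _) (+-cong (Σ-diagonal n) (Σ-triangle n))

  ‖expTerm‖ : ∀ {B} → ‖ z ‖≤ B → Dominated (expTerm z) (bound B)
  ‖expTerm‖ h zero = ‖‖-cong ι-1 (‖ι‖ 1ℚ)
  ‖expTerm‖ {B = B} h (suc k) = ‖‖-≡
    (≡.trans (cong (ℚ._* (B ℚ.* bound B k)) (∣p∣≡p (ℚP.<⇒≤ (recip-pos k))))
      (Q.solve 3 (λ r b t → r Q.:* (b Q.:* t) Q.:= (b Q.:* r) Q.:* t) ≡.refl (recip k) B (bound B k)))
    (‖‖-* (‖ι‖ (recip k)) (‖‖-* h (‖expTerm‖ h k)))
    where module Q = ℚ-Solver

  exp-hasSum : ∀ z → HasSum (expTerm z) (exp z)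
  exp-hasSum z =
    let B , h = bounded z
    in lim⇒hasSum (bound-summable (‖‖-nonneg h)) (‖expTerm‖ h) (exp-series z)

  exp-+ : ∀ z w → exp (z + w) ≈ exp z * exp w
  exp-+ z w =
    let B , hz = bounded z
        D , hw = bounded w
        sums = hasSum-⊗ (bound-summable (‖‖-nonneg hz)) (bound-summable (‖‖-nonneg hw))
                 (‖expTerm‖ hz) (‖expTerm‖ hw) (exp-hasSum z) (exp-hasSum w)
    in ⟶-unique (exp-series (z + w)) (⟶-cong (Σ-triangle z w) (hasSum⇒lim triangle-exhaustion sums))

  -- From the quadratic term on, each term is at most half of the one before, because B ≤ 1.
  -- Starting at B²/2, the whole tail is at most B².
  bound-geometric : ∀ {B} → 0ℚ ℚ.≤ B → B ℚ.≤ 1ℚ → ∀ n → bound B (2 ℕ.+ n) ℚ.≤ (B ℚ.* B) ℚ.* half (suc n)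
  bound-geometric {B} 0≤B B≤1 zero = ℚP.≤-reflexive
    (Q.solve 1 (λ b → (b Q.:* Q.con ½) Q.:* ((b Q.:* Q.con 1ℚ) Q.:* Q.con 1ℚ) Q.:= (b Q.:* b) Q.:* Q.con ½) ≡.refl B)
    where module Q = ℚ-Solver
  bound-geometric {B} 0≤B B≤1 (suc n) = begin
    (B ℚ.* recip (2 ℕ.+ n)) ℚ.* bound B (2 ℕ.+ n)
      ≤⟨ *-mono (*-nonneg 0≤B (ℚP.<⇒≤ (recip-pos (2 ℕ.+ n))))
           (*-nonneg (*-nonneg 0≤B 0≤B) (ℚP.<⇒≤ (half-pos (suc n))))
           (*-mono 0≤B (ℚP.nonNegative⁻¹ ½) B≤1 (recip-anti {1} {2 ℕ.+ n} (ℕ.s≤s ℕ.z≤n))) (bound-geometric 0≤B B≤1 n) ⟩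
    (1ℚ ℚ.* ½) ℚ.* ((B ℚ.* B) ℚ.* half (suc n))
      ≡⟨ Q.solve 2 (λ b h → (Q.con 1ℚ Q.:* Q.con ½) Q.:* (b Q.:* h) Q.:= b Q.:* (Q.con ½ Q.:* h)) ≡.refl (B ℚ.* B) (half (suc n)) ⟩
    (B ℚ.* B) ℚ.* half (2 ℕ.+ n) ∎
    where
    open ℚP.≤-Reasoning
    module Q = ℚ-Solver

  -- The basic analytic estimate on exp: continuity, decay on the negative axis and the error of the
  -- Riemann sums are all drawn from it.
  exp-remainder : ∀ {B} → ‖ z ‖≤ B → B ℚ.≤ 1ℚ → ‖ exp z - (1# + z) ‖≤ (B ℚ.* B)
  exp-remainder {z} {B} h B≤1 = ⟶-bounded {N = 0} (λ n _ → ‖‖-mono (below n) (partial n))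
    (⟶-+ (λ ε 0<ε → let N , p = exp-series z ε 0<ε in N , λ n N≤n → p (2 ℕ.+ n) (ℕP.m≤n⇒m≤1+n (ℕP.m≤n⇒m≤1+n N≤n)))
      (⟶-const _))
    where
    module Q = ℚ-Solver
    0≤B = ‖‖-nonneg h
    -- The bound leaves exactly the room B²·`half n` for the terms still to come, so the induction
    -- closes.
    partial : ∀ n → ‖ Σ (expTerm z) (downFrom (2 ℕ.+ n)) - (1# + z) ‖≤ ((B ℚ.* B) ℚ.* (1ℚ ℚ.- half n))
    partial zero = ‖‖-≡ (≡.sym (ℚP.*-zeroʳ (B ℚ.* B)))
      (≈⇒‖-‖ (≈-trans (+-cong (≈-trans (*-cong ι-1 (*-identityʳ z)) (*-identityˡ z)) (+-identityʳ 1#)) (+-comm z 1#)))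
    partial (suc n) = ‖‖-cong
      (solve 3 (λ t s e → t :+ (s :- e) := (t :+ s) :- e) ≈-refl
        (expTerm z (2 ℕ.+ n)) (Σ (expTerm z) (downFrom (2 ℕ.+ n))) (1# + z))
      (‖‖-≡
        (Q.solve 2 (λ b h → b Q.:* (Q.con ½ Q.:* h) Q.:+ b Q.:* (Q.con 1ℚ Q.:- h) Q.:= b Q.:* (Q.con 1ℚ Q.:- Q.con ½ Q.:* h))
          ≡.refl (B ℚ.* B) (half n))
        (‖‖-+ (‖‖-mono (bound-geometric 0≤B B≤1 n) (‖expTerm‖ h (2 ℕ.+ n))) (partial n)))
    below : ∀ n → (B ℚ.* B) ℚ.* (1ℚ ℚ.- half n) ℚ.≤ B ℚ.* B
    below n = ℚP.≤-trans (*-monoˡ (*-nonneg 0≤B 0≤B)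
        (ℚP.≤-trans (ℚP.+-monoʳ-≤ 1ℚ (ℚP.neg-antimono-≤ (ℚP.<⇒≤ (half-pos n)))) (ℚP.≤-reflexive ≡.refl)))
      (ℚP.≤-reflexive (ℚP.*-identityʳ (B ℚ.* B)))

  exp-0 : z ≈ 0# → exp z ≈ 1#
  exp-0 {z} z≈0 = ≈-trans (x-y≈0⇒x≈y (‖‖-zero (exp-remainder (‖‖-cong (≈-sym z≈0) ‖0‖) 0≤1)))
    (≈-trans (+-congˡ z≈0) (+-identityʳ 1#))

  exp-neg : ∀ z → exp z * exp (- z) ≈ 1#
  exp-neg z = ≈-trans (≈-sym (exp-+ z (- z))) (exp-0 (-‿inverseʳ z))

  ‖1‖ : ‖ 1# ‖≤ 1ℚ
  ‖1‖ = ‖‖-cong ι-1 (‖ι‖ 1ℚ)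

  ‖exp‖ : ∀ {d} → ‖ z ‖≤ d → d ℚ.≤ 1ℚ → ‖ exp z ‖≤ (1ℚ ℚ.+ (d ℚ.+ d))
  ‖exp‖ {z} {d} h d≤1 = ‖‖-mono
    (begin
      d ℚ.* d ℚ.+ (1ℚ ℚ.+ d)  ≤⟨ ℚP.+-monoˡ-≤ (1ℚ ℚ.+ d) (ℚP.≤-trans (*-monoˡ (‖‖-nonneg h) d≤1) (ℚP.≤-reflexive (ℚP.*-identityʳ d))) ⟩
      d ℚ.+ (1ℚ ℚ.+ d)        ≡⟨ Q.solve 1 (λ d → d Q.:+ (Q.con 1ℚ Q.:+ d) Q.:= Q.con 1ℚ Q.:+ (d Q.:+ d)) ≡.refl d ⟩
      1ℚ ℚ.+ (d ℚ.+ d)        ∎)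
    (‖‖-cong (solve 2 (λ e s → (e :- s) :+ s := e) ≈-refl (exp z) (1# + z))
      (‖‖-+ (exp-remainder h d≤1) (‖‖-+ ‖1‖ h)))
    where
    open ℚP.≤-Reasoning
    module Q = ℚ-Solver

  -- Used twice: it gives the bound 1 from which `‖exp-neg‖` starts, and the value 3/4 at σ = 1/2
  -- behind `‖exp[-2n]‖`.
  ‖exp-neg-small‖ : ∀ {σ} → 0ℚ ℚ.≤ σ → σ ℚ.≤ ½ → ‖ exp (ι (ℚ.- σ)) ‖≤ (1ℚ ℚ.- ½ ℚ.* σ)
  ‖exp-neg-small‖ {σ} 0≤σ σ≤½ = ‖‖-mono
    (begin
      σ ℚ.* σ ℚ.+ ℚ.∣ 1ℚ ℚ.- σ ∣  ≡⟨ cong (σ ℚ.* σ ℚ.+_) (∣p∣≡p (0≤q-p σ≤1)) ⟩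
      σ ℚ.* σ ℚ.+ (1ℚ ℚ.- σ)      ≤⟨ ℚP.+-monoˡ-≤ (1ℚ ℚ.- σ) (*-monoˡ 0≤σ σ≤½) ⟩
      σ ℚ.* ½ ℚ.+ (1ℚ ℚ.- σ)      ≡⟨ Q.solve 1 (λ s → s Q.:* Q.con ½ Q.:+ (Q.con 1ℚ Q.:- s) Q.:= Q.con 1ℚ Q.:- Q.con ½ Q.:* s) ≡.refl σ ⟩
      1ℚ ℚ.- ½ ℚ.* σ              ∎)
    (‖‖-cong (≈-trans (+-congˡ (≈-trans (ι-+ 1ℚ (ℚ.- σ)) (+-congʳ ι-1)))
        (solve 2 (λ e s → (e :- s) :+ s := e) ≈-refl (exp (ι (ℚ.- σ))) (1# + ι (ℚ.- σ))))
      (‖‖-+ (exp-remainder (‖‖-≡ (≡.trans (ℚP.∣-p∣≡∣p∣ σ) (∣p∣≡p 0≤σ)) (‖ι‖ (ℚ.- σ))) σ≤1)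
            (‖ι‖ (1ℚ ℚ.- σ))))
    where
    open ℚP.≤-Reasoning
    module Q = ℚ-Solver
    ½≤1 : ½ ℚ.≤ 1ℚ
    ½≤1 = recip-anti {0} {1} ℕ.z≤n
    σ≤1 = ℚP.≤-trans σ≤½ ½≤1

  ‖exp-double‖ : ∀ {q} p → ‖ exp (ι (½ ℚ.* p)) ‖≤ q → ‖ exp (ι p) ‖≤ (q ℚ.* q)
  ‖exp-double‖ p h = ‖‖-cong (≈-trans (≈-sym (exp-+ _ _))
    (exp-cong (≈-trans (≈-sym (ι-+ _ _)) (reflexive (cong ι (½+½ p)))))) (‖‖-* h h)

  -- Halve σ until it is at most 1/2; squaring back up preserves the bound 1.
  ‖exp-neg‖ : ∀ {σ} → 0ℚ ℚ.≤ σ → ‖ exp (ι (ℚ.- σ)) ‖≤ 1ℚ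
  ‖exp-neg‖ {σ} 0≤σ =
    let k , small = scaled-recip σ ½ 0≤σ (ℚP.positive⁻¹ ½)
    in halve k σ 0≤σ (ℚP.≤-trans (ℚP.≤-trans (ℚP.≤-reflexive (ℚP.*-comm (half k) σ)) (*-monoˡ 0≤σ (half≤recip k))) (small k ℕP.≤-refl))
    where
    module Q = ℚ-Solver
    halve : ∀ k σ → 0ℚ ℚ.≤ σ → half k ℚ.* σ ℚ.≤ ½ → ‖ exp (ι (ℚ.- σ)) ‖≤ 1ℚ
    halve zero σ 0≤σ h = ‖‖-mono
      (ℚP.≤-trans (ℚP.+-monoʳ-≤ 1ℚ (ℚP.neg-antimono-≤ (*-nonneg (ℚP.nonNegative⁻¹ ½) 0≤σ))) (ℚP.≤-reflexive ≡.refl))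
      (‖exp-neg-small‖ 0≤σ (ℚP.≤-trans (ℚP.≤-reflexive (≡.sym (ℚP.*-identityˡ σ))) h))
    halve (suc k) σ 0≤σ h = ‖exp-double‖ (ℚ.- σ)
      (subst (λ p → ‖ exp (ι p) ‖≤ 1ℚ) (Q.solve 1 (λ s → Q.:- (Q.con ½ Q.:* s) Q.:= Q.con ½ Q.:* (Q.:- s)) ≡.refl σ)
        (halve k (½ ℚ.* σ) (*-nonneg (ℚP.nonNegative⁻¹ ½) 0≤σ)
          (ℚP.≤-trans (ℚP.≤-reflexive
            (Q.solve 2 (λ k s → k Q.:* (Q.con ½ Q.:* s) Q.:= (Q.con ½ Q.:* k) Q.:* s) ≡.refl (half k) σ)) h)))

  -- ‖e^(-1/2)‖ ≤ 3/4 and (3/4)⁴ ≤ 1/2.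
  ‖exp[-2n]‖ : ∀ n → ‖ exp (ι (ℚ.- ((+ 2 ℚ./ 1) ℚ.* fromℤ/1 (+ n)))) ‖≤ half n
  ‖exp[-2n]‖ zero    = ‖exp-neg‖ {0ℚ} ℚP.≤-refl
  ‖exp[-2n]‖ (suc n) = ‖‖-cong (≈-trans (≈-sym (exp-+ _ _)) (exp-cong (≈-trans (≈-sym (ι-+ _ _)) (reflexive (cong ι
      (≡.trans (Q.solve 1 (λ n → Q.con (ℚ.- (+ 2 ℚ./ 1)) Q.:+ (Q.:- (Q.con (+ 2 ℚ./ 1) Q.:* n)) Q.:= Q.:- (Q.con (+ 2 ℚ./ 1) Q.:* (Q.con 1ℚ Q.:+ n))) ≡.refl (fromℤ/1 (+ n)))
        (cong (λ m → ℚ.- ((+ 2 ℚ./ 1) ℚ.* m)) (≡.sym (/1-+ (+ 1) (+ n))))))))))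
    (‖‖-* exp[-2] (‖exp[-2n]‖ n))
    where
    module Q = ℚ-Solver
    exp[-2] : ‖ exp (ι (ℚ.- (+ 2 ℚ./ 1))) ‖≤ ½
    -- 81/256 ≤ 1/2, cross-multiplied.
    exp[-2] = ‖‖-mono (ℚ.*≤* (ℤ.+≤+ (ℕP.≤ᵇ⇒≤ 162 256 _))) (‖exp-double‖ (ℚ.- (+ 2 ℚ./ 1))
      (‖exp-double‖ (ℚ.- 1ℚ) (‖exp-neg-small‖ {½} (ℚP.nonNegative⁻¹ ½) ℚP.≤-refl)))

  -- Split -z into -σ with σ ≥ 0 rational, whose exponential is at most 1, and a small rest, whose
  -- exponential is close to 1. Taking the rest to 0 leaves the bound 1 itself.
  ‖exp-neg-approx‖ : (∀ δ → 0ℚ ℚ.< δ → ∃ λ σ → 0ℚ ℚ.≤ σ × ‖ z - ι σ ‖≤ δ) → ‖ exp (- z) ‖≤ 1ℚ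
  ‖exp-neg-approx‖ {z} approx = ‖‖-closed λ δ 0<δ → bound-for δ 0<δ (ℚP.≤-total (½ ℚ.* δ) 1ℚ)
    where
    open ℚP.≤-Reasoning
    module Q = ℚ-Solver
    go : ∀ d → 0ℚ ℚ.< d → d ℚ.≤ 1ℚ → ‖ exp (- z) ‖≤ (1ℚ ℚ.+ (d ℚ.+ d))
    go d 0<d d≤1 =
      let σ , 0≤σ , near = approx d 0<d
      in ‖‖-≡ (ℚP.*-identityˡ _) (‖‖-cong
           (≈-trans (≈-sym (exp-+ _ _)) (exp-cong (≈-trans (+-congʳ (ι-neg σ))
             (solve 2 (λ z s → (:- s) :+ (s :- z) := :- z) ≈-refl z (ι σ)))))
           (‖‖-* (‖exp-neg‖ 0≤σ) (‖exp‖ (dist-swap near) d≤1)))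
    bound-for : ∀ δ → 0ℚ ℚ.< δ → ½ ℚ.* δ ℚ.≤ 1ℚ ⊎ 1ℚ ℚ.≤ ½ ℚ.* δ → ‖ exp (- z) ‖≤ (1ℚ ℚ.+ δ)
    bound-for δ 0<δ (inj₁ ≤1) = subst (λ e → ‖ _ ‖≤ (1ℚ ℚ.+ e)) (½+½ δ) (go (½ ℚ.* δ) (½pos 0<δ) ≤1)
    bound-for δ 0<δ (inj₂ 1≤) = ‖‖-mono
      (ℚP.+-monoʳ-≤ 1ℚ (ℚP.≤-trans (ℚP.+-mono-≤ 1≤ 1≤) (ℚP.≤-reflexive (½+½ δ)))) (go 1ℚ 0<1 ℚP.≤-refl)

  conj-0 : conj 0# ≈ 0#
  conj-0 = ≈-trans (conj-cong (≈-sym ι-0)) (≈-trans (conj-ι 0ℚ) ι-0)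

  conj-1 : conj 1# ≈ 1#
  conj-1 = ≈-trans (conj-cong (≈-sym ι-1)) (≈-trans (conj-ι 1ℚ) ι-1)

  conj-neg : ∀ z → conj (- z) ≈ - conj z
  conj-neg z = ≈-trans (conj-cong (solve 1 (λ z → :- z := con (ℚ.- 1ℚ) :* z) ≈-refl z))
    (≈-trans (conj-* _ _) (≈-trans (*-congʳ (conj-ι _)) (solve 1 (λ z → con (ℚ.- 1ℚ) :* z := :- z) ≈-refl (conj z))))

  conj-expTerm : ∀ z k → conj (expTerm z k) ≈ expTerm (conj z) k
  conj-expTerm z zero    = conj-1
  conj-expTerm z (suc k) = ≈-trans (conj-* _ _) (*-cong (conj-ι _) (≈-trans (conj-* _ _) (*-congˡ (conj-expTerm z k))))

  conj-exp : ∀ z → conj (exp z) ≈ exp (conj z)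
  conj-exp z = ⟶-unique (λ ε 0<ε →
      let N , p = exp-series z ε 0<ε
      in N , λ n N≤n → ‖‖-cong (≈-trans (conj-+ _ _) (+-cong (conj-Σ (downFrom n)) (conj-neg _))) (‖conj‖ (p n N≤n)))
    (exp-series (conj z))
    where
    conj-Σ : ∀ ks → conj (Σ (expTerm z) ks) ≈ Σ (expTerm (conj z)) ks
    conj-Σ []       = conj-0
    conj-Σ (k ∷ ks) = ≈-trans (conj-+ _ _) (+-cong (conj-expTerm z k) (conj-Σ ks))

  -- The series has real coefficients, so for imaginary z the conjugate of `exp z` is its inverse
  -- `exp (- z)`.
  ‖exp-imaginary‖ : conj z ≈ - z → ‖ exp z ‖≤ (+ 2 ℚ./ 1)
  ‖exp-imaginary‖ {z} h = ‖‖-conj-1 _ (‖‖-cong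
    (≈-sym (≈-trans (*-congˡ (≈-trans (conj-exp z) (exp-cong h))) (exp-neg z))) ‖1‖)

-- π and the period of exp

module RationalArctangent where
  open RiemannSumLemmas using (f-anti; f-nonneg; dyadic-double; dyadic-mono; dyadic-nonneg)
  open ℚ-Solver

  -- Derived from the integrand `4/1+t²` of π, whose monotonicity carries over and whose Riemann
  -- sums then match up to rational factors.
  1/[1+_²] : ℚ → ℚ
  1/[1+ t ²] = (+ 1 ℚ./ 4) ℚ.* 4/1+t² t

  1+t²-inverse : ∀ t → (1ℚ ℚ.+ t ℚ.* t) ℚ.* 1/[1+ t ²] ≡ 1ℚ
  1+t²-inverse t = ≡.trans
    (solve 2 (λ d e → d :* (con (+ 1 ℚ./ 4) :* (con (+ 4 ℚ./ 1) :* e)) := d :* e) ≡.refl (1ℚ ℚ.+ t ℚ.* t) _)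
    (ℚP.*-inverseʳ (1ℚ ℚ.+ t ℚ.* t) {{1+p²-nonZero t}})

  1/[1+t²]-nonneg : ∀ t → 0ℚ ℚ.≤ 1/[1+ t ²]
  1/[1+t²]-nonneg t = *-nonneg (ℚP.nonNegative⁻¹ (+ 1 ℚ./ 4)) (f-nonneg t)

  1/[1+t²]≤1 : ∀ {t} → 0ℚ ℚ.≤ t → 1/[1+ t ²] ℚ.≤ 1ℚ
  1/[1+t²]≤1 0≤t = *-monoˡ (ℚP.nonNegative⁻¹ (+ 1 ℚ./ 4)) (f-anti ℚP.≤-refl 0≤t)

  dyadic-suc : ∀ k j → dyadic k (suc j) ≡ dyadic k j ℚ.+ half k
  dyadic-suc k j = ≡.trans (cong (ℚ._* half k) (/1-+ (+ 1) (+ j)))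
    (solve 2 (λ j h → (con 1ℚ :+ j) :* h := j :* h :+ h) ≡.refl (fromℤ/1 (+ j)) (half k))

  dyadic-full : ∀ k → dyadic k (2 ℕ.^ k) ≡ 1ℚ
  dyadic-full zero    = ≡.refl
  dyadic-full (suc k) = ≡.trans (dyadic-double k (2 ℕ.^ k)) (dyadic-full k)

  dyadic≤1 : ∀ k {j} → j ℕ.≤ 2 ℕ.^ k → dyadic k j ℚ.≤ 1ℚ
  dyadic≤1 k j≤ = ℚP.≤-trans (dyadic-mono k j≤) (ℚP.≤-reflexive (dyadic-full k))

module Period (C : ComplexField) where
  open ComplexField C
  open Exponential C
  open Solver
  open RationalArctangent
  open RiemannSumLemmas using (dyadic-nonneg)
  module Q = ℚ-Solver

  exp-⟶ : ∀ {s x} → s ⟶ x → (exp ∘ s) ⟶ exp x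
  exp-⟶ {s} {x} lim = ⟶-resp (*-identityʳ _) (⟶-cong
    (λ n → ≈-trans (≈-sym (exp-+ x (s n - x))) (exp-cong (solve 2 (λ x s → x :+ (s :- x) := s) ≈-refl x (s n))))
    (⟶-* (⟶-const (exp x)) factor))
    where
    factor : (λ n → exp (s n - x)) ⟶ 1#
    factor ε 0<ε =
      let N , p = lim (½ ℚ.* ε) (½pos 0<ε)
          M , q = lim 1ℚ 0<1
      in N ℕ.⊔ M , λ n h →
        let ‖e‖≤½ε = p n (ℕP.m⊔n≤o⇒m≤o N M h)
            ‖e‖≤1  = q n (ℕP.m⊔n≤o⇒n≤o N M h)
            -- Since d ≤ 1, also d² ≤ d; the quadratic remainder and the linear term each cost at
            -- most ½ε.
            d = ½ ℚ.* ε ℚ.⊓ 1ℚ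
            ‖e‖≤d : ‖ s n - x ‖≤ d
            ‖e‖≤d = case ℚP.≤-total (½ ℚ.* ε) 1ℚ of λ where
              (inj₁ le) → ‖‖-≡ (≡.sym (ℚP.p≤q⇒p⊓q≡p le)) ‖e‖≤½ε
              (inj₂ ge) → ‖‖-≡ (≡.sym (ℚP.p≥q⇒p⊓q≡q ge)) ‖e‖≤1
            d≤1 = ℚP.p⊓q≤q (½ ℚ.* ε) 1ℚ
            d≤½ε = ℚP.p⊓q≤p (½ ℚ.* ε) 1ℚ
        in halves (‖‖-mono (ℚP.+-mono-≤ (ℚP.≤-trans (ℚP.≤-trans (*-monoˡ (‖‖-nonneg ‖e‖≤d) d≤1) (ℚP.≤-reflexive (ℚP.*-identityʳ d))) d≤½ε) d≤½ε)
             (‖‖-cong (solve 2 (λ E e → (E :- (con 1ℚ :+ e)) :+ e := E :- con 1ℚ) ≈-refl (exp (s n - x)) (s n - x)  |> ≈-via-ι-1)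
               (‖‖-+ (exp-remainder ‖e‖≤d d≤1) ‖e‖≤d)))
      where
      ≈-via-ι-1 : ∀ {E e} → (E - (ι 1ℚ + e)) + e ≈ E - ι 1ℚ → (E - (1# + e)) + e ≈ E - 1#
      ≈-via-ι-1 h = ≈-trans (+-congʳ (+-congˡ (-‿cong (+-congʳ (≈-sym ι-1))))) (≈-trans h (+-congˡ (-‿cong ι-1)))

  9ℚ 2ℚ 90ℚ : ℚ
  9ℚ = + 9 ℚ./ 1
  2ℚ = + 2 ℚ./ 1
  90ℚ = + 90 ℚ./ 1

  -- `‖exp‖` needs a bound of at most 1, so it is applied to z/2, where it gives 3, and the result
  -- is squared.
  ‖exp‖≤9 : ∀ {z} → ‖ z ‖≤ 2ℚ → ‖ exp z ‖≤ 9ℚ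
  ‖exp‖≤9 {z} h = ‖‖-cong (≈-trans (≈-sym (exp-+ _ _)) (exp-cong (solve 1 (λ z → con ½ :* z :+ con ½ :* z := z) ≈-refl z)))
    (‖‖-* half-bound half-bound)
    where
    half-bound : ‖ exp (ι ½ * z) ‖≤ (+ 3 ℚ./ 1)
    half-bound = ‖exp‖ (‖‖-* (‖ι‖ ½) h) ℚP.≤-refl

  -- For κ = ±i, (1 + κ t) exp (- ∫₀ᵗ κ/(1+κs) ds) is constant; the integral is approximated by
  -- the left Riemann sum, and κ/(1+κt) = (κ+t)/(1+t²).
  module Integral (κ : Carrier) (κ² : κ * κ ≈ - 1#) (‖κ‖ : ‖ κ ‖≤ 1ℚ) (k : ℕ) where
    h : ℚ
    h = half k

    0≤h : 0ℚ ℚ.≤ h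
    0≤h = ℚP.<⇒≤ (half-pos k)

    t : ℕ → ℚ
    t = dyadic k

    a : ℕ → Carrier
    a j = (κ + ι (t j)) * ι 1/[1+ t j ²]

    integral : ℕ → Carrier
    integral zero    = 0#
    integral (suc j) = integral j + ι h * a j

    ratio : ℕ → Carrier
    ratio j = (1# + κ * ι (t j)) * exp (- integral j)

    a-inverse : ∀ j → (1# + κ * ι (t j)) * a j ≈ κ
    a-inverse j = begin
      (1# + κ * T) * ((κ + T) * V)
        ≈⟨ *-congʳ (+-congʳ (≈-sym ι-1)) ⟩
      (ι 1ℚ + κ * T) * ((κ + T) * V)
        ≈⟨ solve 3 (λ κ t v → (con 1ℚ :+ κ :* t) :* ((κ :+ t) :* v) :=
                              κ :* ((con 1ℚ :+ t :* t) :* v) :+ (κ :* κ :+ con 1ℚ) :* (t :* v)) ≈-refl κ T V ⟩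
      κ * ((ι 1ℚ + T * T) * V) + (κ * κ + ι 1ℚ) * (T * V)
        ≈⟨ +-cong (*-congˡ unit) (*-congʳ (≈-trans (+-cong κ² ι-1) (-‿inverseˡ 1#))) ⟩
      κ * 1# + 0# * (T * V)
        ≈⟨ ≈-trans (+-cong (*-identityʳ κ) (zeroˡ _)) (+-identityʳ κ) ⟩
      κ ∎
      where
      open import Relation.Binary.Reasoning.Setoid setoid
      T = ι (t j)
      V = ι 1/[1+ t j ²]
      unit : (ι 1ℚ + T * T) * V ≈ 1#
      unit = ≈-trans (*-congʳ (≈-trans (+-congˡ (≈-sym (ι-* _ _))) (≈-sym (ι-+ _ _))))
        (≈-trans (≈-sym (ι-* _ _)) (≈-trans (reflexive (cong ι (1+t²-inverse (t j)))) ι-1))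

    0≤t : ∀ j → 0ℚ ℚ.≤ t j
    0≤t = dyadic-nonneg k

    ‖ιt‖ : ∀ j → ‖ ι (t j) ‖≤ t j
    ‖ιt‖ j = ‖‖-≡ (∣p∣≡p (0≤t j)) (‖ι‖ (t j))

    ‖ιh‖ : ‖ ι h ‖≤ h
    ‖ιh‖ = ‖‖-≡ (∣p∣≡p 0≤h) (‖ι‖ h)

    ‖a‖ : ∀ {j} → j ℕ.≤ 2 ℕ.^ k → ‖ a j ‖≤ 2ℚ
    ‖a‖ {j} j≤ = ‖‖-* (‖‖-+ ‖κ‖ (‖‖-mono (dyadic≤1 k j≤) (‖ιt‖ j)))
      (‖‖-mono (1/[1+t²]≤1 (0≤t j)) (‖‖-≡ (∣p∣≡p (1/[1+t²]-nonneg (t j))) (‖ι‖ 1/[1+ t j ²])))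

    ‖integral‖ : ∀ {j} → j ℕ.≤ 2 ℕ.^ k → ‖ integral j ‖≤ (t j ℚ.* 2ℚ)
    ‖integral‖ {zero}  _  = ‖‖-mono (*-nonneg (0≤t 0) (ℚP.nonNegative⁻¹ 2ℚ)) ‖0‖
    ‖integral‖ {suc j} j< = ‖‖-≡
      (≡.trans (≡.sym (ℚP.*-distribʳ-+ 2ℚ (t j) h)) (cong (ℚ._* 2ℚ) (≡.sym (dyadic-suc k j))))
      (‖‖-+ (‖integral‖ (ℕP.<⇒≤ j<)) (‖‖-* ‖ιh‖ (‖a‖ (ℕP.<⇒≤ j<))))

    ‖1+κt‖ : ∀ {j} → j ℕ.≤ 2 ℕ.^ k → ‖ 1# + κ * ι (t j) ‖≤ 2ℚ
    ‖1+κt‖ {j} j≤ = ‖‖-+ ‖1‖ (‖‖-* ‖κ‖ (‖‖-mono (dyadic≤1 k j≤) (‖ιt‖ j)))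

    remainder : ℕ → Carrier
    remainder j = exp (- (ι h * a j)) - (1# + - (ι h * a j))

    -- With exp(-ha) = 1 - ha + remainder, the terms of first order in h combine to h(κ - (1+κt)a),
    -- which is 0 by `a-inverse`. What is left is of second order.
    ratio-step : ∀ j → ratio (suc j) - ratio j ≈
      exp (- integral j) * ((1# + κ * ι (t (suc j))) * remainder j + - ((ι h * ι h) * (κ * a j)))
    ratio-step j = begin
      (1# + κ * T′) * exp (- (integral j + ι h * a j)) - (1# + κ * T) * e
        ≈⟨ +-congʳ (*-congˡ (≈-trans (exp-cong (solve 2 (λ x y → :- (x :+ y) := (:- x) :+ (:- y)) ≈-refl (integral j) (ι h * a j)))
             (exp-+ _ _))) ⟩
      (1# + κ * T′) * (e * E) - (1# + κ * T) * e
        ≈⟨ +-congʳ (*-congʳ (+-congˡ (*-congˡ T′≈))) ⟩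
      (1# + κ * (T + ι h)) * (e * E) - (1# + κ * T) * e
        -- `1#` is passed to the solver as a variable o; the corrections with o·o - o and o - 1 are
        -- disposed of in `vanish`.
        ≈⟨ solve 7 (λ o κ t h e E a →
             (o :+ κ :* (t :+ h)) :* (e :* E) :- (o :+ κ :* t) :* e :=
             e :* ((o :+ κ :* (t :+ h)) :* (E :- (o :+ :- (h :* a))) :+
                   ((o :* o :- o) :+ κ :* (t :+ h) :* (o :- con 1ℚ) :+ h :* (κ :- (o :+ κ :* t) :* a) :- (h :* h) :* (κ :* a))))
             ≈-refl 1# κ T (ι h) e E (a j) ⟩
      e * ((1# + κ * (T + ι h)) * remainder j +
           ((1# * 1# - 1#) + κ * (T + ι h) * (1# - ι 1ℚ) + ι h * (κ - (1# + κ * T) * a j) - (ι h * ι h) * (κ * a j)))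
        ≈⟨ *-congˡ (+-cong (*-congʳ (+-congˡ (*-congˡ (≈-sym T′≈)))) (+-congʳ vanish)) ⟩
      e * ((1# + κ * T′) * remainder j + (0# - (ι h * ι h) * (κ * a j)))
        ≈⟨ *-congˡ (+-congˡ (+-identityˡ _)) ⟩
      e * ((1# + κ * T′) * remainder j + - ((ι h * ι h) * (κ * a j))) ∎
      where
      open import Relation.Binary.Reasoning.Setoid setoid
      T = ι (t j)
      T′ = ι (t (suc j))
      e = exp (- integral j)
      E = exp (- (ι h * a j))
      T′≈ : T′ ≈ T + ι h
      T′≈ = ≈-trans (reflexive (cong ι (dyadic-suc k j))) (ι-+ _ _)
      vanish : (1# * 1# - 1#) + κ * (T + ι h) * (1# - ι 1ℚ) + ι h * (κ - (1# + κ * T) * a j) ≈ 0#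
      vanish = ≈-trans (+-cong (+-cong (≈-trans (+-congʳ (*-identityˡ 1#)) (-‿inverseʳ 1#))
          (≈-trans (*-congˡ (≈-trans (+-congˡ (-‿cong ι-1)) (-‿inverseʳ 1#))) (zeroʳ _)))
          (≈-trans (*-congˡ (≈-trans (+-congˡ (-‿cong (a-inverse j))) (-‿inverseʳ κ))) (zeroʳ _)))
        (≈-trans (+-identityʳ _) (+-identityʳ _))

    module _ (h≤½ : h ℚ.≤ ½) where

      -- 9 bounds the exponential, 2 bounds 1+κt, (2h)² the remainder and 2 bounds κa: 9(2·4 + 2)h²
      -- = 90h². Over 2ᵏ steps of length h these errors add up to 90h.
      ‖ratio-step‖ : ∀ {j} → suc j ℕ.≤ 2 ℕ.^ k → ‖ ratio (suc j) - ratio j ‖≤ (h ℚ.* (90ℚ ℚ.* h))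
      ‖ratio-step‖ {j} j< = ‖‖-cong (≈-sym (ratio-step j)) (‖‖-≡
        (Q.solve 1 (λ h → Q.con 9ℚ Q.:* (Q.con 2ℚ Q.:* ((h Q.:* Q.con 2ℚ) Q.:* (h Q.:* Q.con 2ℚ)) Q.:+ (h Q.:* h) Q.:* Q.con 2ℚ)
           Q.:= h Q.:* (Q.con 90ℚ Q.:* h)) ≡.refl h)
        (‖‖-* (‖exp‖≤9 (‖neg‖ (‖‖-mono (≤2 (dyadic≤1 k j≤)) (‖integral‖ j≤))))
          (‖‖-+ (‖‖-* (‖1+κt‖ j<) (exp-remainder (‖neg‖ (‖‖-* ‖ιh‖ (‖a‖ j≤))) (h*2≤1)))
                (‖neg‖ (‖‖-* (‖‖-* ‖ιh‖ ‖ιh‖) (‖‖-* ‖κ‖ (‖a‖ j≤)))))))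
        where
        j≤ = ℕP.<⇒≤ j<
        ≤2 : ∀ {p} → p ℚ.≤ 1ℚ → p ℚ.* 2ℚ ℚ.≤ 2ℚ
        ≤2 p≤1 = ℚP.*-monoʳ-≤-nonNeg 2ℚ p≤1
        h*2≤1 : h ℚ.* 2ℚ ℚ.≤ 1ℚ
        h*2≤1 = ℚP.*-monoʳ-≤-nonNeg 2ℚ h≤½

      ‖ratio-1‖ : ∀ {j} → j ℕ.≤ 2 ℕ.^ k → ‖ ratio j - 1# ‖≤ (t j ℚ.* (90ℚ ℚ.* h))
      ‖ratio-1‖ {zero} _ = ‖‖-mono (*-nonneg (0≤t 0) (*-nonneg (ℚP.nonNegative⁻¹ 90ℚ) 0≤h)) (≈⇒‖-‖
        (≈-trans (*-cong (≈-trans (+-congˡ (≈-trans (*-congˡ (≈-trans (reflexive (cong ι (ℚP.*-zeroˡ h))) ι-0)) (zeroʳ κ))) (+-identityʳ 1#))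
          (exp-0 (≈-trans (≈-sym (+-identityˡ _)) (-‿inverseʳ 0#)))) (*-identityˡ 1#)))
      ‖ratio-1‖ {suc j} j< = ‖‖-≡
        (≡.trans (Q.solve 3 (λ t h n → h Q.:* n Q.:+ t Q.:* n Q.:= (t Q.:+ h) Q.:* n) ≡.refl (t j) h (90ℚ ℚ.* h))
          (cong (ℚ._* (90ℚ ℚ.* h)) (≡.sym (dyadic-suc k j))))
        (dist-trans (‖ratio-step‖ j<) (‖ratio-1‖ (ℕP.<⇒≤ j<)))

      ‖full-ratio-1‖ : ‖ (1# + κ) * exp (- integral (2 ℕ.^ k)) - 1# ‖≤ (90ℚ ℚ.* h)
      ‖full-ratio-1‖ = ‖‖-≡ (≡.trans (cong (ℚ._* (90ℚ ℚ.* h)) (dyadic-full k)) (ℚP.*-identityˡ _))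
        (‖‖-cong (+-congʳ (*-congʳ (+-congˡ (≈-trans (*-congˡ (≈-trans (reflexive (cong ι (dyadic-full k))) ι-1)) (*-identityʳ κ)))))
          (‖ratio-1‖ ℕP.≤-refl))

  ‖-J‖ : ‖ - J ‖≤ 1ℚ
  ‖-J‖ = ‖neg‖ ‖J‖

  -J*-J : - J * - J ≈ - 1#
  -J*-J = ≈-trans (solve 1 (λ j → (:- j) :* (:- j) := j :* j) ≈-refl J) J*J

  module I⁺ = Integral J J*J ‖J‖
  module I⁻ = Integral (- J) -J*-J ‖-J‖

  full : ∀ κ (κ² : κ * κ ≈ - 1#) (‖κ‖ : ‖ κ ‖≤ 1ℚ) →
    (λ k → (1# + κ) * exp (- Integral.integral κ κ² ‖κ‖ k (2 ℕ.^ k))) ⟶ 1#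
  full κ κ² ‖κ‖ ε 0<ε =
    let N , small = scaled-recip 90ℚ ε (ℚP.nonNegative⁻¹ 90ℚ) 0<ε
    -- Starting at `suc N` excludes k = 0, where the step length 1 exceeds ½.
    in suc N , λ { (suc k) (ℕ.s≤s N≤k) → ‖‖-mono
         (ℚP.≤-trans (*-monoˡ (ℚP.nonNegative⁻¹ 90ℚ) (half≤recip (suc k))) (small (suc k) (ℕP.m≤n⇒m≤1+n N≤k)))
         (Integral.‖full-ratio-1‖ κ κ² ‖κ‖ (suc k)
           (ℚP.≤-trans (half≤recip (suc k)) (recip-anti {1} {suc k} (ℕ.s≤s ℕ.z≤n)))) }

  -- The integrands (±i+t)/(1+t²) differ by 2i/(1+t²), half of i times the integrand of π. At j = 2ᵏ
  -- the difference therefore tends to iπ/2.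
  integral-difference : ∀ k j → I⁺.integral k j - I⁻.integral k j ≈ J * ι (½ ℚ.* (half k ℚ.* Σ< j (λ m → 4/1+t² (dyadic k m))))
  integral-difference k zero = ≈-trans (-‿inverseʳ 0#) (≈-sym (≈-trans (*-congˡ
    (≈-trans (reflexive (cong ι (Q.solve 1 (λ h → Q.con ½ Q.:* (h Q.:* Q.con 0ℚ) Q.:= Q.con 0ℚ) ≡.refl (half k)))) ι-0)) (zeroʳ J)))
  integral-difference k (suc j) = begin
    (A⁺ + H * ((J + T) * V)) - (A⁻ + H * ((- J + T) * V))
      ≈⟨ solve 6 (λ p n h j t v → (p :+ h :* ((j :+ t) :* v)) :- (n :+ h :* (((:- j) :+ t) :* v)) :=
                   (p :- n) :+ j :* (con 2ℚ :* (h :* v))) ≈-refl A⁺ A⁻ H J T V ⟩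
    (A⁺ - A⁻) + J * (ι 2ℚ * (H * V))
      ≈⟨ +-cong (integral-difference k j) (*-congˡ (≈-trans (*-congˡ (≈-sym (ι-* _ _))) (≈-sym (ι-* _ _)))) ⟩
    J * ι (½ ℚ.* (half k ℚ.* S)) + J * ι (2ℚ ℚ.* (half k ℚ.* 1/[1+ dyadic k j ²]))
      ≈⟨ ≈-trans (≈-sym (distribˡ J _ _)) (*-congˡ (≈-sym (ι-+ _ _))) ⟩
    J * ι (½ ℚ.* (half k ℚ.* S) ℚ.+ 2ℚ ℚ.* (half k ℚ.* ((+ 1 ℚ./ 4) ℚ.* 4/1+t² (dyadic k j))))
      ≈⟨ *-congˡ (reflexive (cong ι (Q.solve 3 (λ h s f → Q.con ½ Q.:* (h Q.:* s) Q.:+ Q.con 2ℚ Q.:* (h Q.:* (Q.con (+ 1 ℚ./ 4) Q.:* f))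
           Q.:= Q.con ½ Q.:* (h Q.:* (s Q.:+ f))) ≡.refl (half k) S (4/1+t² (dyadic k j))))) ⟩
    J * ι (½ ℚ.* (half k ℚ.* (S ℚ.+ 4/1+t² (dyadic k j)))) ∎
    where
    open import Relation.Binary.Reasoning.Setoid setoid
    A⁺ = I⁺.integral k j
    A⁻ = I⁻.integral k j
    H = ι (half k)
    T = ι (dyadic k j)
    V = ι 1/[1+ dyadic k j ²]
    S = Σ< j (λ m → 4/1+t² (dyadic k m))

  -- exp of the two integrals tends to 1+i and 1-i, so exp of their difference tends to (1+i)/(1-i)
  -- = i. Division is avoided by proving (1-i)X = 1+i, the statement `limit`.
  exp-quarter-turn : exp (J * (ι ½ * Π)) ≈ J
  exp-quarter-turn = begin
    X
      -- (1+J)/2 inverts 1-J because J² = -1; the solver does not know this and leaves a multiple of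
      -- J² + 1.
      ≈⟨ solve 2 (λ j x → x := (con ½ :* (con 1ℚ :+ j)) :* ((con 1ℚ :- j) :* x) :+ con ½ :* ((j :* j :+ con 1ℚ) :* x)) ≈-refl J X ⟩
    (ι ½ * (ι 1ℚ + J)) * ((ι 1ℚ - J) * X) + ι ½ * ((J * J + ι 1ℚ) * X)
      ≈⟨ +-cong (*-congˡ limit) (*-congˡ (*-congʳ J²+1)) ⟩
    (ι ½ * (ι 1ℚ + J)) * (ι 1ℚ + J) + ι ½ * (0# * X)
      ≈⟨ +-cong (solve 1 (λ j → (con ½ :* (con 1ℚ :+ j)) :* (con 1ℚ :+ j) := j :+ con ½ :* (j :* j :+ con 1ℚ)) ≈-refl J)
           (*-congˡ (zeroˡ X)) ⟩
    (J + ι ½ * (J * J + ι 1ℚ)) + ι ½ * 0#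
      ≈⟨ +-cong (+-congˡ (≈-trans (*-congˡ J²+1) (zeroʳ _))) (zeroʳ _) ⟩
    (J + 0#) + 0#
      ≈⟨ ≈-trans (+-identityʳ _) (+-identityʳ J) ⟩
    J ∎
    where
    open import Relation.Binary.Reasoning.Setoid setoid
    X = exp (J * (ι ½ * Π))
    J²+1 : J * J + ι 1ℚ ≈ 0#
    J²+1 = ≈-trans (+-cong J*J ι-1) (-‿inverseˡ 1#)
    A⁺ A⁻ : ℕ → Carrier
    A⁺ k = I⁺.integral k (2 ℕ.^ k)
    A⁻ k = I⁻.integral k (2 ℕ.^ k)
    angle : ℕ → Carrier
    angle k = J * (ι ½ * ι (riemannSum k))
    sequences : ∀ k → (1# + - J) * (((1# + J) * exp (- A⁺ k)) * exp (angle k)) ≈ (1# + J) * ((1# + - J) * exp (- A⁻ k))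
    sequences k = ≈-trans
      (solve 4 (λ o j e x → (o :+ :- j) :* (((o :+ j) :* e) :* x) := (o :+ j) :* ((o :+ :- j) :* (e :* x))) ≈-refl 1# J _ _)
      (*-congˡ (*-congˡ (≈-trans (≈-sym (exp-+ _ _)) (exp-cong
        (≈-trans (+-congˡ (≈-trans (*-congˡ (≈-sym (ι-* _ _))) (≈-sym (integral-difference k (2 ℕ.^ k)))))
          (solve 2 (λ p n → (:- p) :+ (p :- n) := :- n) ≈-refl (A⁺ k) (A⁻ k)))))))
    limit : (ι 1ℚ - J) * X ≈ ι 1ℚ + J
    limit = ≈-trans (≈-trans (*-congʳ (+-congʳ ι-1)) (≈-trans (≈-sym (*-congˡ (*-identityˡ X)))
      (⟶-unique
        (⟶-cong sequences (⟶-* (⟶-const _) (⟶-* (full J J*J ‖J‖) (exp-⟶ (⟶-* (⟶-const J) (⟶-* (⟶-const (ι ½)) Π-series))))))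
        (⟶-* (⟶-const (1# + J)) (full (- J) -J*-J ‖-J‖)))))
      (≈-trans (*-identityʳ _) (+-congʳ (≈-sym ι-1)))

  exp-full-turn : exp (ι 2ℚ * (J * Π)) ≈ 1#
  exp-full-turn = begin
    exp (ι 2ℚ * (J * Π))
      ≈⟨ exp-cong (solve 2 (λ j p → con 2ℚ :* (j :* p) := (q j p :+ q j p) :+ (q j p :+ q j p)) ≈-refl J Π) ⟩
    exp ((Y + Y) + (Y + Y))
      ≈⟨ ≈-trans (exp-+ _ _) (*-cong twice twice) ⟩
    - 1# * - 1#
      ≈⟨ ≈-trans (solve 1 (λ o → (:- o) :* (:- o) := o :* o) ≈-refl 1#) (*-identityˡ 1#) ⟩
    1# ∎
    where
    open import Relation.Binary.Reasoning.Setoid setoid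
    q = λ j p → j :* (con ½ :* p)
    Y = J * (ι ½ * Π)
    twice : exp (Y + Y) ≈ - 1#
    twice = ≈-trans (exp-+ Y Y) (≈-trans (*-cong exp-quarter-turn exp-quarter-turn) J*J)

-- The involution on triples of lattice points

module Reflection where

  record Residue (d : ℤ) : Set where
    constructor residue
    field
      remainder : Fin 3
      quotient  : ℤ
      equation  : d ≡ + 3 ℤ.* quotient ℤ.+ + toℕ remainder

  residue-of : ∀ d → Residue d
  residue-of d = residue (fromℕ< (ℤD.n%ℕd<d d 3)) (d ℤD./ℕ 3)
    (≡.trans (ℤD.a≡a%ℕn+[a/ℕn]*n d 3) (≡.trans (ℤP.+-comm (+ (d ℤD.%ℕ 3)) ((d ℤD./ℕ 3) ℤ.* + 3))
      (cong₂ ℤ._+_ (ℤP.*-comm (d ℤD./ℕ 3) (+ 3)) (cong +_ (≡.sym (toℕ-fromℕ< (ℤD.n%ℕd<d d 3)))))))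

  private
    difference<3 : ∀ (a b : Fin 3) → ℤ.∣ + toℕ b ℤ.- + toℕ a ∣ ℕ.< 3
    difference<3 = toWitness {a? = all? λ a → all? λ b → ℤ.∣ + toℕ b ℤ.- + toℕ a ∣ ℕ.<? 3} _

    triple<3⇒0 : ∀ e {c} → ℤ.∣ c ∣ ℕ.< 3 → + 3 ℤ.* e ≡ c → e ≡ + 0
    triple<3⇒0 e {c} c<3 eq = ℤP.∣i∣≡0⇒i≡0 (zero-if (ℤ.∣ e ∣) ≡.refl)
      where
      3∣e∣<3 : 3 ℕ.* ℤ.∣ e ∣ ℕ.< 3
      3∣e∣<3 = subst (ℕ._< 3) (≡.trans (cong ℤ.∣_∣ (≡.sym eq)) (ℤP.abs-* (+ 3) e)) c<3
      zero-if : ∀ n → ℤ.∣ e ∣ ≡ n → ℤ.∣ e ∣ ≡ 0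
      zero-if zero    h = h
      zero-if (suc n) h = ⊥-elim (ℕP.<⇒≱ 3∣e∣<3 (subst (λ m → 3 ℕ.≤ 3 ℕ.* m) (≡.sym h) (ℕP.m≤m*n 3 (suc n))))

  -- Lets the residue computed for `defect (φ T)` be replaced by one written down explicitly, so
  -- that `reflect` reduces on it.
  residue-unique : ∀ {d} (r s : Residue d) → r ≡ s
  residue-unique {d} (residue a m e) (residue b n f) = combine m≡n a≡b
    where
    uip : ∀ {x y : ℤ} (p q : x ≡ y) → p ≡ q
    uip ≡.refl ≡.refl = ≡.refl
    open ℤ-Solver
    3[m-n] : + 3 ℤ.* (m ℤ.- n) ≡ + toℕ b ℤ.- + toℕ a
    3[m-n] = ≡.trans
      (solve 3 (λ m n a → con (+ 3) :* (m :- n) := (con (+ 3) :* m :+ a) :- (con (+ 3) :* n :+ a)) ≡.refl m n (+ toℕ a))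
      (≡.trans (cong (ℤ._- (+ 3 ℤ.* n ℤ.+ + toℕ a)) (≡.trans (≡.sym e) f))
        (solve 3 (λ n a b → (con (+ 3) :* n :+ b) :- (con (+ 3) :* n :+ a) := b :- a) ≡.refl n (+ toℕ a) (+ toℕ b)))
    m-n≡0 : m ℤ.- n ≡ + 0
    m-n≡0 = triple<3⇒0 (m ℤ.- n) (difference<3 a b) 3[m-n]
    m≡n : m ≡ n
    m≡n = ℤP.i-j≡0⇒i≡j m n m-n≡0
    a≡b : a ≡ b
    a≡b = toℕ-injective (ℤP.+-injective (≡.sym (ℤP.i-j≡0⇒i≡j (+ toℕ b) (+ toℕ a)
      (≡.trans (≡.sym 3[m-n]) (cong (+ 3 ℤ.*_) m-n≡0)))))
    combine : m ≡ n → a ≡ b → residue {d} a m e ≡ residue b n f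
    combine ≡.refl ≡.refl = cong (residue a m) (uip e f)

  Triple : Set → Set
  Triple A = A × (A × A)

  mapT : ∀ {A B : Set} → (A → B) → Triple A → Triple B
  mapT f (a , b , c) = f a , f b , f c

  sumT : Triple ℤ → ℤ
  sumT (a , b , c) = a ℤ.+ (b ℤ.+ c)

  -- For a term (k , ℓ) of C(x,y): the part of the exponent of q depending on (k , ℓ), and the
  -- exponents of e^(2ix) and e^(2iy), including the prefactor e^(2ix) e^(2iy).
  quadratic x-weight y-weight : ℤ × ℤ → ℤ
  quadratic (k , ℓ) = ℓ ℤ.* ℓ ℤ.+ ℓ ℤ.* k ℤ.+ k ℤ.* k ℤ.+ k ℤ.+ ℓ
  x-weight  (k , ℓ) = (+ 2 ℤ.* ℓ ℤ.+ k) ℤ.+ + 1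
  y-weight  (k , ℓ) = (+ 2 ℤ.* k ℤ.+ ℓ) ℤ.+ + 1

  Q X Y K defect : Triple (ℤ × ℤ) → ℤ
  Q = sumT ∘ mapT quadratic
  X = sumT ∘ mapT x-weight
  Y = sumT ∘ mapT y-weight
  K = sumT ∘ mapT proj₁
  defect T = sumT (mapT proj₂ T) ℤ.- K T

  -- In a = k + 1/3, b = ℓ + 1/3 the deviations from the centroid undergo (a,b) ↦ (a+b, -a) in
  -- `reflect₁` and the inverse (a,b) ↦ (-b, a+b) in `reflect₂`; the constants are those that negate
  -- the centroid when the defect is 3m+1, respectively 3m+2.
  reflect₁ reflect₂ : ℤ → Triple (ℤ × ℤ) → Triple (ℤ × ℤ)
  reflect₁ m T = mapT (λ (k , ℓ) → (ℓ ℤ.+ k) ℤ.- (m ℤ.+ + 1) ℤ.- K T , ℤ.- k ℤ.- (m ℤ.+ + 1)) T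
  reflect₂ m T = mapT (λ (k , ℓ) → ℤ.- ℓ ℤ.+ m , (ℓ ℤ.+ k) ℤ.- K T ℤ.- + 2 ℤ.* m ℤ.- + 2) T

  reflect : Triple (ℤ × ℤ) → ∀ {d} → Residue d → Triple (ℤ × ℤ)
  reflect T (residue zero m _)             = T
  reflect T (residue (suc zero) m _)       = reflect₁ m T
  reflect T (residue (suc (suc zero)) m _) = reflect₂ m T

  φ : Triple (ℤ × ℤ) → Triple (ℤ × ℤ)
  φ T = reflect T (residue-of (defect T))

  private
    pattern ⟨_,_∣_,_∣_,_⟩ k₁ l₁ k₂ l₂ k₃ l₃ = (k₁ , l₁) , (k₂ , l₂) , (k₃ , l₃)

    open ℤ-Solver

    -- The identities below hold only where the defect is 3m+c. This equation is linear in `l₃` with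
    -- coefficient 1; substituting for `l₃` leaves polynomial identities in free variables, which
    -- the solver decides.
    last-coordinate : ∀ k₁ l₁ k₂ l₂ k₃ l₃ v → defect ⟨ k₁ , l₁ ∣ k₂ , l₂ ∣ k₃ , l₃ ⟩ ≡ v →
      l₃ ≡ v ℤ.+ (k₁ ℤ.+ (k₂ ℤ.+ k₃)) ℤ.- l₁ ℤ.- l₂
    last-coordinate k₁ l₁ k₂ l₂ k₃ l₃ v e = ≡.trans
      (solve 6 (λ k₁ l₁ k₂ l₂ k₃ l₃ → l₃ := (((l₁ :+ (l₂ :+ l₃)) :- (k₁ :+ (k₂ :+ k₃))) :+ (k₁ :+ (k₂ :+ k₃))) :- l₁ :- l₂)
        ≡.refl k₁ l₁ k₂ l₂ k₃ l₃)
      (cong (λ v → v ℤ.+ (k₁ ℤ.+ (k₂ ℤ.+ k₃)) ℤ.- l₁ ℤ.- l₂) e)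

    -- The names with a leading colon copy the definitions above into the syntax of the solver.
    :quadratic : ∀ {n} → Polynomial n → Polynomial n → Polynomial n
    :quadratic k l = l :* l :+ l :* k :+ k :* k :+ k :+ l
    :x :y : ∀ {n} → Polynomial n → Polynomial n → Polynomial n
    :x k l = (con (+ 2) :* l :+ k) :+ con (+ 1)
    :y k l = (con (+ 2) :* k :+ l) :+ con (+ 1)

    record :Triple (n : ℕ) : Set where
      constructor :⟨_,_∣_,_∣_,_⟩
      field a₁ b₁ a₂ b₂ a₃ b₃ : Polynomial n
    open :Triple

    :sum : ∀ {n} → (Polynomial n → Polynomial n → Polynomial n) → :Triple n → Polynomial n
    :sum f T = f (a₁ T) (b₁ T) :+ (f (a₂ T) (b₂ T) :+ f (a₃ T) (b₃ T))
    :map : ∀ {n} → (Polynomial n → Polynomial n → Polynomial n) → (Polynomial n → Polynomial n → Polynomial n) → :Triple n → :Triple n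
    :map f g T = :⟨ f (a₁ T) (b₁ T) , g (a₁ T) (b₁ T) ∣ f (a₂ T) (b₂ T) , g (a₂ T) (b₂ T) ∣ f (a₃ T) (b₃ T) , g (a₃ T) (b₃ T) ⟩
    :K :d : ∀ {n} → :Triple n → Polynomial n
    :K = :sum (λ k l → k)
    :d T = :sum (λ k l → l) T :- :K T
    :reflect₁ :reflect₂ : ∀ {n} → Polynomial n → :Triple n → :Triple n
    :reflect₁ m T = :map (λ k l → (l :+ k) :- (m :+ con (+ 1)) :- :K T) (λ k l → :- k :- (m :+ con (+ 1))) T
    :reflect₂ m T = :map (λ k l → :- l :+ m) (λ k l → (l :+ k) :- :K T :- con (+ 2) :* m :- con (+ 2)) T
    -- The triple with defect 3m+c and the other five coordinates free.
    :with-defect : ∀ {n} → ℤ → (k₁ l₁ k₂ l₂ k₃ m : Polynomial n) → :Triple n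
    :with-defect c k₁ l₁ k₂ l₂ k₃ m =
      :⟨ k₁ , l₁ ∣ k₂ , l₂ ∣ k₃ , (con (+ 3) :* m :+ con c) :+ (k₁ :+ (k₂ :+ k₃)) :- l₁ :- l₂ ⟩
    :m′ : ∀ {n} → Polynomial n → Polynomial n
    :m′ m = :- m :- con (+ 1)

  record Reflected (T T′ : Triple (ℤ × ℤ)) : Set where
    field
      Q-eq : Q T′ ≡ Q T
      X-eq : X T′ ≡ ℤ.- X T
      Y-eq : Y T′ ≡ ℤ.- Y T

  open Reflected

  private
    reflect₁-reflected : ∀ T m → defect T ≡ + 3 ℤ.* m ℤ.+ + 1 → Reflected T (reflect₁ m T)
    reflect₁-reflected ⟨ k₁ , l₁ ∣ k₂ , l₂ ∣ k₃ , l₃ ⟩ m e with last-coordinate k₁ l₁ k₂ l₂ k₃ l₃ _ e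
    ... | ≡.refl = record
      { Q-eq = solve 6 (λ k₁ l₁ k₂ l₂ k₃ m → let T = :with-defect (+ 1) k₁ l₁ k₂ l₂ k₃ m in
                 :sum :quadratic (:reflect₁ m T) := :sum :quadratic T) ≡.refl k₁ l₁ k₂ l₂ k₃ m
      ; X-eq = solve 6 (λ k₁ l₁ k₂ l₂ k₃ m → let T = :with-defect (+ 1) k₁ l₁ k₂ l₂ k₃ m in
                 :sum :x (:reflect₁ m T) := :- (:sum :x T)) ≡.refl k₁ l₁ k₂ l₂ k₃ m
      ; Y-eq = solve 6 (λ k₁ l₁ k₂ l₂ k₃ m → let T = :with-defect (+ 1) k₁ l₁ k₂ l₂ k₃ m in
                 :sum :y (:reflect₁ m T) := :- (:sum :y T)) ≡.refl k₁ l₁ k₂ l₂ k₃ m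
      }

    reflect₂-reflected : ∀ T m → defect T ≡ + 3 ℤ.* m ℤ.+ + 2 → Reflected T (reflect₂ m T)
    reflect₂-reflected ⟨ k₁ , l₁ ∣ k₂ , l₂ ∣ k₃ , l₃ ⟩ m e with last-coordinate k₁ l₁ k₂ l₂ k₃ l₃ _ e
    ... | ≡.refl = record
      { Q-eq = solve 6 (λ k₁ l₁ k₂ l₂ k₃ m → let T = :with-defect (+ 2) k₁ l₁ k₂ l₂ k₃ m in
                 :sum :quadratic (:reflect₂ m T) := :sum :quadratic T) ≡.refl k₁ l₁ k₂ l₂ k₃ m
      ; X-eq = solve 6 (λ k₁ l₁ k₂ l₂ k₃ m → let T = :with-defect (+ 2) k₁ l₁ k₂ l₂ k₃ m in
                 :sum :x (:reflect₂ m T) := :- (:sum :x T)) ≡.refl k₁ l₁ k₂ l₂ k₃ m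
      ; Y-eq = solve 6 (λ k₁ l₁ k₂ l₂ k₃ m → let T = :with-defect (+ 2) k₁ l₁ k₂ l₂ k₃ m in
                 :sum :y (:reflect₂ m T) := :- (:sum :y T)) ≡.refl k₁ l₁ k₂ l₂ k₃ m
      }

    triple-≡ : ∀ {a b c d e f a′ b′ c′ d′ e′ f′ : ℤ} → a ≡ a′ → b ≡ b′ → c ≡ c′ → d ≡ d′ → e ≡ e′ → f ≡ f′ →
      ⟨ a , b ∣ c , d ∣ e , f ⟩ ≡ ⟨ a′ , b′ ∣ c′ , d′ ∣ e′ , f′ ⟩
    triple-≡ ≡.refl ≡.refl ≡.refl ≡.refl ≡.refl ≡.refl = ≡.refl

    -- The defect changes sign, and -(3m+1) = 3(-m-1) + 2, so the next reflection is of the other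
    -- kind and rotates back.
    reflect₁-defect : ∀ T m → defect T ≡ + 3 ℤ.* m ℤ.+ + 1 →
      defect (reflect₁ m T) ≡ + 3 ℤ.* (ℤ.- m ℤ.- + 1) ℤ.+ + 2 × reflect₂ (ℤ.- m ℤ.- + 1) (reflect₁ m T) ≡ T
    reflect₁-defect ⟨ k₁ , l₁ ∣ k₂ , l₂ ∣ k₃ , l₃ ⟩ m e with last-coordinate k₁ l₁ k₂ l₂ k₃ l₃ _ e
    ... | ≡.refl =
      solve 6 (λ k₁ l₁ k₂ l₂ k₃ m → :d (:reflect₁ m (:with-defect (+ 1) k₁ l₁ k₂ l₂ k₃ m)) :=
        con (+ 3) :* :m′ m :+ con (+ 2)) ≡.refl k₁ l₁ k₂ l₂ k₃ m ,
      triple-≡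
        (solve 6 (λ k₁ l₁ k₂ l₂ k₃ m → a₁ (twice k₁ l₁ k₂ l₂ k₃ m) := a₁ (:with-defect (+ 1) k₁ l₁ k₂ l₂ k₃ m)) ≡.refl k₁ l₁ k₂ l₂ k₃ m)
        (solve 6 (λ k₁ l₁ k₂ l₂ k₃ m → b₁ (twice k₁ l₁ k₂ l₂ k₃ m) := b₁ (:with-defect (+ 1) k₁ l₁ k₂ l₂ k₃ m)) ≡.refl k₁ l₁ k₂ l₂ k₃ m)
        (solve 6 (λ k₁ l₁ k₂ l₂ k₃ m → a₂ (twice k₁ l₁ k₂ l₂ k₃ m) := a₂ (:with-defect (+ 1) k₁ l₁ k₂ l₂ k₃ m)) ≡.refl k₁ l₁ k₂ l₂ k₃ m)
        (solve 6 (λ k₁ l₁ k₂ l₂ k₃ m → b₂ (twice k₁ l₁ k₂ l₂ k₃ m) := b₂ (:with-defect (+ 1) k₁ l₁ k₂ l₂ k₃ m)) ≡.refl k₁ l₁ k₂ l₂ k₃ m)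
        (solve 6 (λ k₁ l₁ k₂ l₂ k₃ m → a₃ (twice k₁ l₁ k₂ l₂ k₃ m) := a₃ (:with-defect (+ 1) k₁ l₁ k₂ l₂ k₃ m)) ≡.refl k₁ l₁ k₂ l₂ k₃ m)
        (solve 6 (λ k₁ l₁ k₂ l₂ k₃ m → b₃ (twice k₁ l₁ k₂ l₂ k₃ m) := b₃ (:with-defect (+ 1) k₁ l₁ k₂ l₂ k₃ m)) ≡.refl k₁ l₁ k₂ l₂ k₃ m)
      where
      twice : (k₁ l₁ k₂ l₂ k₃ m : Polynomial 6) → :Triple 6
      twice k₁ l₁ k₂ l₂ k₃ m = :reflect₂ (:m′ m) (:reflect₁ m (:with-defect (+ 1) k₁ l₁ k₂ l₂ k₃ m))

    reflect₂-defect : ∀ T m → defect T ≡ + 3 ℤ.* m ℤ.+ + 2 →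
      defect (reflect₂ m T) ≡ + 3 ℤ.* (ℤ.- m ℤ.- + 1) ℤ.+ + 1 × reflect₁ (ℤ.- m ℤ.- + 1) (reflect₂ m T) ≡ T
    reflect₂-defect ⟨ k₁ , l₁ ∣ k₂ , l₂ ∣ k₃ , l₃ ⟩ m e with last-coordinate k₁ l₁ k₂ l₂ k₃ l₃ _ e
    ... | ≡.refl =
      solve 6 (λ k₁ l₁ k₂ l₂ k₃ m → :d (:reflect₂ m (:with-defect (+ 2) k₁ l₁ k₂ l₂ k₃ m)) :=
        con (+ 3) :* :m′ m :+ con (+ 1)) ≡.refl k₁ l₁ k₂ l₂ k₃ m ,
      triple-≡
        (solve 6 (λ k₁ l₁ k₂ l₂ k₃ m → a₁ (twice k₁ l₁ k₂ l₂ k₃ m) := a₁ (:with-defect (+ 2) k₁ l₁ k₂ l₂ k₃ m)) ≡.refl k₁ l₁ k₂ l₂ k₃ m)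
        (solve 6 (λ k₁ l₁ k₂ l₂ k₃ m → b₁ (twice k₁ l₁ k₂ l₂ k₃ m) := b₁ (:with-defect (+ 2) k₁ l₁ k₂ l₂ k₃ m)) ≡.refl k₁ l₁ k₂ l₂ k₃ m)
        (solve 6 (λ k₁ l₁ k₂ l₂ k₃ m → a₂ (twice k₁ l₁ k₂ l₂ k₃ m) := a₂ (:with-defect (+ 2) k₁ l₁ k₂ l₂ k₃ m)) ≡.refl k₁ l₁ k₂ l₂ k₃ m)
        (solve 6 (λ k₁ l₁ k₂ l₂ k₃ m → b₂ (twice k₁ l₁ k₂ l₂ k₃ m) := b₂ (:with-defect (+ 2) k₁ l₁ k₂ l₂ k₃ m)) ≡.refl k₁ l₁ k₂ l₂ k₃ m)
        (solve 6 (λ k₁ l₁ k₂ l₂ k₃ m → a₃ (twice k₁ l₁ k₂ l₂ k₃ m) := a₃ (:with-defect (+ 2) k₁ l₁ k₂ l₂ k₃ m)) ≡.refl k₁ l₁ k₂ l₂ k₃ m)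
        (solve 6 (λ k₁ l₁ k₂ l₂ k₃ m → b₃ (twice k₁ l₁ k₂ l₂ k₃ m) := b₃ (:with-defect (+ 2) k₁ l₁ k₂ l₂ k₃ m)) ≡.refl k₁ l₁ k₂ l₂ k₃ m)
      where
      twice : (k₁ l₁ k₂ l₂ k₃ m : Polynomial 6) → :Triple 6
      twice k₁ l₁ k₂ l₂ k₃ m = :reflect₁ (:m′ m) (:reflect₂ m (:with-defect (+ 2) k₁ l₁ k₂ l₂ k₃ m))

  reflect-involutive : ∀ T (r : Residue (defect T)) (s : Residue (defect (reflect T r))) → reflect (reflect T r) s ≡ T
  reflect-involutive T r@(residue zero m e) s = cong (reflect T) (residue-unique s r)
  reflect-involutive T (residue (suc zero) m e) s =
    let d , back = reflect₁-defect T m e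
    in ≡.trans (cong (reflect (reflect₁ m T)) (residue-unique s (residue (suc (suc zero)) (ℤ.- m ℤ.- + 1) d))) back
  reflect-involutive T (residue (suc (suc zero)) m e) s =
    let d , back = reflect₂-defect T m e
    in ≡.trans (cong (reflect (reflect₂ m T)) (residue-unique s (residue (suc zero) (ℤ.- m ℤ.- + 1) d))) back

  φ-involutive : ∀ T → φ (φ T) ≡ T
  φ-involutive T = reflect-involutive T (residue-of (defect T)) (residue-of (defect (φ T)))

  φ-cases : ∀ T → (φ T ≡ T × ∃ λ m → X T ≡ + 3 ℤ.* m) ⊎ Reflected T (φ T)
  φ-cases T with residue-of (defect T)
  ... | residue (suc zero) m e       = inj₂ (reflect₁-reflected T m e)
  ... | residue (suc (suc zero)) m e = inj₂ (reflect₂-reflected T m e)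
  ... | residue zero m e = inj₁ (≡.refl , X-multiple T m e)
    where
    X-multiple : ∀ T m → defect T ≡ + 3 ℤ.* m ℤ.+ + 0 → ∃ λ n → X T ≡ + 3 ℤ.* n
    X-multiple ⟨ k₁ , l₁ ∣ k₂ , l₂ ∣ k₃ , l₃ ⟩ m e with last-coordinate k₁ l₁ k₂ l₂ k₃ l₃ _ e
    -- In general X = 3K + 2d + 3, here with d = 3m.
    ... | ≡.refl = (m ℤ.+ m) ℤ.+ (k₁ ℤ.+ (k₂ ℤ.+ k₃)) ℤ.+ + 1 ,
      solve 6 (λ k₁ l₁ k₂ l₂ k₃ m → :sum :x (:with-defect (+ 0) k₁ l₁ k₂ l₂ k₃ m) :=
        con (+ 3) :* ((m :+ m) :+ (k₁ :+ (k₂ :+ k₃)) :+ con (+ 1))) ≡.refl k₁ l₁ k₂ l₂ k₃ m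

open Reflection public

-- The geometric series over ℤ

ℤ-stage : ℕ → List ℤ
ℤ-stage n = map +_ (downFrom n) ++ map -[1+_] (downFrom n)

ℤ-exhaustion : Exhaustion ℤ
ℤ-exhaustion = record
  { stage  = ℤ-stage
  ; unique = λ n → UniqueP.++⁺ (UniqueP.map⁺ (λ { ≡.refl → ≡.refl }) (UniqueP.downFrom⁺ n))
      (UniqueP.map⁺ (λ { ≡.refl → ≡.refl }) (UniqueP.downFrom⁺ n)) (λ (p , q) → disjoint p q)
  ; mono   = λ {m} {n} m≤n p → grow m≤n (∈-++⁻ (map +_ (downFrom m)) p)
  ; covers = λ where
      (+ n)    → suc n , here ≡.refl
      -[1+ n ] → suc n , ∈-++⁺ʳ (map +_ (downFrom (suc n))) (here ≡.refl)
  }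
  where
  disjoint : ∀ {n z} → z ∈ map +_ (downFrom n) → z ∈ map -[1+_] (downFrom n) → ⊥
  disjoint p q with ∈-map⁻ +_ p | ∈-map⁻ -[1+_] q
  ... | _ , _ , ≡.refl | _ , _ , ()
  grow : ∀ {m n} → m ℕ.≤ n → ∀ {z} → z ∈ map +_ (downFrom m) ⊎ z ∈ map -[1+_] (downFrom m) → z ∈ ℤ-stage n
  grow m≤n (inj₁ p) with ∈-map⁻ +_ p
  ... | i , q , ≡.refl = ∈-++⁺ˡ (∈-map⁺ +_ (mono downFrom-exhaustion m≤n q))
  grow {n = n} m≤n (inj₂ p) with ∈-map⁻ -[1+_] p
  ... | i , q , ≡.refl = ∈-++⁺ʳ (map +_ (downFrom n)) (∈-map⁺ -[1+_] (mono downFrom-exhaustion m≤n q))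

half-+ : ∀ m n → half (m ℕ.+ n) ≡ half m ℚ.* half n
half-+ zero    n = ≡.sym (ℚP.*-identityˡ (half n))
half-+ (suc m) n = ≡.trans (cong (½ ℚ.*_) (half-+ m n)) (≡.sym (ℚP.*-assoc ½ (half m) (half n)))

half-cauchy : IsCauchy half
half-cauchy ε 0<ε =
  let N , small = archimedean ε 0<ε
      bounds = λ m N≤m → ℚP.≤-trans (half≤recip m) (small m N≤m)
  in N , λ m n N≤m N≤n → ∣-∣≤ (below m n (bounds m N≤m))
       (ℚP.≤-trans (ℚP.≤-reflexive (solve 2 (λ a b → :- (a :- b) := b :- a) ≡.refl (half m) (half n))) (below n m (bounds n N≤n)))
  where
  open ℚ-Solver
  below : ∀ m n → half m ℚ.≤ ε → half m ℚ.- half n ℚ.≤ ε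
  below m n h = ℚP.≤-trans (ℚP.+-monoʳ-≤ (half m) (ℚP.neg-antimono-≤ (ℚP.<⇒≤ (half-pos n))))
    (ℚP.≤-trans (ℚP.≤-reflexive (ℚP.+-identityʳ (half m))) h)

-- The partial sums have the closed form B(3 - 3·2⁻ⁿ): the negative integers contribute half as much
-- as the nonnegative ones.
geometric : ∀ B → 0ℚ ℚ.≤ B → Summable ℤ-exhaustion λ k → B ℚ.* half ℤ.∣ k ∣
geometric B 0≤B .Summable.nonneg k = *-nonneg 0≤B (ℚP.<⇒≤ (half-pos ℤ.∣ k ∣))
geometric B 0≤B .Summable.cauchyΣ ε 0<ε =
  let N , close = mul-cauchy (λ _ → B) (λ n → 3ℚ ℚ.+ ℚ.- (3ℚ ℚ.* half n)) (const-cauchy B)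
        (add-cauchy (λ _ → 3ℚ) (λ n → ℚ.- (3ℚ ℚ.* half n)) (const-cauchy 3ℚ)
          (neg-cauchy (λ n → 3ℚ ℚ.* half n) (mul-cauchy (λ _ → 3ℚ) half (const-cauchy 3ℚ) half-cauchy))) ε 0<ε
  in N , λ m n N≤m N≤n → subst₂ (λ s t → ℚ.∣ s ℚ.- t ∣ ℚ.≤ ε) (≡.sym (closed-form m)) (≡.sym (closed-form n)) (close m n N≤m N≤n)
  where
  open ℚ-Solver
  open ≡.≡-Reasoning
  3ℚ 2ℚ : ℚ
  3ℚ = + 3 ℚ./ 1
  2ℚ = + 2 ℚ./ 1
  nonnegative-part : ∀ n → ℚΣ.Σ half (downFrom n) ≡ 2ℚ ℚ.- 2ℚ ℚ.* half n
  nonnegative-part zero    = ≡.refl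
  nonnegative-part (suc n) = ≡.trans (cong (half n ℚ.+_) (nonnegative-part n))
    (solve 1 (λ h → h :+ (con 2ℚ :- con 2ℚ :* h) := con 2ℚ :- con 2ℚ :* (con ½ :* h)) ≡.refl (half n))
  closed-form : ∀ n → ℚΣ.Σ (λ k → B ℚ.* half ℤ.∣ k ∣) (ℤ-stage n) ≡ B ℚ.* (3ℚ ℚ.+ ℚ.- (3ℚ ℚ.* half n))
  closed-form n = begin
    ℚΣ.Σ (λ k → B ℚ.* half ℤ.∣ k ∣) (ℤ-stage n)
      ≡⟨ ℚΣ.Σ-* B (λ k → half ℤ.∣ k ∣) (ℤ-stage n) ⟩
    B ℚ.* ℚΣ.Σ (λ k → half ℤ.∣ k ∣) (ℤ-stage n)
      ≡⟨ cong (B ℚ.*_) (ℚΣ.Σ-++ (λ k → half ℤ.∣ k ∣) (map +_ (downFrom n)) (map -[1+_] (downFrom n))) ⟩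
    B ℚ.* (ℚΣ.Σ (λ k → half ℤ.∣ k ∣) (map +_ (downFrom n)) ℚ.+ ℚΣ.Σ (λ k → half ℤ.∣ k ∣) (map -[1+_] (downFrom n)))
      ≡⟨ cong (B ℚ.*_) (cong₂ ℚ._+_ (ℚΣ.Σ-map (λ k → half ℤ.∣ k ∣) +_ (downFrom n))
           (≡.trans (ℚΣ.Σ-map (λ k → half ℤ.∣ k ∣) -[1+_] (downFrom n)) (ℚΣ.Σ-* ½ half (downFrom n)))) ⟩
    B ℚ.* (ℚΣ.Σ half (downFrom n) ℚ.+ ½ ℚ.* ℚΣ.Σ half (downFrom n))
      ≡⟨ cong (λ s → B ℚ.* (s ℚ.+ ½ ℚ.* s)) (nonnegative-part n) ⟩
    B ℚ.* ((2ℚ ℚ.- 2ℚ ℚ.* half n) ℚ.+ ½ ℚ.* (2ℚ ℚ.- 2ℚ ℚ.* half n))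
      ≡⟨ cong (B ℚ.*_) (solve 1 (λ h → (con 2ℚ :- con 2ℚ :* h) :+ con ½ :* (con 2ℚ :- con 2ℚ :* h) :=
           con 3ℚ :+ :- (con 3ℚ :* h)) ≡.refl (half n)) ⟩
    B ℚ.* (3ℚ ℚ.+ ℚ.- (3ℚ ℚ.* half n)) ∎

-- Growth of the quadratic exponent

fromℤ/1-∣∣ : ∀ k → fromℤ/1 (+ ℤ.∣ k ∣) ≡ ℚ.∣ fromℤ/1 k ∣
fromℤ/1-∣∣ (+ n) = ≡.sym (∣p∣≡p (RiemannSumLemmas.fromℕ-mono {0} {n} ℕ.z≤n))
fromℤ/1-∣∣ -[1+ n ] = ≡.sym (≡.trans (ℚP.∣-p∣≡∣p∣ (fromℤ/1 (+ suc n))) (∣p∣≡p (RiemannSumLemmas.fromℕ-mono {0} {suc n} ℕ.z≤n)))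

C-exponent-/1 : ∀ k l → let K = fromℤ/1 k ; Λ = fromℤ/1 l in
  C-exponent k l ≡ (+ 2 ℚ./ 1) ℚ.* ((Λ ℚ.* Λ ℚ.+ Λ ℚ.* K ℚ.+ K ℚ.* K ℚ.+ K ℚ.+ Λ) ℚ.+ + 1 ℚ./ 3)
C-exponent-/1 k l = cong (λ s → (+ 2 ℚ./ 1) ℚ.* (s ℚ.+ + 1 ℚ./ 3))
  (≡.trans (/1-+ (l ℤ.* l ℤ.+ l ℤ.* k ℤ.+ k ℤ.* k ℤ.+ k) l) (cong (ℚ._+ fromℤ/1 l)
  (≡.trans (/1-+ (l ℤ.* l ℤ.+ l ℤ.* k ℤ.+ k ℤ.* k) k) (cong (ℚ._+ fromℤ/1 k)
  (≡.trans (/1-+ (l ℤ.* l ℤ.+ l ℤ.* k) (k ℤ.* k)) (cong₂ ℚ._+_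
  (≡.trans (/1-+ (l ℤ.* l) (l ℤ.* k)) (cong₂ ℚ._+_ (/1-* l l) (/1-* l k))) (/1-* k k)))))))

2m+n-/1 : ∀ m n → fromℤ/1 (+ 2 ℤ.* m ℤ.+ n) ≡ (+ 2 ℚ./ 1) ℚ.* fromℤ/1 m ℚ.+ fromℤ/1 n
2m+n-/1 m n = ≡.trans (/1-+ (+ 2 ℤ.* m) n) (cong (ℚ._+ fromℤ/1 n) (/1-* (+ 2) m))

module QuadraticGrowth (c d L : ℚ) (0≤c : 0ℚ ℚ.≤ c) (0≤L : 0ℚ ℚ.≤ L) (cd≡1 : c ℚ.* d ≡ 1ℚ) where
  open ℚ-Solver
  2ℚ 3ℚ ⅓ ¼ ⅔ : ℚ
  2ℚ = + 2 ℚ./ 1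
  3ℚ = + 3 ℚ./ 1
  ⅓ = + 1 ℚ./ 3
  ¼ = + 1 ℚ./ 4
  ⅔ = + 2 ℚ./ 3

  -- The linear terms cost at most 3L per unit of |K| and |Λ|, and the gain asked for is 2 more:
  -- this is `G`. `P` = G²/(4c) is the maximum of Gs - cs², taken once for K and once for Λ. Passing
  -- from |K| to |K + 1/3| costs G/3, again twice.
  G P M : ℚ
  G = 3ℚ ℚ.* L ℚ.+ 2ℚ
  P = ¼ ℚ.* (G ℚ.* G ℚ.* d)
  M = (P ℚ.+ P) ℚ.+ ⅔ ℚ.* G

  -- c (s - Gd/2)² expanded, using cd = 1.
  complete-square : ∀ a → 0ℚ ℚ.≤ (c ℚ.* (a ℚ.* a) ℚ.- G ℚ.* ℚ.∣ a ∣) ℚ.+ P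
  complete-square a = ℚP.≤-trans (*-nonneg 0≤c (square-nonneg (s ℚ.- ½ ℚ.* (G ℚ.* d)))) (ℚP.≤-reflexive (begin
    c ℚ.* ((s ℚ.- ½ ℚ.* (G ℚ.* d)) ℚ.* (s ℚ.- ½ ℚ.* (G ℚ.* d)))
      ≡⟨ solve 4 (λ c d g s → c :* ((s :- con ½ :* (g :* d)) :* (s :- con ½ :* (g :* d))) :=
           (c :* (s :* s) :- (c :* d) :* (g :* s)) :+ con ¼ :* ((c :* d) :* (g :* g :* d))) ≡.refl c d G s ⟩
    (c ℚ.* (s ℚ.* s) ℚ.- (c ℚ.* d) ℚ.* (G ℚ.* s)) ℚ.+ ¼ ℚ.* ((c ℚ.* d) ℚ.* (G ℚ.* G ℚ.* d))
      ≡⟨ cong₂ (λ u q → (c ℚ.* q ℚ.- u ℚ.* (G ℚ.* s)) ℚ.+ ¼ ℚ.* (u ℚ.* (G ℚ.* G ℚ.* d))) cd≡1 s*s ⟩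
    (c ℚ.* (a ℚ.* a) ℚ.- 1ℚ ℚ.* (G ℚ.* s)) ℚ.+ ¼ ℚ.* (1ℚ ℚ.* (G ℚ.* G ℚ.* d))
      ≡⟨ cong₂ (λ u v → (c ℚ.* (a ℚ.* a) ℚ.- u) ℚ.+ ¼ ℚ.* v) (ℚP.*-identityˡ (G ℚ.* s)) (ℚP.*-identityˡ (G ℚ.* G ℚ.* d)) ⟩
    (c ℚ.* (a ℚ.* a) ℚ.- G ℚ.* s) ℚ.+ P ∎))
    where
    open ≡.≡-Reasoning
    s = ℚ.∣ a ∣
    s*s : s ℚ.* s ≡ a ℚ.* a
    s*s = ≡.trans (≡.sym (ℚP.∣p*q∣≡∣p∣*∣q∣ a a)) (∣p∣≡p (square-nonneg a))

  product-lower : ∀ {p q m} → ℚ.∣ p ∣ ℚ.≤ L → ℚ.∣ q ∣ ℚ.≤ m → 0ℚ ℚ.≤ L ℚ.* m ℚ.+ p ℚ.* q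
  product-lower {p} {q} {m} p≤L q≤m = ℚP.≤-trans (0≤q-p (begin
      ℚ.- (p ℚ.* q)          ≤⟨ p≤∣p∣ (ℚ.- (p ℚ.* q)) ⟩
      ℚ.∣ ℚ.- (p ℚ.* q) ∣    ≡⟨ ≡.trans (ℚP.∣-p∣≡∣p∣ (p ℚ.* q)) (ℚP.∣p*q∣≡∣p∣*∣q∣ p q) ⟩
      ℚ.∣ p ∣ ℚ.* ℚ.∣ q ∣    ≤⟨ *-mono (ℚP.0≤∣p∣ p) (ℚP.≤-trans (ℚP.0≤∣p∣ q) q≤m) p≤L q≤m ⟩
      L ℚ.* m                ∎))
    (ℚP.≤-reflexive (solve 2 (λ a b → a :- :- b := a :+ b) ≡.refl (L ℚ.* m) (p ℚ.* q)))
    where open ℚP.≤-Reasoning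

  shifted : ∀ K → 0ℚ ℚ.≤ (ℚ.∣ K ℚ.+ ⅓ ∣ ℚ.+ ⅓) ℚ.- ℚ.∣ K ∣
  shifted K = 0≤q-p (ℚP.≤-trans
    (ℚP.≤-reflexive (cong ℚ.∣_∣ (solve 1 (λ k → k := (k :+ con ⅓) :- con ⅓) ≡.refl K)))
    (ℚP.∣p-q∣≤∣p∣+∣q∣ (K ℚ.+ ⅓) ⅓))

  ∣2m+n∣ : ∀ m n → ℚ.∣ 2ℚ ℚ.* m ℚ.+ n ∣ ℚ.≤ 2ℚ ℚ.* ℚ.∣ m ∣ ℚ.+ ℚ.∣ n ∣
  ∣2m+n∣ m n = ℚP.≤-trans (ℚP.∣p+q∣≤∣p∣+∣q∣ (2ℚ ℚ.* m) n)
    (ℚP.≤-reflexive (cong (ℚ._+ ℚ.∣ n ∣) (ℚP.∣p*q∣≡∣p∣*∣q∣ 2ℚ m)))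

  module _ {α ξ η : ℚ} (c≤α : c ℚ.≤ α) (ξ≤L : ℚ.∣ ξ ∣ ℚ.≤ L) (η≤L : ℚ.∣ η ∣ ℚ.≤ L) where

    -- With a = K + 1/3 and b = Λ + 1/3, r = a² + b² + (a+b)².
    growth : ∀ K Λ → let r = 2ℚ ℚ.* ((Λ ℚ.* Λ ℚ.+ Λ ℚ.* K ℚ.+ K ℚ.* K ℚ.+ K ℚ.+ Λ) ℚ.+ ⅓) in
      0ℚ ℚ.≤ (M ℚ.+ ℚ.- (2ℚ ℚ.* (ℚ.∣ K ∣ ℚ.+ ℚ.∣ Λ ∣))) ℚ.+
             (r ℚ.* α ℚ.+ ((2ℚ ℚ.* Λ ℚ.+ K) ℚ.* ξ ℚ.+ (2ℚ ℚ.* K ℚ.+ Λ) ℚ.* η))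
    -- The claim is the sum of the following nonnegative terms: α is lowered to c, the square (a+b)²
    -- is given away, a² and b² absorb the loss G|a| + G|b|, and the other four pay for the linear
    -- terms and for the shift by 1/3.
    growth K Λ = ℚP.≤-trans
      (+-nonneg (+-nonneg (+-nonneg (*-nonneg (0≤q-p c≤α) 0≤r) (*-nonneg 0≤c (square-nonneg (a ℚ.+ b))))
                          (+-nonneg (complete-square a) (complete-square b)))
                (+-nonneg (+-nonneg (product-lower ξ≤L (∣2m+n∣ Λ K)) (product-lower η≤L (∣2m+n∣ K Λ)))
                          (+-nonneg (*-nonneg 0≤G (shifted K)) (*-nonneg 0≤G (shifted Λ)))))
      (ℚP.≤-reflexive (identity α c L ξ η K Λ ℚ.∣ a ∣ ℚ.∣ b ∣ ℚ.∣ K ∣ ℚ.∣ Λ ∣ P))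
      where
      a = K ℚ.+ ⅓
      b = Λ ℚ.+ ⅓
      0≤G : 0ℚ ℚ.≤ G
      0≤G = +-nonneg (*-nonneg (ℚP.nonNegative⁻¹ 3ℚ) 0≤L) (ℚP.nonNegative⁻¹ 2ℚ)
      sum-of-squares = (a ℚ.* a ℚ.+ b ℚ.* b) ℚ.+ (a ℚ.+ b) ℚ.* (a ℚ.+ b)
      0≤r : 0ℚ ℚ.≤ sum-of-squares
      0≤r = +-nonneg (+-nonneg (square-nonneg a) (square-nonneg b)) (square-nonneg (a ℚ.+ b))
      identity : ∀ α c L ξ η K Λ s t κ l P →
        let a = K ℚ.+ ⅓ ; b = Λ ℚ.+ ⅓ ; G = 3ℚ ℚ.* L ℚ.+ 2ℚ in
        (((α ℚ.- c) ℚ.* ((a ℚ.* a ℚ.+ b ℚ.* b) ℚ.+ (a ℚ.+ b) ℚ.* (a ℚ.+ b)) ℚ.+ c ℚ.* ((a ℚ.+ b) ℚ.* (a ℚ.+ b))) ℚ.+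
          (((c ℚ.* (a ℚ.* a) ℚ.- G ℚ.* s) ℚ.+ P) ℚ.+ ((c ℚ.* (b ℚ.* b) ℚ.- G ℚ.* t) ℚ.+ P))) ℚ.+
        (((L ℚ.* (2ℚ ℚ.* l ℚ.+ κ) ℚ.+ ξ ℚ.* (2ℚ ℚ.* Λ ℚ.+ K)) ℚ.+ (L ℚ.* (2ℚ ℚ.* κ ℚ.+ l) ℚ.+ η ℚ.* (2ℚ ℚ.* K ℚ.+ Λ))) ℚ.+
          (G ℚ.* ((s ℚ.+ ⅓) ℚ.- κ) ℚ.+ G ℚ.* ((t ℚ.+ ⅓) ℚ.- l)))
        ≡ (((P ℚ.+ P) ℚ.+ ⅔ ℚ.* G) ℚ.+ ℚ.- (2ℚ ℚ.* (κ ℚ.+ l))) ℚ.+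
          ((2ℚ ℚ.* ((Λ ℚ.* Λ ℚ.+ Λ ℚ.* K ℚ.+ K ℚ.* K ℚ.+ K ℚ.+ Λ) ℚ.+ ⅓)) ℚ.* α ℚ.+
           ((2ℚ ℚ.* Λ ℚ.+ K) ℚ.* ξ ℚ.+ (2ℚ ℚ.* K ℚ.+ Λ) ℚ.* η))
      identity = solve 12 (λ α c L ξ η K Λ s t κ l P →
        let a = K :+ con ⅓ ; b = Λ :+ con ⅓ ; G = con 3ℚ :* L :+ con 2ℚ in
        (((α :- c) :* ((a :* a :+ b :* b) :+ (a :+ b) :* (a :+ b)) :+ c :* ((a :+ b) :* (a :+ b))) :+
          (((c :* (a :* a) :- G :* s) :+ P) :+ ((c :* (b :* b) :- G :* t) :+ P))) :+
        (((L :* (con 2ℚ :* l :+ κ) :+ ξ :* (con 2ℚ :* Λ :+ K)) :+ (L :* (con 2ℚ :* κ :+ l) :+ η :* (con 2ℚ :* K :+ Λ))) :+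
          (G :* ((s :+ con ⅓) :- κ) :+ G :* ((t :+ con ⅓) :- l)))
        := (((P :+ P) :+ con ⅔ :* G) :+ :- (con 2ℚ :* (κ :+ l))) :+
          ((con 2ℚ :* ((Λ :* Λ :+ Λ :* K :+ K :* K :+ K :+ Λ) :+ con ⅓)) :* α :+
           ((con 2ℚ :* Λ :+ K) :* ξ :+ (con 2ℚ :* K :+ Λ) :* η))) ≡.refl

-- The integrand is at least 4/(1+1) on [0,1]. If c bounds the approximants of Im τ from below, this
-- makes 2c a lower bound for those of π Im τ.
riemannSum≥2 : ∀ k → (+ 2 ℚ./ 1) ℚ.≤ riemannSum k
riemannSum≥2 k = ℚP.≤-trans
  (ℚP.≤-reflexive (≡.trans (≡.sym (ℚP.*-identityˡ _)) (≡.trans (cong (ℚ._* (+ 2 ℚ./ 1)) (≡.sym (RationalArctangent.dyadic-full k)))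
    (solve 2 (λ n h → (n :* h) :* con (+ 2 ℚ./ 1) := h :* (n :* con (+ 2 ℚ./ 1))) ≡.refl (fromℤ/1 (+ (2 ℕ.^ k))) (half k)))))
  (*-monoˡ (ℚP.<⇒≤ (half-pos k)) (Σ-lower (2 ℕ.^ k) λ j j< → RiemannSumLemmas.f-anti (RiemannSumLemmas.dyadic-nonneg k j) (RationalArctangent.dyadic≤1 k (ℕP.<⇒≤ j<))))
  where
  open ℚ-Solver
  Σ-lower : ∀ n {f} → (∀ j → j ℕ.< n → (+ 2 ℚ./ 1) ℚ.≤ f j) → fromℤ/1 (+ n) ℚ.* (+ 2 ℚ./ 1) ℚ.≤ Σ< n f
  Σ-lower zero    h = ℚP.≤-refl
  Σ-lower (suc n) h = ℚP.≤-trans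
    (ℚP.≤-reflexive (≡.trans (cong (ℚ._* (+ 2 ℚ./ 1)) (≡.trans (cong (fromℤ/1 ∘ +_) (≡.sym (ℕP.+-comm n 1))) (/1-+ (+ n) (+ 1))))
      (solve 1 (λ n → (n :+ con 1ℚ) :* con (+ 2 ℚ./ 1) := n :* con (+ 2 ℚ./ 1) :+ con (+ 2 ℚ./ 1)) ≡.refl (fromℤ/1 (+ n)))))
    (ℚP.+-mono-≤ (Σ-lower n (λ j j< → h j (ℕP.m≤n⇒m≤1+n j<))) (h n ℕP.≤-refl))

-- The series for C(x,y) and its cube

-- The series of the theorem at τ = τ₁ + i τ₂, where τ₂ is the limit of the rationals ρ.
module Theta (C : ComplexField) where
  open ComplexField C

  module Series (τ τ₁ τ₂ : Carrier) (τ-parts : τ ≈ τ₁ + J * τ₂) (τ₁-approx : Approximable τ₁)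
    (ρ : ℕ → ℚ) (ρ⟶τ₂ : (ι ∘ ρ) ⟶ τ₂) (c : ℚ) (0<c : 0ℚ ℚ.< c) (c≤ρ : Eventually λ n → c ℚ.≤ ρ n)
    where
    open Exponential C
    open Period C using (exp-full-turn)
    open Solver

    2ℚ : ℚ
    2ℚ = + 2 ℚ./ 1

    x-exponent y-exponent : ℤ × ℤ → ℤ
    x-exponent (k , l) = + 2 ℤ.* l ℤ.+ k
    y-exponent (k , l) = + 2 ℤ.* k ℤ.+ l

    term : Carrier → Carrier → ℤ × ℤ → Carrier
    term x y (k , l) = exp (Π * J * ι (C-exponent k l) * τ)
      * exp (ι 2ℚ * J * x * ι (fromℤ/1 (+ 2 ℤ.* l ℤ.+ k)))
      * exp (ι 2ℚ * J * y * ι (fromℤ/1 (+ 2 ℤ.* k ℤ.+ l)))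

    phase : Carrier → Carrier → ℚ → ℚ → ℚ → Carrier
    phase x y r a b = Π * J * ι r * τ + (ι 2ℚ * J * x * ι a + ι 2ℚ * J * y * ι b)

    term-phase : ∀ x y k l → term x y (k , l) ≈
      exp (phase x y (C-exponent k l) (fromℤ/1 (+ 2 ℤ.* l ℤ.+ k)) (fromℤ/1 (+ 2 ℤ.* k ℤ.+ l)))
    term-phase x y k l = ≈-sym (≈-trans (exp-+ _ _) (≈-trans (*-congˡ (exp-+ _ _)) (≈-sym (*-assoc _ _ _))))

    ⟶-ι-+ : ∀ {u v ρ σ} → (ι ∘ ρ) ⟶ u → (ι ∘ σ) ⟶ v → (λ n → ι (ρ n ℚ.+ σ n)) ⟶ (u + v)
    ⟶-ι-+ p q = ⟶-cong (λ n → ≈-sym (ι-+ _ _)) (⟶-+ p q)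

    ⟶-ι-* : ∀ {u v ρ σ} → (ι ∘ ρ) ⟶ u → (ι ∘ σ) ⟶ v → (λ n → ι (ρ n ℚ.* σ n)) ⟶ (u * v)
    ⟶-ι-* p q = ⟶-cong (λ n → ≈-sym (ι-* _ _)) (⟶-* p q)

    limit-real : ∀ {u ρ} → (ι ∘ ρ) ⟶ u → conj u ≈ u
    limit-real {u} {ρ} lim = ⟶-unique
      (λ ε 0<ε → let N , p = lim ε 0<ε in N , λ n N≤n →
        ‖‖-cong (≈-trans (conj-+ _ _) (+-cong (conj-ι (ρ n)) (conj-neg u))) (‖conj‖ (p n N≤n)))
      lim

    real-+ : ∀ {u v} → conj u ≈ u → conj v ≈ v → conj (u + v) ≈ u + v
    real-+ p q = ≈-trans (conj-+ _ _) (+-cong p q)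

    real-* : ∀ {u v} → conj u ≈ u → conj v ≈ v → conj (u * v) ≈ u * v
    real-* p q = ≈-trans (conj-* _ _) (*-cong p q)

    imaginary : ∀ {u} → conj u ≈ u → conj (J * u) ≈ - (J * u)
    imaginary {u} p = ≈-trans (conj-* _ _) (≈-trans (*-cong conj-J p)
      (solve 2 (λ j u → (:- j) :* u := :- (j :* u)) ≈-refl J u))

    module _ (x y : Carrier) where

      private
        x₁ = parts x .proj₁
        x₂ = parts x .proj₂ .proj₁
        x-parts = parts x .proj₂ .proj₂ .proj₁
        x₁-approx = parts x .proj₂ .proj₂ .proj₂ .proj₁
        x₂-approx = parts x .proj₂ .proj₂ .proj₂ .proj₂
        y₁ = parts y .proj₁
        y₂ = parts y .proj₂ .proj₁
        y-parts = parts y .proj₂ .proj₂ .proj₁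
        y₁-approx = parts y .proj₂ .proj₂ .proj₂ .proj₁
        y₂-approx = parts y .proj₂ .proj₂ .proj₂ .proj₂
        ξ η : ℕ → ℚ
        ξ n = 2ℚ ℚ.* x₂-approx .proj₁ n
        η n = 2ℚ ℚ.* y₂-approx .proj₁ n
        ξ⟶ = ⟶-ι-* (⟶-const (ι 2ℚ)) (x₂-approx .proj₂ .proj₁)
        η⟶ = ⟶-ι-* (⟶-const (ι 2ℚ)) (y₂-approx .proj₂ .proj₁)
        Lx = x₂-approx .proj₂ .proj₂ .proj₁
        Ly = y₂-approx .proj₂ .proj₂ .proj₁
        L : ℚ
        L = 2ℚ ℚ.* (ℚ.∣ Lx ∣ ℚ.+ ℚ.∣ Ly ∣)
        0≤L : 0ℚ ℚ.≤ L
        0≤L = *-nonneg (ℚP.nonNegative⁻¹ 2ℚ) (+-nonneg (ℚP.0≤∣p∣ Lx) (ℚP.0≤∣p∣ Ly))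
        double-bound : ∀ {p B B′} → ℚ.∣ p ∣ ℚ.≤ B → B ℚ.≤ B′ → ℚ.∣ 2ℚ ℚ.* p ∣ ℚ.≤ 2ℚ ℚ.* B′
        double-bound {p} h k = ℚP.≤-trans (ℚP.≤-reflexive (ℚP.∣p*q∣≡∣p∣*∣q∣ 2ℚ p))
          (*-monoˡ (ℚP.nonNegative⁻¹ 2ℚ) (ℚP.≤-trans h k))
        ξ≤L : Eventually λ n → ℚ.∣ ξ n ∣ ℚ.≤ L
        ξ≤L = let N , p = x₂-approx .proj₂ .proj₂ .proj₂ in
          N , λ n h → double-bound (p n h) (ℚP.≤-trans (p≤∣p∣ Lx) (p≤p+q (ℚP.0≤∣p∣ Ly)))
        η≤L : Eventually λ n → ℚ.∣ η n ∣ ℚ.≤ L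
        η≤L = let N , p = y₂-approx .proj₂ .proj₂ .proj₂ in
          N , λ n h → double-bound (p n h) (ℚP.≤-trans (p≤∣p∣ Ly) (p≤q+p (ℚP.0≤∣p∣ Lx)))
        c₂ d : ℚ
        c₂ = 2ℚ ℚ.* c
        0<c₂ : 0ℚ ℚ.< c₂
        0<c₂ = *-pos (ℚP.positive⁻¹ 2ℚ) 0<c
        c₂-nonZero : ℚ.NonZero c₂
        c₂-nonZero = ℚP.pos⇒nonZero c₂ {{ℚ.positive 0<c₂}}
        d = (ℚ.1/ c₂) {{c₂-nonZero}}
        module Growth = QuadraticGrowth c₂ d L (ℚP.<⇒≤ 0<c₂) 0≤L (ℚP.*-inverseʳ c₂ {{c₂-nonZero}})
        M : ℚ
        M = Growth.M

        module _ (k l : ℤ) where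
          r α β N : ℚ
          r = C-exponent k l
          α = fromℤ/1 (+ 2 ℤ.* l ℤ.+ k)
          β = fromℤ/1 (+ 2 ℤ.* k ℤ.+ l)
          N = fromℤ/1 (+ (ℤ.∣ k ∣ ℕ.+ ℤ.∣ l ∣))

          -- The real part of the exponent of the term is M - 2N - decay, and QuadraticGrowth makes decay
          -- a limit of nonnegative rationals.
          decay angle : Carrier
          decay = ι (M ℚ.+ ℚ.- (2ℚ ℚ.* N)) + (ι r * (Π * τ₂) + (ι α * (ι 2ℚ * x₂) + ι β * (ι 2ℚ * y₂)))
          angle = ι r * (Π * τ₁) + (ι α * (ι 2ℚ * x₁) + ι β * (ι 2ℚ * y₁))

          decay-approx : ∀ δ → 0ℚ ℚ.< δ → ∃ λ σ → 0ℚ ℚ.≤ σ × ‖ decay - ι σ ‖≤ δ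
          decay-approx δ 0<δ =
            let m₁ , small = lim δ 0<δ
                m₂ , p = c≤ρ
                m₃ , q = ξ≤L
                m₄ , s = η≤L
                n = (m₁ ℕ.⊔ m₂) ℕ.⊔ (m₃ ℕ.⊔ m₄)
                left = ℕP.m≤m⊔n (m₁ ℕ.⊔ m₂) (m₃ ℕ.⊔ m₄)
                right = ℕP.m≤n⊔m (m₁ ℕ.⊔ m₂) (m₃ ℕ.⊔ m₄)
            in σ n ,
               subst (0ℚ ℚ.≤_) (≡.sym (σ-eq n)) (Growth.growth
                 (*-mono (ℚP.nonNegative⁻¹ 2ℚ) (ℚP.≤-trans (ℚP.<⇒≤ 0<c) (p n (ℕP.≤-trans (ℕP.m≤n⊔m m₁ m₂) left)))
                   (riemannSum≥2 n) (p n (ℕP.≤-trans (ℕP.m≤n⊔m m₁ m₂) left)))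
                 (q n (ℕP.≤-trans (ℕP.m≤m⊔n m₃ m₄) right)) (s n (ℕP.≤-trans (ℕP.m≤n⊔m m₃ m₄) right))
                 (fromℤ/1 k) (fromℤ/1 l)) ,
               dist-swap (small n (ℕP.≤-trans (ℕP.m≤m⊔n m₁ m₂) left))
            where
            σ : ℕ → ℚ
            σ n = (M ℚ.+ ℚ.- (2ℚ ℚ.* N)) ℚ.+ (r ℚ.* (riemannSum n ℚ.* ρ n) ℚ.+ (α ℚ.* ξ n ℚ.+ β ℚ.* η n))
            lim : (ι ∘ σ) ⟶ decay
            lim = ⟶-ι-+ (⟶-const _) (⟶-ι-+ (⟶-ι-* (⟶-const (ι r)) (⟶-ι-* Π-series ρ⟶τ₂))
              (⟶-ι-+ (⟶-ι-* (⟶-const (ι α)) ξ⟶) (⟶-ι-* (⟶-const (ι β)) η⟶)))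
            σ-eq : ∀ n → σ n ≡ _
            σ-eq n = cong₂ (λ N u → (M ℚ.+ ℚ.- (2ℚ ℚ.* N)) ℚ.+ u)
              (≡.trans (/1-+ (+ ℤ.∣ k ∣) (+ ℤ.∣ l ∣)) (cong₂ ℚ._+_ (fromℤ/1-∣∣ k) (fromℤ/1-∣∣ l)))
              (cong₂ (λ r v → r ℚ.* (riemannSum n ℚ.* ρ n) ℚ.+ v) (C-exponent-/1 k l)
                (cong₂ (λ α β → α ℚ.* ξ n ℚ.+ β ℚ.* η n) (2m+n-/1 l k) (2m+n-/1 k l)))

          exponent-parts : phase x y r α β ≈ ((ι M + ι (ℚ.- (2ℚ ℚ.* N))) + - decay) + J * angle
          exponent-parts = begin
            Π * J * ι r * τ + (ι 2ℚ * J * x * ι α + ι 2ℚ * J * y * ι β)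
              ≈⟨ +-cong (*-congˡ τ-parts) (+-cong (*-congʳ (*-congˡ x-parts)) (*-congʳ (*-congˡ y-parts))) ⟩
            Π * J * ι r * (τ₁ + J * τ₂) + (ι 2ℚ * J * (x₁ + J * x₂) * ι α + ι 2ℚ * J * (y₁ + J * y₂) * ι β)
              -- J is a free variable for the solver, so the identity carries a multiple of J² + 1,
              -- removed in the next step.
              ≈⟨ solve 13 (λ Π J r τ₁ τ₂ x₁ x₂ α y₁ y₂ β m n →
                   Π :* J :* r :* (τ₁ :+ J :* τ₂) :+
                     (con 2ℚ :* J :* (x₁ :+ J :* x₂) :* α :+ con 2ℚ :* J :* (y₁ :+ J :* y₂) :* β) :=
                   (((m :+ n) :+ :- ((m :+ n) :+ (r :* (Π :* τ₂) :+ (α :* (con 2ℚ :* x₂) :+ β :* (con 2ℚ :* y₂)))))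
                     :+ J :* (r :* (Π :* τ₁) :+ (α :* (con 2ℚ :* x₁) :+ β :* (con 2ℚ :* y₁))))
                   :+ (J :* J :+ con 1ℚ) :* (r :* (Π :* τ₂) :+ (α :* (con 2ℚ :* x₂) :+ β :* (con 2ℚ :* y₂))))
                   ≈-refl Π J (ι r) τ₁ τ₂ x₁ x₂ (ι α) y₁ y₂ (ι β) (ι M) (ι (ℚ.- (2ℚ ℚ.* N))) ⟩
            (((ι M + ι (ℚ.- (2ℚ ℚ.* N))) + - ((ι M + ι (ℚ.- (2ℚ ℚ.* N))) + linear)) + J * angle) + (J * J + ι 1ℚ) * linear
              ≈⟨ +-cong (+-congʳ (+-congˡ (-‿cong (+-congʳ (≈-sym (ι-+ M _))))))
                   (≈-trans (*-congʳ (≈-trans (+-cong J*J ι-1) (-‿inverseˡ 1#))) (zeroˡ linear)) ⟩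
            (((ι M + ι (ℚ.- (2ℚ ℚ.* N))) + - decay) + J * angle) + 0#
              ≈⟨ +-identityʳ _ ⟩
            ((ι M + ι (ℚ.- (2ℚ ℚ.* N))) + - decay) + J * angle ∎
            where
            open import Relation.Binary.Reasoning.Setoid setoid
            linear = ι r * (Π * τ₂) + (ι α * (ι 2ℚ * x₂) + ι β * (ι 2ℚ * y₂))

          angle-real : conj angle ≈ angle
          angle-real = real-+ (real-* (conj-ι r) (real-* (limit-real Π-series) (limit-real (τ₁-approx .proj₂ .proj₁))))
            (real-+ (real-* (conj-ι α) (real-* (conj-ι 2ℚ) (limit-real (x₁-approx .proj₂ .proj₁))))
                    (real-* (conj-ι β) (real-* (conj-ι 2ℚ) (limit-real (y₁-approx .proj₂ .proj₁)))))

        D : ℚ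
        D = bounded (exp (ι M)) .proj₁ ℚ.* 2ℚ

      -- The factors of a term are exp M, which with the bound 2 for the imaginary part of the
      -- exponent makes `D`; exp(-2N), at most 2 to the power -(|k|+|ℓ|); and exp(-`decay`), at most
      -- 1. The form is a product over the two coordinates, as `⊗-summable` requires.
      majorant : ℤ × ℤ → ℚ
      majorant (k , l) = (D ℚ.* half ℤ.∣ k ∣) ℚ.* (1ℚ ℚ.* half ℤ.∣ l ∣)

      majorant-summable : Summable (ℤ-exhaustion ⊗ ℤ-exhaustion) majorant
      majorant-summable = ⊗-summable
        (geometric D (*-nonneg (‖‖-nonneg (bounded (exp (ι M)) .proj₂)) (ℚP.nonNegative⁻¹ 2ℚ))) (geometric 1ℚ 0≤1)

      term-dominated : Dominated (term x y) majorant
      term-dominated (k , l) = ‖‖-≡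
        (≡.trans (cong (λ h → ((D′ ℚ.* h) ℚ.* 1ℚ) ℚ.* 2ℚ) (half-+ ℤ.∣ k ∣ ℤ.∣ l ∣))
          (Q.solve 3 (λ b g h → ((b Q.:* (g Q.:* h)) Q.:* Q.con 1ℚ) Q.:* Q.con 2ℚ Q.:= ((b Q.:* Q.con 2ℚ) Q.:* g) Q.:* (Q.con 1ℚ Q.:* h))
            ≡.refl D′ (half ℤ.∣ k ∣) (half ℤ.∣ l ∣)))
        (‖‖-cong
          (≈-sym (≈-trans (term-phase x y k l) (≈-trans (exp-cong (exponent-parts k l))
            (≈-trans (exp-+ _ _) (*-congʳ (≈-trans (exp-+ _ _) (*-congʳ (exp-+ _ _))))))))
          (‖‖-* (‖‖-* (‖‖-* (bounded (exp (ι M)) .proj₂) (‖exp[-2n]‖ (ℤ.∣ k ∣ ℕ.+ ℤ.∣ l ∣)))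
                      (‖exp-neg-approx‖ (decay-approx k l)))
                (‖exp-imaginary‖ (imaginary (angle-real k l)))))
        where
        module Q = ℚ-Solver
        D′ = bounded (exp (ι M)) .proj₁

      term-sum : ∃ (HasSum (term x y))
      term-sum = sum-exists majorant-summable term-dominated

      prefactor : Carrier
      prefactor = exp (ι 2ℚ * J * x) * exp (ι 2ℚ * J * y)

      -- The prefactor becomes the summand 1 in both weights.
      weighted-term : ∀ p → prefactor * term x y p ≈
        exp (phase x y (C-exponent (proj₁ p) (proj₂ p)) (fromℤ/1 (x-weight p)) (fromℤ/1 (y-weight p)))
      weighted-term (k , l) = ≈-trans (*-cong (≈-sym (exp-+ _ _)) (term-phase x y k l)) (≈-trans (≈-sym (exp-+ _ _)) (exp-cong
        (≈-trans (solve 8 (λ Π J r τ x A y B →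
            (con 2ℚ :* J :* x :+ con 2ℚ :* J :* y) :+ (Π :* J :* r :* τ :+ (con 2ℚ :* J :* x :* A :+ con 2ℚ :* J :* y :* B)) :=
            Π :* J :* r :* τ :+ (con 2ℚ :* J :* x :* (A :+ con 1ℚ) :+ con 2ℚ :* J :* y :* (B :+ con 1ℚ)))
            ≈-refl Π J (ι (C-exponent k l)) τ x _ y _)
          (+-congˡ (+-cong (*-congˡ (add-1 (x-exponent (k , l)))) (*-congˡ (add-1 (y-exponent (k , l)))))))))
        where
        add-1 : ∀ n → ι (fromℤ/1 n) + ι 1ℚ ≈ ι (fromℤ/1 (n ℤ.+ + 1))
        add-1 n = ≈-sym (≈-trans (reflexive (cong ι (/1-+ n (+ 1)))) (ι-+ _ _))

      -- The constant 1 collects the 1/3 of each of three terms.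
      q-exponent : ℤ → ℚ
      q-exponent n = 2ℚ ℚ.* (fromℤ/1 n ℚ.+ 1ℚ)

      cubed-term : Triple (ℤ × ℤ) → Carrier
      cubed-term T = exp (phase x y (q-exponent (Q T)) (fromℤ/1 (X T)) (fromℤ/1 (Y T)))

      private
        sumT-/1 : ∀ a b e → ι (fromℤ/1 a) + (ι (fromℤ/1 b) + ι (fromℤ/1 e)) ≈ ι (fromℤ/1 (sumT (a , b , e)))
        sumT-/1 a b e = ≈-sym (≈-trans (reflexive (cong ι (≡.trans (/1-+ a (b ℤ.+ e)) (cong (fromℤ/1 a ℚ.+_) (/1-+ b e)))))
          (≈-trans (ι-+ _ _) (+-congˡ (ι-+ _ _))))

        q-exponent-sum : ∀ a b e → let C-exp = λ n → 2ℚ ℚ.* (fromℤ/1 n ℚ.+ + 1 ℚ./ 3) in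
          ι (C-exp a) + (ι (C-exp b) + ι (C-exp e)) ≈ ι (q-exponent (sumT (a , b , e)))
        q-exponent-sum a b e = ≈-sym (≈-trans (reflexive (cong ι (≡.trans
            (cong (λ s → 2ℚ ℚ.* (s ℚ.+ 1ℚ)) (≡.trans (/1-+ a (b ℤ.+ e)) (cong (fromℤ/1 a ℚ.+_) (/1-+ b e))))
            (R.solve 3 (λ a b e → let t = λ n → R.con 2ℚ R.:* (n R.:+ R.con (+ 1 ℚ./ 3)) in
               R.con 2ℚ R.:* ((a R.:+ (b R.:+ e)) R.:+ R.con 1ℚ) R.:= t a R.:+ (t b R.:+ t e)) ≡.refl (fromℤ/1 a) (fromℤ/1 b) (fromℤ/1 e)))))
          (≈-trans (ι-+ _ _) (+-congˡ (ι-+ _ _))))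
          where module R = ℚ-Solver

      cube-of-terms : ∀ (T : Triple (ℤ × ℤ)) → let (p , q , s) = T ; t = term x y in
        (prefactor * (prefactor * prefactor)) * (t p * (t q * t s)) ≈ cubed-term T
      cube-of-terms T@(p , q , s) = begin
        (u * (u * u)) * (t p * (t q * t s))
          ≈⟨ solve 4 (λ u a b e → (u :* (u :* u)) :* (a :* (b :* e)) := (u :* a) :* ((u :* b) :* (u :* e))) ≈-refl u (t p) (t q) (t s) ⟩
        (u * t p) * ((u * t q) * (u * t s))
          ≈⟨ *-cong (weighted-term p) (*-cong (weighted-term q) (weighted-term s)) ⟩
        exp (ph p) * (exp (ph q) * exp (ph s))
          ≈⟨ ≈-trans (*-congˡ (≈-sym (exp-+ _ _))) (≈-sym (exp-+ _ _)) ⟩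
        exp (ph p + (ph q + ph s))
          ≈⟨ exp-cong (solve 13 (λ P J2x J2y τ r₁ r₂ r₃ a₁ a₂ a₃ b₁ b₂ b₃ →
               (P :* r₁ :* τ :+ (J2x :* a₁ :+ J2y :* b₁)) :+ ((P :* r₂ :* τ :+ (J2x :* a₂ :+ J2y :* b₂)) :+ (P :* r₃ :* τ :+ (J2x :* a₃ :+ J2y :* b₃)))
               := P :* (r₁ :+ (r₂ :+ r₃)) :* τ :+ (J2x :* (a₁ :+ (a₂ :+ a₃)) :+ J2y :* (b₁ :+ (b₂ :+ b₃))))
               ≈-refl (Π * J) (ι 2ℚ * J * x) (ι 2ℚ * J * y) τ (ι (e p)) (ι (e q)) (ι (e s)) (ι (fromℤ/1 (x-weight p))) (ι (fromℤ/1 (x-weight q))) (ι (fromℤ/1 (x-weight s)))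
               (ι (fromℤ/1 (y-weight p))) (ι (fromℤ/1 (y-weight q))) (ι (fromℤ/1 (y-weight s)))) ⟩
        exp (Π * J * (ι (e p) + (ι (e q) + ι (e s))) * τ +
             (ι 2ℚ * J * x * (ι (fromℤ/1 (x-weight p)) + (ι (fromℤ/1 (x-weight q)) + ι (fromℤ/1 (x-weight s)))) +
              ι 2ℚ * J * y * (ι (fromℤ/1 (y-weight p)) + (ι (fromℤ/1 (y-weight q)) + ι (fromℤ/1 (y-weight s))))))
          ≈⟨ exp-cong (+-cong (*-congʳ (*-congˡ (q-exponent-sum (quadratic p) (quadratic q) (quadratic s))))
               (+-cong (*-congˡ (sumT-/1 (x-weight p) (x-weight q) (x-weight s))) (*-congˡ (sumT-/1 (y-weight p) (y-weight q) (y-weight s))))) ⟩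
        cubed-term T ∎
        where
        open import Relation.Binary.Reasoning.Setoid setoid
        u = prefactor
        t = term x y
        e : ℤ × ℤ → ℚ
        e (k , l) = C-exponent k l
        ph : ℤ × ℤ → Carrier
        ph p = phase x y (e p) (fromℤ/1 (x-weight p)) (fromℤ/1 (y-weight p))

      -- With the final `1#` this has the shape to which `z ^ 3` unfolds.
      cube : Carrier → Carrier
      cube z = z * (z * (z * 1#))

      hasSum-cubed : ∀ {S} → HasSum (term x y) S → HasSum cubed-term (cube (prefactor * S))
      hasSum-cubed {S} h = hasSum-resp
        (≈-trans (solve 2 (λ u s → (u :* (u :* u)) :* (s :* (s :* s)) := (u :* s) :* ((u :* s) :* ((u :* s) :* con 1ℚ))) ≈-refl prefactor S)
          (*-congˡ (*-congˡ (*-congˡ ι-1))))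
        (hasSum-cong cube-of-terms (hasSum-* _
          (hasSum-⊗ majorant-summable (⊗-summable majorant-summable majorant-summable)
             term-dominated (λ (a , b) → ‖‖-* (term-dominated a) (term-dominated b)) h
             (hasSum-⊗ majorant-summable majorant-summable term-dominated term-dominated h h))))

    cubed-term-cong : ∀ {x x′ y y′} → x ≈ x′ → y ≈ y′ → ∀ T → cubed-term x y T ≈ cubed-term x′ y′ T
    cubed-term-cong p q T = exp-cong (+-congˡ (+-cong (*-congʳ (*-congˡ p)) (*-congʳ (*-congˡ q))))

    cubed-term-reflected : ∀ x y {T T′} → Reflected T T′ → cubed-term (- x) (- y) T′ ≈ cubed-term x y T
    cubed-term-reflected x y {T} {T′} R = exp-cong (+-cong
      (*-congʳ (*-congˡ (reflexive (cong (ι ∘ q-exponent x y) Q-eq))))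
      (+-cong (negate x X-eq) (negate y Y-eq)))
      where
      open Reflected R
      negate : ∀ z {m n} → m ≡ ℤ.- n → ι 2ℚ * J * - z * ι (fromℤ/1 m) ≈ ι 2ℚ * J * z * ι (fromℤ/1 n)
      negate z {m} {n} e = ≈-trans (*-congˡ (≈-trans (reflexive (cong ι (≡.trans (cong fromℤ/1 e) (/1-neg n)))) (ι-neg _)))
        (solve 3 (λ j z n → con 2ℚ :* j :* (:- z) :* (:- n) := con 2ℚ :* j :* z :* n) ≈-refl J z (ι (fromℤ/1 n)))
        where
        /1-neg : ∀ n → fromℤ/1 (ℤ.- n) ≡ ℚ.- fromℤ/1 n
        /1-neg (+ zero)  = ≡.refl
        /1-neg (+ suc n) = ≡.refl
        /1-neg -[1+ n ]  = ≡.sym (RingProperties.-‿involutive ℚP.+-*-ring (fromℤ/1 (+ suc n)))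

    exp-turns-ℕ : ∀ n → exp (ι 2ℚ * (J * Π) * ι (fromℤ/1 (+ n))) ≈ 1#
    exp-turns-ℕ zero    = exp-0 (≈-trans (*-congˡ ι-0) (zeroʳ _))
    exp-turns-ℕ (suc n) = ≈-trans (exp-cong (≈-trans (*-congˡ (≈-trans (reflexive (cong ι (/1-+ (+ 1) (+ n)))) (ι-+ _ _)))
        (solve 2 (λ t n → t :* (con 1ℚ :+ n) := t :+ t :* n) ≈-refl (ι 2ℚ * (J * Π)) (ι (fromℤ/1 (+ n))))))
      (≈-trans (exp-+ _ _) (≈-trans (*-cong exp-full-turn (exp-turns-ℕ n)) (*-identityˡ 1#)))

    exp-turns : ∀ n → exp (ι 2ℚ * (J * Π) * ι (fromℤ/1 n)) ≈ 1#
    exp-turns (+ n) = exp-turns-ℕ n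
    exp-turns -[1+ n ] = begin
      exp (t * ι (ℚ.- m))             ≈⟨ exp-cong (≈-trans (*-congˡ (ι-neg m)) (solve 2 (λ t m → t :* (:- m) := :- (t :* m)) ≈-refl t (ι m))) ⟩
      exp (- (t * ι m))               ≈⟨ *-identityˡ _ ⟨
      1# * exp (- (t * ι m))          ≈⟨ *-congʳ (exp-turns-ℕ (suc n)) ⟨
      exp (t * ι m) * exp (- (t * ι m)) ≈⟨ exp-neg (t * ι m) ⟩
      1# ∎
      where
      open import Relation.Binary.Reasoning.Setoid setoid
      t = ι 2ℚ * (J * Π)
      m = fromℤ/1 (+ suc n)

    module _ (s : Carrier) (3s≈Π : s * ι (+ 3 ℚ./ 1) ≈ Π) where

      -- The extra factor is exp(2is·X(T)); as X(T) = 3n and 3s = π, it is exp(2πin) = 1.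
      cubed-term-shift : ∀ x y T n → X T ≡ + 3 ℤ.* n → cubed-term (x + s) y T ≈ cubed-term x y T
      cubed-term-shift x y T n e = begin
        exp (E + (ι 2ℚ * J * (x + s) * ι (fromℤ/1 (X T)) + Y′))
          ≈⟨ exp-cong (solve 6 (λ E J x s X Y → E :+ (con 2ℚ :* J :* (x :+ s) :* X :+ Y) :=
               (E :+ (con 2ℚ :* J :* x :* X :+ Y)) :+ con 2ℚ :* (J :* (s :* X))) ≈-refl E J x s (ι (fromℤ/1 (X T))) Y′) ⟩
        exp (phase′ + ι 2ℚ * (J * (s * ι (fromℤ/1 (X T)))))
          ≈⟨ exp-+ _ _ ⟩
        exp phase′ * exp (ι 2ℚ * (J * (s * ι (fromℤ/1 (X T)))))
          ≈⟨ *-congˡ (≈-trans (exp-cong turns) (exp-turns n)) ⟩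
        exp phase′ * 1#
          ≈⟨ *-identityʳ _ ⟩
        exp phase′ ∎
        where
        open import Relation.Binary.Reasoning.Setoid setoid
        E = Π * J * ι (q-exponent x y (Q T)) * τ
        Y′ = ι 2ℚ * J * y * ι (fromℤ/1 (Y T))
        phase′ = E + (ι 2ℚ * J * x * ι (fromℤ/1 (X T)) + Y′)
        turns : ι 2ℚ * (J * (s * ι (fromℤ/1 (X T)))) ≈ ι 2ℚ * (J * Π) * ι (fromℤ/1 n)
        turns = ≈-trans (*-congˡ (*-congˡ (*-congˡ (≈-trans (reflexive (cong ι (≡.trans (cong fromℤ/1 e) (/1-* (+ 3) n)))) (ι-* _ _)))))
          (≈-trans (solve 4 (λ J s t n → con 2ℚ :* (J :* (s :* (t :* n))) := con 2ℚ :* (J :* (s :* t)) :* n) ≈-refl J s (ι (+ 3 ℚ./ 1)) (ι (fromℤ/1 n)))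
            (*-congʳ (*-congˡ (*-congˡ 3s≈Π))))

      -- The two series with negated arguments are reindexed by `φ`. All four sums then run over the
      -- same triples and their combination vanishes term by term; the residue of the defect matters
      -- only within one term.
      theta-identity : ∀ x y {S₁ S₂ S₃ S₄} →
        HasSum (term x y) S₁ → HasSum (term (- x) (- y)) S₂ →
        HasSum (term (x + s) y) S₃ → HasSum (term (- x - s) (- y)) S₄ →
        let c = λ x y S → cube x y (prefactor x y * S) in
        c x y S₁ - c (- x) (- y) S₂ ≈ c (x + s) y S₃ - c (- x - s) (- y) S₄
      theta-identity x y h₁ h₂ h₃ h₄ = x-y≈0⇒x≈y (hasSum-zero (E ⊗ E ⊗ E) vanish
        (hasSum-- (hasSum-- (hasSum-cubed x y h₁) (reindexed h₂)) (hasSum-- (hasSum-cubed (x + s) y h₃) (reindexed h₄))))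
        where
        E = ℤ-exhaustion ⊗ ℤ-exhaustion
        reindexed : ∀ {x y S} → HasSum (term x y) S → HasSum (cubed-term x y ∘ φ) (cube x y (prefactor x y * S))
        reindexed {x} {y} h = hasSum-involution φ φ-involutive (hasSum-cubed x y h)
        -x-s : - x - s ≈ - (x + s)
        -x-s = solve 2 (λ x s → :- x :- s := :- (x :+ s)) ≈-refl x s
        vanish : ∀ T → (cubed-term x y T - cubed-term (- x) (- y) (φ T))
                     - (cubed-term (x + s) y T - cubed-term (- x - s) (- y) (φ T)) ≈ 0#
        vanish T with φ-cases T
        ... | inj₂ R = ≈-trans (+-cong
            (≈-trans (+-congˡ (-‿cong (cubed-term-reflected x y R))) (-‿inverseʳ _))
            (-‿cong (≈-trans (+-congˡ (-‿cong (≈-trans (cubed-term-cong -x-s ≈-refl (φ T)) (cubed-term-reflected (x + s) y R)))) (-‿inverseʳ _))))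
          (-‿inverseʳ 0#)
        ... | inj₁ (φT≡T , n , e) = ≈-trans (+-cong
            (+-congˡ (-‿cong (reflexive (cong (cubed-term (- x) (- y)) φT≡T))))
            (-‿cong (+-cong (cubed-term-shift x y T n e)
              (-‿cong (≈-trans (reflexive (cong (cubed-term (- x - s) (- y)) φT≡T))
                -- The shift lemma is read backwards here: adding s leads from -x-s to -x.
                (≈-trans (≈-sym (cubed-term-shift (- x - s) (- y) T n e))
                  (cubed-term-cong (solve 2 (λ x s → (:- x :- s) :+ s := :- x) ≈-refl x s) ≈-refl T)))))))
          (-‿inverseʳ _)

-- Transfer to given operations

-- The identity restated in terms of arbitrary operations and abbreviations with the given laws, so
-- that its instance for ℂ is literally about the operations and abbreviations of Defs.
module MainTheorem {C : Set} {_≈_ : C → C → Set} {_+_ _*_ : C → C → C} { -_ : C → C} {0# 1# : C}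
  {ι : ℚ → C} {‖_‖≤_ : C → ℚ → Set} {exp : C → C} {J Π : C}
  (isComplexField : IsComplexField _≈_ _+_ _*_ -_ 0# 1# ι ‖_‖≤_ exp J Π)
  (_−_ : C → C → C) (−-law : ∀ x y → (x − y) ≈ (x + (- y)))
  (2J : C) (2J-law : 2J ≈ (ι (+ 2 ℚ./ 1) * J))
  (ιℤ : ℤ → C) (ιℤ-law : ∀ n → ιℤ n ≈ ι (fromℤ/1 n))
  (cube : C → C) (cube-law : ∀ z → cube z ≈ (z * (z * (z * 1#))))
  (s : C) (s-law : (s * ι (+ 3 ℚ./ 1)) ≈ Π)
  (sum : {A : Set} → (A → C) → List A → C)
  (sum-[] : {A : Set} (f : A → C) → sum f [] ≈ 0#)
  (sum-∷ : {A : Set} (f : A → C) → ∀ a as → sum f (a ∷ as) ≈ (f a + sum f as))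
  (τ : C) (term : C → C → ℤ × ℤ → C)
  (term-law : ∀ x y k l → term x y (k , l) ≈
    ((exp (((Π * J) * ι (C-exponent k l)) * τ) * exp ((2J * x) * ιℤ (+ 2 ℤ.* l ℤ.+ k)))
      * exp ((2J * y) * ιℤ (+ 2 ℤ.* k ℤ.+ l))))
  where

  private
    complexField : ComplexField
    complexField = record { isComplexField = isComplexField }

    module M = ComplexField complexField
    open M using (≈-refl; ≈-sym; ≈-trans; +-cong; *-cong; *-congˡ; *-congʳ; -‿cong)
    open Exponential complexField using (exp-cong)

  HasSum : {A : Set} → (A → C) → C → Set
  HasSum {A} f x = ∀ ε → 0ℚ ℚ.< ε → ∃ λ (F : List A) → ∀ G → Unique G → F ⊆ G →
    ‖ sum f G + (- x) ‖≤ ε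

  open IsComplexField isComplexField using (Approximable)

  module _ (τ₁ τ₂ : C) (τ-parts : τ ≈ (τ₁ + (J * τ₂))) (τ₁-approx : Approximable τ₁)
    (ρ : ℕ → ℚ) (ρ⟶τ₂ : ∀ ε → 0ℚ ℚ.< ε → Eventually λ n → ‖ ι (ρ n) + (- τ₂) ‖≤ ε)
    (c : ℚ) (0<c : 0ℚ ℚ.< c) (c≤ρ : Eventually λ n → c ℚ.≤ ρ n) where

    private
      module Θ = Theta.Series complexField τ τ₁ τ₂ τ-parts τ₁-approx ρ ρ⟶τ₂ c 0<c c≤ρ

      sum≈Σ : ∀ {A : Set} (f : A → C) as → sum f as ≈ M.Σ f as
      sum≈Σ f []       = sum-[] f
      sum≈Σ f (a ∷ as) = ≈-trans (sum-∷ f a as) (M.+-congˡ (sum≈Σ f as))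

      to : ∀ {A : Set} {f : A → C} {x} → HasSum f x → M.HasSum f x
      to {f = f} h ε 0<ε = let F , close = h ε 0<ε in F , λ G uG F⊆G →
        M.‖‖-cong (M.+-congʳ (sum≈Σ f G)) (close G uG F⊆G)

      from : ∀ {A : Set} {f : A → C} {x} → M.HasSum f x → HasSum f x
      from {f = f} h ε 0<ε = let F , close = h ε 0<ε in F , λ G uG F⊆G →
        M.‖‖-cong (M.+-congʳ (≈-sym (sum≈Σ f G))) (close G uG F⊆G)

      term-≈ : ∀ x y p → term x y p ≈ Θ.term x y p
      term-≈ x y (k , l) = ≈-trans (term-law x y k l) (*-cong (*-congˡ (exp-cong (argument x _))) (exp-cong (argument y _)))
        where
        argument : ∀ x n → ((2J * x) * ιℤ n) ≈ (((ι (+ 2 ℚ./ 1) * J) * x) * ι (fromℤ/1 n))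
        argument x n = *-cong (*-congʳ 2J-law) (ιℤ-law n)

      cube-≈ : ∀ {c x y S} → c ≈ ((exp (2J * x) * exp (2J * y)) * S) → cube c ≈ Θ.cube x y (Θ.prefactor x y * S)
      cube-≈ {c} {x} {y} {S} e = ≈-trans (cube-law c) (*-cong e′ (*-cong e′ (*-congʳ e′)))
        where
        e′ : c ≈ (Θ.prefactor x y * S)
        e′ = ≈-trans e (*-congʳ (*-cong (exp-cong (*-congʳ 2J-law)) (exp-cong (*-congʳ 2J-law))))

    sum-exists : ∀ x y → ∃ (HasSum (term x y))
    sum-exists x y = let S , h = Θ.term-sum x y in S , from (M.hasSum-cong (λ p → ≈-sym (term-≈ x y p)) h)

    identity : ∀ x y {c₁ c₂ c₃ c₄ S₁ S₂ S₃ S₄} →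
      HasSum (term x y) S₁ → c₁ ≈ ((exp (2J * x) * exp (2J * y)) * S₁) →
      HasSum (term (- x) (- y)) S₂ → c₂ ≈ ((exp (2J * (- x)) * exp (2J * (- y))) * S₂) →
      HasSum (term (x + s) y) S₃ → c₃ ≈ ((exp (2J * (x + s)) * exp (2J * y)) * S₃) →
      HasSum (term ((- x) − s) (- y)) S₄ → c₄ ≈ ((exp (2J * ((- x) − s)) * exp (2J * (- y))) * S₄) →
      (cube c₁ − cube c₂) ≈ (cube c₃ − cube c₄)
    identity x y {c₁} {c₂} {c₃} {c₄} h₁ e₁ h₂ e₂ h₃ e₃ h₄ e₄ = ≈-trans (−-law _ _) (≈-trans
      (+-cong (cube-≈ e₁) (-‿cong (cube-≈ e₂)))
      (≈-trans (Θ.theta-identity s s-law x y (sums x y h₁) (sums _ _ h₂) (sums _ _ h₃)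
                 (M.hasSum-cong (λ (k , l) → *-congʳ (*-congˡ (exp-cong (*-congʳ (*-congˡ (−-law _ _)))))) (sums _ _ h₄)))
        (≈-sym (≈-trans (−-law _ _) (+-cong (cube-≈ e₃) (-‿cong (cube-≈ e₄′)))))))
      where
      e₄′ : c₄ ≈ ((exp (2J * ((- x) + (- s))) * exp (2J * (- y))) * _)
      e₄′ = ≈-trans e₄ (*-congʳ (*-congʳ (exp-cong (*-congˡ (−-law _ _)))))
      sums : ∀ x y {S} → HasSum (term x y) S → M.HasSum (Θ.term x y) S
      sums x y h = M.hasSum-cong (term-≈ x y) (to h)

open import Defs
open ExpLemmas using (size; size-nonneg; size-*; re≤size; im≤size; size-bounded; 1/!-suc)

-- The complex numbers as Cauchy sequences

module ComplexInstance where
  open ℚP.≤-Reasoning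
  open ℚ-Solver

  -- The norm is |re| + |im|: it is rational at every index, where the modulus would need a square
  -- root, and `size-*` makes it submultiplicative.
  record SizeBound (z : ℂ) (q : ℚ) : Set where
    constructor size≤
    field eventually : ∀ δ → 0ℚ ℚ.< δ → Eventually λ p → size z p ℚ.≤ q ℚ.+ δ

  open SizeBound

  infix 4 _≈_ _≗_

  -- Not a field of type SizeBound (z - w) 0ℚ: its normal form contains the Cauchy proofs of z - w.
  record _≈_ (z w : ℂ) : Set where
    constructor small-difference
    field close : ∀ δ → 0ℚ ℚ.< δ → Eventually λ p → size (z - w) p ℚ.≤ 0ℚ ℚ.+ δ

  open _≈_

  ≈-bound : ∀ {z w} → z ≈ w → SizeBound (z - w) 0ℚ
  ≈-bound e = size≤ (close e)

  ≈-by : ∀ {z w} → SizeBound (z - w) 0ℚ → z ≈ w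
  ≈-by b = small-difference (eventually b)

  -- The operations act index by index, so the ring laws hold already between the approximating
  -- sequences, as identities in ℚ.
  record _≗_ (z w : ℂ) : Set where
    constructor pointwise
    field
      re-≡ : ∀ p → seq (re z) p ≡ seq (re w) p
      im-≡ : ∀ p → seq (im z) p ≡ seq (im w) p

  open _≗_

  both : ∀ {P Q : ℕ → Set} → Eventually P → Eventually Q → Eventually λ n → P n × Q n
  both (M , p) (N , q) = M ℕ.⊔ N , λ n h → p n (ℕP.m⊔n≤o⇒m≤o M N h) , q n (ℕP.m⊔n≤o⇒n≤o M N h)

  weaken : ∀ {P Q : ℕ → Set} → (∀ n → P n → Q n) → Eventually P → Eventually Q
  weaken f (N , p) = N , λ n h → f n (p n h)

  -- The order of ℚ is decidable, so the contrary case p > q may be refuted with half the gap.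
  ≤-small : ∀ {p q} → (∀ δ → 0ℚ ℚ.< δ → p ℚ.≤ q ℚ.+ δ) → p ℚ.≤ q
  ≤-small {p} {q} h with p ℚP.≤? q
  ... | yes p≤q = p≤q
  ... | no p≰q = ⊥-elim (ℚP.<-irrefl ≡.refl (begin-strict
    p            ≤⟨ h ε 0<ε ⟩
    q ℚ.+ ε      ≡⟨ ℚP.+-identityʳ (q ℚ.+ ε) ⟨
    q ℚ.+ ε ℚ.+ 0ℚ <⟨ ℚP.+-monoʳ-< (q ℚ.+ ε) 0<ε ⟩
    q ℚ.+ ε ℚ.+ ε  ≡⟨ solve 2 (λ p q → q :+ con ½ :* (p :- q) :+ con ½ :* (p :- q) := p) ≡.refl p q ⟩
    p            ∎))
    where
    ε = ½ ℚ.* (p ℚ.- q)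
    0<ε : 0ℚ ℚ.< ε
    0<ε = ½pos (subst (ℚ._< p ℚ.- q) (ℚP.+-inverseʳ q) (ℚP.+-monoˡ-< (ℚ.- q) (ℚP.≰⇒> p≰q)))

  bound-map : ∀ {z w p q} → (∀ n → size z n ℚ.≤ size w n) → p ℚ.≤ q → SizeBound w p → SizeBound z q
  bound-map h p≤q b .eventually δ 0<δ =
    weaken (λ n s → ℚP.≤-trans (h n) (ℚP.≤-trans s (ℚP.+-monoˡ-≤ δ p≤q))) (eventually b δ 0<δ)

  bound-≗ : ∀ {z w q} → z ≗ w → SizeBound w q → SizeBound z q
  bound-≗ {z} {w} e = bound-map {z} {w} (λ n → ℚP.≤-reflexive (cong₂ (λ a b → ℚ.∣ a ∣ ℚ.+ ℚ.∣ b ∣) (re-≡ e n) (im-≡ e n))) ℚP.≤-refl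

  bound-const : ∀ {z q} → (∀ n → size z n ℚ.≤ q) → SizeBound z q
  bound-const h .eventually δ 0<δ = 0 , λ n _ → ℚP.≤-trans (h n) (p≤p+q (ℚP.<⇒≤ 0<δ))

  bound-mono : ∀ {z p q} → p ℚ.≤ q → SizeBound z p → SizeBound z q
  bound-mono {z} = bound-map {z} {z} (λ n → ℚP.≤-refl)

  bound-+ : ∀ {z w p q} → SizeBound z p → SizeBound w q → SizeBound (z + w) (p ℚ.+ q)
  bound-+ {z} {w} {p} {q} a b .eventually δ 0<δ = weaken (λ n (s , t) → begin
      size (z + w) n
        ≤⟨ ℚP.+-mono-≤ (ℚP.∣p+q∣≤∣p∣+∣q∣ (seq (re z) n) (seq (re w) n)) (ℚP.∣p+q∣≤∣p∣+∣q∣ (seq (im z) n) (seq (im w) n)) ⟩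
      (ℚ.∣ seq (re z) n ∣ ℚ.+ ℚ.∣ seq (re w) n ∣) ℚ.+ (ℚ.∣ seq (im z) n ∣ ℚ.+ ℚ.∣ seq (im w) n ∣)
        ≡⟨ solve 4 (λ a b c d → (a :+ b) :+ (c :+ d) := (a :+ c) :+ (b :+ d)) ≡.refl
             (ℚ.∣ seq (re z) n ∣) (ℚ.∣ seq (re w) n ∣) (ℚ.∣ seq (im z) n ∣) (ℚ.∣ seq (im w) n ∣) ⟩
      size z n ℚ.+ size w n
        ≤⟨ ℚP.+-mono-≤ s t ⟩
      (p ℚ.+ ½ ℚ.* δ) ℚ.+ (q ℚ.+ ½ ℚ.* δ)
        ≡⟨ solve 3 (λ p q d → (p :+ con ½ :* d) :+ (q :+ con ½ :* d) := (p :+ q) :+ d) ≡.refl p q δ ⟩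
      (p ℚ.+ q) ℚ.+ δ ∎)
    (both (eventually a (½ ℚ.* δ) (½pos 0<δ)) (eventually b (½ ℚ.* δ) (½pos 0<δ)))

  bound-nonneg′ : ∀ {z q} → SizeBound z q → 0ℚ ℚ.≤ q
  bound-nonneg′ {z} b = ≤-small λ δ 0<δ →
    let N , s = eventually b δ 0<δ in ℚP.≤-trans (size-nonneg z N) (s N ℕP.≤-refl)

  ⊓-pos : ∀ {p q} → 0ℚ ℚ.< p → 0ℚ ℚ.< q → 0ℚ ℚ.< p ℚ.⊓ q
  ⊓-pos {p} {q} 0<p 0<q with ℚP.⊓-sel p q
  ... | inj₁ e = subst (0ℚ ℚ.<_) (≡.sym e) 0<p
  ... | inj₂ e = subst (0ℚ ℚ.<_) (≡.sym e) 0<q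

  bound-* : ∀ {z w p q} → SizeBound z p → SizeBound w q → SizeBound (z * w) (p ℚ.* q)
  bound-* {z} {w} {p} {q} a b .eventually δ 0<δ = weaken (λ n (s , t) → begin
      size (z * w) n
        ≤⟨ size-* z w n ⟩
      size z n ℚ.* size w n
        ≤⟨ *-mono (size-nonneg z n) (+-nonneg 0≤q (ℚP.<⇒≤ 0<ε)) s t ⟩
      (p ℚ.+ ε) ℚ.* (q ℚ.+ ε)
        ≡⟨ solve 3 (λ p q e → (p :+ e) :* (q :+ e) := p :* q :+ (p :+ q :+ e) :* e) ≡.refl p q ε ⟩
      p ℚ.* q ℚ.+ (p ℚ.+ q ℚ.+ ε) ℚ.* ε
        ≤⟨ ℚP.+-monoʳ-≤ (p ℚ.* q) (ℚP.≤-trans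
             (*-mono (+-nonneg (+-nonneg 0≤p 0≤q) (ℚP.<⇒≤ 0<ε)) (ℚP.<⇒≤ 0<ε′) (ℚP.+-monoʳ-≤ (p ℚ.+ q) (ℚP.p⊓q≤q ε′ 1ℚ)) (ℚP.p⊓q≤p ε′ 1ℚ)) small) ⟩
      p ℚ.* q ℚ.+ δ ∎)
    (both (eventually a ε 0<ε) (eventually b ε 0<ε))
    where
    0≤p = bound-nonneg′ a
    0≤q = bound-nonneg′ b
    shrunk = shrink (p ℚ.+ q ℚ.+ 1ℚ) δ (+-nonneg (+-nonneg 0≤p 0≤q) 0≤1) 0<δ
    ε′ = proj₁ shrunk
    0<ε′ = proj₁ (proj₂ shrunk)
    small = proj₂ (proj₂ shrunk)
    -- The cap 1 keeps p + q + ε below p + q + 1, the factor for which ε′ was chosen.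
    ε = ε′ ℚ.⊓ 1ℚ
    0<ε : 0ℚ ℚ.< ε
    0<ε = ⊓-pos 0<ε′ 0<1

  bounded-by : ∀ z → ∃ (SizeBound z)
  bounded-by z = let B , _ , N , s = size-bounded z in
    B , size≤ λ δ 0<δ → N , λ n h → ℚP.≤-trans (s n h) (p≤p+q (ℚP.<⇒≤ 0<δ))

  bound-zero : ∀ {z} → z ≗ fromℤ (+ 0) → SizeBound z 0ℚ
  bound-zero {z} e = bound-≗ {z} {fromℤ (+ 0)} e (bound-const {fromℤ (+ 0)} λ n → ℚP.≤-refl)

  ≗⇒≈ : ∀ {z w} → z ≗ w → z ≈ w
  ≗⇒≈ {z} {w} e = ≈-by (bound-zero {z - w} (pointwise
    (λ n → ≡.trans (cong (ℚ._- seq (re w) n) (re-≡ e n)) (ℚP.+-inverseʳ (seq (re w) n)))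
    (λ n → ≡.trans (cong (ℚ._- seq (im w) n) (im-≡ e n)) (ℚP.+-inverseʳ (seq (im w) n)))))

  ≈⇒≃ : ∀ {z w} → z ≈ w → z ≃ w
  ≈⇒≃ {z} {w} b =
    (λ ε 0<ε → weaken (λ n s → ℚP.≤-trans (re≤size (z - w) n) (ℚP.≤-trans s (ℚP.≤-reflexive (ℚP.+-identityˡ ε)))) (eventually (≈-bound b) ε 0<ε)) ,
    (λ ε 0<ε → weaken (λ n s → ℚP.≤-trans (im≤size (z - w) n) (ℚP.≤-trans s (ℚP.≤-reflexive (ℚP.+-identityˡ ε)))) (eventually (≈-bound b) ε 0<ε))

  ≃-refl : ∀ z → z ≃ z
  ≃-refl z = (λ ε 0<ε → 0 , λ n _ → zero-distance (seq (re z) n) ε 0<ε) , (λ ε 0<ε → 0 , λ n _ → zero-distance (seq (im z) n) ε 0<ε)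
    where
    zero-distance : ∀ p ε → 0ℚ ℚ.< ε → ℚ.∣ p ℚ.- p ∣ ℚ.≤ ε
    zero-distance p ε 0<ε = ℚP.≤-trans (ℚP.≤-reflexive (cong ℚ.∣_∣ (ℚP.+-inverseʳ p))) (ℚP.<⇒≤ 0<ε)

  ≃⇒≈ : ∀ {z w} → z ≃ w → z ≈ w
  ≃⇒≈ {z} {w} (a , b) = ≈-by (size≤ λ δ 0<δ → weaken (λ n (s , t) → begin
      size (z - w) n      ≤⟨ ℚP.+-mono-≤ s t ⟩
      ½ ℚ.* δ ℚ.+ ½ ℚ.* δ ≡⟨ ≡.trans (½+½ δ) (≡.sym (ℚP.+-identityˡ δ)) ⟩
      0ℚ ℚ.+ δ            ∎)
    (both (a (½ ℚ.* δ) (½pos 0<δ)) (b (½ ℚ.* δ) (½pos 0<δ))))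

  bound-neg : ∀ {z q} → SizeBound z q → SizeBound (- z) q
  bound-neg {z} = bound-map { - z} {z} (λ n → ℚP.≤-reflexive
    (cong₂ ℚ._+_ (ℚP.∣-p∣≡∣p∣ (seq (re z) n)) (ℚP.∣-p∣≡∣p∣ (seq (im z) n)))) ℚP.≤-refl

  ≗-sub-swap : ∀ z w → z - w ≗ - (w - z)
  ≗-sub-swap z w = pointwise (λ n → eq (seq (re z) n) (seq (re w) n)) (λ n → eq (seq (im z) n) (seq (im w) n))
    where
    eq : ∀ a b → a ℚ.- b ≡ ℚ.- (b ℚ.- a)
    eq = solve 2 (λ a b → a :- b := :- (b :- a)) ≡.refl

  ≗-sub-trans : ∀ z w v → z - v ≗ (z - w) + (w - v)
  ≗-sub-trans z w v = pointwise (λ n → eq (seq (re z) n) (seq (re w) n) (seq (re v) n)) (λ n → eq (seq (im z) n) (seq (im w) n) (seq (im v) n))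
    where
    eq : ∀ a b c → a ℚ.- c ≡ (a ℚ.- b) ℚ.+ (b ℚ.- c)
    eq = solve 3 (λ a b c → a :- c := (a :- b) :+ (b :- c)) ≡.refl

  ≈-isEquivalence : IsEquivalence _≈_
  ≈-isEquivalence = record
    { refl  = ≗⇒≈ (pointwise (λ _ → ≡.refl) (λ _ → ≡.refl))
    ; sym   = λ {z} {w} b → ≈-by (bound-≗ {w - z} { - (z - w)} (≗-sub-swap w z) (bound-neg {z - w} (≈-bound b)))
    ; trans = λ {z} {w} {v} a b → ≈-by (bound-≗ {z - v} {(z - w) + (w - v)} (≗-sub-trans z w v) (bound-+ {z - w} {w - v} (≈-bound a) (≈-bound b)))
    }

  ≗-sub-+ : ∀ x y u v → (x + u) - (y + v) ≗ (x - y) + (u - v)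
  ≗-sub-+ x y u v = pointwise (λ n → eq (seq (re x) n) (seq (re y) n) (seq (re u) n) (seq (re v) n))
                              (λ n → eq (seq (im x) n) (seq (im y) n) (seq (im u) n) (seq (im v) n))
    where
    eq : ∀ x y u v → (x ℚ.+ u) ℚ.- (y ℚ.+ v) ≡ (x ℚ.- y) ℚ.+ (u ℚ.- v)
    eq = solve 4 (λ x y u v → (x :+ u) :- (y :+ v) := (x :- y) :+ (u :- v)) ≡.refl

  ≗-sub-* : ∀ x y u v → x * u - y * v ≗ x * (u - v) + (x - y) * v
  ≗-sub-* x y u v = pointwise
    (λ n → solve 8 (λ x x′ y y′ u u′ v v′ → (x :* u :- x′ :* u′) :- (y :* v :- y′ :* v′) :=
       (x :* (u :- v) :- x′ :* (u′ :- v′)) :+ ((x :- y) :* v :- (x′ :- y′) :* v′)) ≡.refl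
       (seq (re x) n) (seq (im x) n) (seq (re y) n) (seq (im y) n) (seq (re u) n) (seq (im u) n) (seq (re v) n) (seq (im v) n))
    (λ n → solve 8 (λ x x′ y y′ u u′ v v′ → (x :* u′ :+ x′ :* u) :- (y :* v′ :+ y′ :* v) :=
       (x :* (u′ :- v′) :+ x′ :* (u :- v)) :+ ((x :- y) :* v′ :+ (x′ :- y′) :* v)) ≡.refl
       (seq (re x) n) (seq (im x) n) (seq (re y) n) (seq (im y) n) (seq (re u) n) (seq (im u) n) (seq (re v) n) (seq (im v) n))

  *-congruent : ∀ {x y u v} → x ≈ y → u ≈ v → x * u ≈ y * v
  *-congruent {x} {y} {u} {v} a b =
    let B , bx = bounded-by x
        D , bv = bounded-by v
    in ≈-by (bound-≗ {x * u - y * v} {x * (u - v) + (x - y) * v} (≗-sub-* x y u v) (bound-mono {x * (u - v) + (x - y) * v}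
         (ℚP.≤-reflexive (solve 2 (λ B D → B :* con 0ℚ :+ con 0ℚ :* D := con 0ℚ) ≡.refl B D))
         (bound-+ {x * (u - v)} {(x - y) * v} (bound-* {x} {u - v} bx (≈-bound b)) (bound-* {x - y} {v} (≈-bound a) bv))))

  +-assoc-≈ : ∀ x y z → (x + y) + z ≈ x + (y + z)
  +-assoc-≈ x y z = ≗⇒≈ (pointwise (λ n → ℚP.+-assoc (seq (re x) n) (seq (re y) n) (seq (re z) n))
                                   (λ n → ℚP.+-assoc (seq (im x) n) (seq (im y) n) (seq (im z) n)))

  +-comm-≈ : ∀ x y → x + y ≈ y + x
  +-comm-≈ x y = ≗⇒≈ (pointwise (λ n → ℚP.+-comm (seq (re x) n) (seq (re y) n)) (λ n → ℚP.+-comm (seq (im x) n) (seq (im y) n)))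

  +-identityˡ-≈ : ∀ x → fromℤ (+ 0) + x ≈ x
  +-identityˡ-≈ x = ≗⇒≈ (pointwise (λ n → ℚP.+-identityˡ (seq (re x) n)) (λ n → ℚP.+-identityˡ (seq (im x) n)))

  +-inverseˡ-≈ : ∀ x → - x + x ≈ fromℤ (+ 0)
  +-inverseˡ-≈ x = ≗⇒≈ (pointwise (λ n → ℚP.+-inverseˡ (seq (re x) n)) (λ n → ℚP.+-inverseˡ (seq (im x) n)))

  +-cong-≈ : ∀ {x y u v} → x ≈ y → u ≈ v → x + u ≈ y + v
  +-cong-≈ {x} {y} {u} {v} a b = ≈-by (bound-≗ {(x + u) - (y + v)} {(x - y) + (u - v)} (≗-sub-+ x y u v)
    (bound-+ {x - y} {u - v} (≈-bound a) (≈-bound b)))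

  neg-cong-≈ : ∀ {x y} → x ≈ y → - x ≈ - y
  neg-cong-≈ {x} {y} b = ≈-by (bound-≗ { - x - - y} { - (x - y)} neg-sub (bound-neg {x - y} (≈-bound b)))
    where
    neg-sub : - x - - y ≗ - (x - y)
    neg-sub = pointwise (λ n → eq (seq (re x) n) (seq (re y) n)) (λ n → eq (seq (im x) n) (seq (im y) n))
      where
      eq : ∀ a b → ℚ.- a ℚ.- ℚ.- b ≡ ℚ.- (a ℚ.- b)
      eq = solve 2 (λ a b → :- a :- :- b := :- (a :- b)) ≡.refl

  *-assoc-≈ : ∀ x y z → (x * y) * z ≈ x * (y * z)
  *-assoc-≈ x y z = ≗⇒≈ (pointwise
    (λ n → solve 6 (λ a b c d e f → (a :* c :- b :* d) :* e :- (a :* d :+ b :* c) :* f := a :* (c :* e :- d :* f) :- b :* (c :* f :+ d :* e)) ≡.refl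
      (seq (re x) n) (seq (im x) n) (seq (re y) n) (seq (im y) n) (seq (re z) n) (seq (im z) n))
    (λ n → solve 6 (λ a b c d e f → (a :* c :- b :* d) :* f :+ (a :* d :+ b :* c) :* e := a :* (c :* f :+ d :* e) :+ b :* (c :* e :- d :* f)) ≡.refl
      (seq (re x) n) (seq (im x) n) (seq (re y) n) (seq (im y) n) (seq (re z) n) (seq (im z) n)))

  *-comm-≈ : ∀ x y → x * y ≈ y * x
  *-comm-≈ x y = ≗⇒≈ (pointwise
    (λ n → solve 4 (λ a b c d → a :* c :- b :* d := c :* a :- d :* b) ≡.refl (seq (re x) n) (seq (im x) n) (seq (re y) n) (seq (im y) n))
    (λ n → solve 4 (λ a b c d → a :* d :+ b :* c := c :* b :+ d :* a) ≡.refl (seq (re x) n) (seq (im x) n) (seq (re y) n) (seq (im y) n)))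

  *-identityˡ-≈ : ∀ x → fromℤ (+ 1) * x ≈ x
  *-identityˡ-≈ x = ≗⇒≈ (pointwise
    (λ n → solve 2 (λ a b → con 1ℚ :* a :- con 0ℚ :* b := a) ≡.refl (seq (re x) n) (seq (im x) n))
    (λ n → solve 2 (λ a b → con 1ℚ :* b :+ con 0ℚ :* a := b) ≡.refl (seq (re x) n) (seq (im x) n)))

  *-distribˡ-+-≈ : ∀ x y z → x * (y + z) ≈ x * y + x * z
  *-distribˡ-+-≈ x y z = ≗⇒≈ (pointwise
    (λ n → solve 6 (λ a b c d e f → a :* (c :+ e) :- b :* (d :+ f) := (a :* c :- b :* d) :+ (a :* e :- b :* f)) ≡.refl
      (seq (re x) n) (seq (im x) n) (seq (re y) n) (seq (im y) n) (seq (re z) n) (seq (im z) n))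
    (λ n → solve 6 (λ a b c d e f → a :* (d :+ f) :+ b :* (c :+ e) := (a :* d :+ b :* c) :+ (a :* f :+ b :* e)) ≡.refl
      (seq (re x) n) (seq (im x) n) (seq (re y) n) (seq (im y) n) (seq (re z) n) (seq (im z) n)))

  open import Algebra.Definitions _≈_ using (Congruent₁)
  module E = IsEquivalence ≈-isEquivalence

  +-identityʳ-≈ : ∀ x → x + fromℤ (+ 0) ≈ x
  +-identityʳ-≈ x = E.trans (+-comm-≈ x (fromℤ (+ 0))) (+-identityˡ-≈ x)

  +-inverseʳ-≈ : ∀ x → x + - x ≈ fromℤ (+ 0)
  +-inverseʳ-≈ x = E.trans (+-comm-≈ x (- x)) (+-inverseˡ-≈ x)

  *-identityʳ-≈ : ∀ x → x * fromℤ (+ 1) ≈ x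
  *-identityʳ-≈ x = E.trans (*-comm-≈ x (fromℤ (+ 1))) (*-identityˡ-≈ x)

  *-distribʳ-+-≈ : ∀ x y z → (y + z) * x ≈ y * x + z * x
  *-distribʳ-+-≈ x y z = E.trans (*-comm-≈ (y + z) x)
    (E.trans (*-distribˡ-+-≈ x y z) (+-cong-≈ {x * y} {y * x} {x * z} {z * x} (*-comm-≈ x y) (*-comm-≈ x z)))

  +-isMagma : IsMagma _≈_ _+_
  +-isMagma = record { isEquivalence = ≈-isEquivalence ; ∙-cong = λ {x} {y} {u} {v} → +-cong-≈ {x} {y} {u} {v} }

  +-isSemigroup : IsSemigroup _≈_ _+_
  +-isSemigroup = record { isMagma = +-isMagma ; assoc = +-assoc-≈ }

  +-isMonoid : IsMonoid _≈_ _+_ (fromℤ (+ 0))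
  +-isMonoid = record { isSemigroup = +-isSemigroup ; identity = +-identityˡ-≈ , +-identityʳ-≈ }

  -- Stated for a variable f because the two types are expensive to compare at f = -_.
  congruent₁ : ∀ f → (∀ {x y} → x ≈ y → f x ≈ f y) → Congruent₁ f
  congruent₁ f f-cong = f-cong

  +-isGroup : IsGroup _≈_ _+_ (fromℤ (+ 0)) (-_)
  +-isGroup = record { isMonoid = +-isMonoid ; inverse = +-inverseˡ-≈ , +-inverseʳ-≈ ; ⁻¹-cong = congruent₁ (-_) (λ {x} {y} → neg-cong-≈ {x} {y}) }

  +-isAbelianGroup : IsAbelianGroup _≈_ _+_ (fromℤ (+ 0)) (-_)
  +-isAbelianGroup = record { isGroup = +-isGroup ; comm = +-comm-≈ }

  +-*-isRing : IsRing _≈_ _+_ _*_ (-_) (fromℤ (+ 0)) (fromℤ (+ 1))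
  +-*-isRing = record
    { +-isAbelianGroup = +-isAbelianGroup
    ; *-cong = λ {x} {y} {u} {v} → *-congruent {x} {y} {u} {v}
    ; *-assoc = *-assoc-≈
    ; *-identity = *-identityˡ-≈ , *-identityʳ-≈
    ; distrib = *-distribˡ-+-≈ , *-distribʳ-+-≈
    }

  +-*-isCommutativeRing : IsCommutativeRing _≈_ _+_ _*_ (-_) (fromℤ (+ 0)) (fromℤ (+ 1))
  +-*-isCommutativeRing = record { isRing = +-*-isRing ; *-comm = *-comm-≈ }

  ApproachedBy : (ℕ → ℝ) → ℝ → Set
  ApproachedBy f x = ∀ ε → 0ℚ ℚ.< ε → Eventually λ n → ∀ δ → 0ℚ ℚ.< δ →
    Eventually λ p → ℚ.∣ seq (f n) p ℚ.- seq x p ∣ ℚ.≤ ε ℚ.+ δ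

  -- The p-th approximant of the limit is one rational from row `Mp`. It is compared with row n
  -- through a common later row b, at an index q beyond all thresholds. Besides ε this costs five
  -- errors γ, hence γ = δ/5.
  lim-converges : ∀ f c → ApproachedBy f (lim f c)
  lim-converges f c ε 0<ε = N , converges
    where
    N = proj₁ (c ε 0<ε)
    converges : ∀ n → N ℕ.≤ n → ∀ δ → 0ℚ ℚ.< δ → Eventually λ p → ℚ.∣ seq (f n) p ℚ.- seq (lim f c) p ∣ ℚ.≤ ε ℚ.+ δ
    converges n N≤n δ 0<δ = R ℕ.⊔ S , λ p p≥ →
      let r≤γ = rec p (ℕP.m⊔n≤o⇒m≤o R S p≥)
          p≥S = ℕP.m⊔n≤o⇒n≤o R S p≥
          Mp = proj₁ (c (recip p) (recip-pos p))
          Pp = proj₁ (cauchy (f Mp) (recip p) (recip-pos p))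
          b = N ℕ.⊔ Mp
          Q₁ , near₁ = proj₂ (c ε 0<ε) n b N≤n (ℕP.m≤m⊔n N Mp) γ 0<γ
          Q₂ , near₂ = proj₂ (c (recip p) (recip-pos p)) b Mp (ℕP.m≤n⊔m N Mp) ℕP.≤-refl γ 0<γ
          q = (S ℕ.⊔ Pp) ℕ.⊔ (Q₁ ℕ.⊔ Q₂)
          left = ℕP.m≤m⊔n (S ℕ.⊔ Pp) (Q₁ ℕ.⊔ Q₂)
          right = ℕP.m≤n⊔m (S ℕ.⊔ Pp) (Q₁ ℕ.⊔ Q₂)
          A = seq (f n) p
          A′ = seq (f n) q
          B = seq (f b) q
          D = seq (f Mp) q
          E = seq (f Mp) Pp
      in begin
        ℚ.∣ A ℚ.- E ∣
          ≤⟨ ℚP.≤-trans (triangle A A′ E) (ℚP.+-monoʳ-≤ ℚ.∣ A ℚ.- A′ ∣ (ℚP.≤-trans (triangle A′ B E) (ℚP.+-monoʳ-≤ ℚ.∣ A′ ℚ.- B ∣ (triangle B D E)))) ⟩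
        ℚ.∣ A ℚ.- A′ ∣ ℚ.+ (ℚ.∣ A′ ℚ.- B ∣ ℚ.+ (ℚ.∣ B ℚ.- D ∣ ℚ.+ ℚ.∣ D ℚ.- E ∣))
          ≤⟨ ℚP.+-mono-≤ (near p q p≥S (ℕP.≤-trans (ℕP.m≤m⊔n S Pp) left))
               (ℚP.+-mono-≤ (near₁ q (ℕP.≤-trans (ℕP.m≤m⊔n Q₁ Q₂) right))
                 (ℚP.+-mono-≤ (ℚP.≤-trans (near₂ q (ℕP.≤-trans (ℕP.m≤n⊔m Q₁ Q₂) right)) (ℚP.+-monoˡ-≤ γ r≤γ))
                   (ℚP.≤-trans (proj₂ (cauchy (f Mp) (recip p) (recip-pos p)) q Pp (ℕP.≤-trans (ℕP.m≤n⊔m S Pp) left) ℕP.≤-refl) r≤γ))) ⟩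
        γ ℚ.+ ((ε ℚ.+ γ) ℚ.+ ((γ ℚ.+ γ) ℚ.+ γ))
          ≡⟨ solve 2 (λ e d → let g = con (+ 1 ℚ./ 5) :* d in g :+ ((e :+ g) :+ ((g :+ g) :+ g)) := e :+ d) ≡.refl ε δ ⟩
        ε ℚ.+ δ ∎
      where
      γ = (+ 1 ℚ./ 5) ℚ.* δ
      0<γ : 0ℚ ℚ.< γ
      0<γ = *-pos (ℚP.positive⁻¹ (+ 1 ℚ./ 5)) 0<δ
      R = proj₁ (archimedean γ 0<γ)
      rec = proj₂ (archimedean γ 0<γ)
      S = proj₁ (cauchy (f n) γ 0<γ)
      near = proj₂ (cauchy (f n) γ 0<γ)

  join-parts : ∀ {z w ε} →
    (∀ δ → 0ℚ ℚ.< δ → Eventually λ p → ℚ.∣ seq (re z) p ℚ.- seq (re w) p ∣ ℚ.≤ ½ ℚ.* ε ℚ.+ δ) →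
    (∀ δ → 0ℚ ℚ.< δ → Eventually λ p → ℚ.∣ seq (im z) p ℚ.- seq (im w) p ∣ ℚ.≤ ½ ℚ.* ε ℚ.+ δ) →
    SizeBound (z - w) ε
  join-parts {ε = ε} a b .eventually δ 0<δ = weaken (λ n (s , t) → ℚP.≤-trans (ℚP.+-mono-≤ s t) (ℚP.≤-reflexive
      (solve 2 (λ e d → (con ½ :* e :+ con ½ :* d) :+ (con ½ :* e :+ con ½ :* d) := e :+ d) ≡.refl ε δ)))
    (both (a (½ ℚ.* δ) (½pos 0<δ)) (b (½ ℚ.* δ) (½pos 0<δ)))

  parts-bound : ∀ (s : ℕ → ℂ) x y z → z ≡ x +i y →
    ApproachedBy (λ n → re (s n)) x → ApproachedBy (λ n → im (s n)) y →
    ∀ ε → 0ℚ ℚ.< ε → Eventually λ n → SizeBound (s n + (- z)) ε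
  parts-bound s x y z ≡.refl a b ε 0<ε = weaken (λ n (h , k) → join-parts {s n} {x +i y} h k)
    (both (a (½ ℚ.* ε) (½pos 0<ε)) (b (½ ℚ.* ε) (½pos 0<ε)))

  ι-+-≈ : ∀ p q → fromℝ (fromℚ (p ℚ.+ q)) ≈ fromℝ (fromℚ p) + fromℝ (fromℚ q)
  ι-+-≈ p q = ≗⇒≈ {fromℝ (fromℚ (p ℚ.+ q))} {fromℝ (fromℚ p) + fromℝ (fromℚ q)} (pointwise (λ _ → ≡.refl) (λ _ → ≡.refl))

  ι-*-≈ : ∀ p q → fromℝ (fromℚ (p ℚ.* q)) ≈ fromℝ (fromℚ p) * fromℝ (fromℚ q)
  ι-*-≈ p q = ≗⇒≈ {fromℝ (fromℚ (p ℚ.* q))} {fromℝ (fromℚ p) * fromℝ (fromℚ q)} (pointwise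
    (λ _ → solve 2 (λ p q → p :* q := p :* q :- con 0ℚ :* con 0ℚ) ≡.refl p q)
    (λ _ → solve 2 (λ p q → con 0ℚ := p :* con 0ℚ :+ con 0ℚ :* q) ≡.refl p q))

  ι-neg-≈ : ∀ p → fromℝ (fromℚ (ℚ.- p)) ≈ - fromℝ (fromℚ p)
  ι-neg-≈ p = ≗⇒≈ {fromℝ (fromℚ (ℚ.- p))} { - fromℝ (fromℚ p)} (pointwise (λ _ → ≡.refl) (λ _ → ≡.refl))

  ‖ι‖-bound : ∀ p → SizeBound (fromℝ (fromℚ p)) ℚ.∣ p ∣
  ‖ι‖-bound p = bound-const {fromℝ (fromℚ p)} λ n → ℚP.≤-reflexive (ℚP.+-identityʳ ℚ.∣ p ∣)

  bound-≈ : ∀ {x y q} → x ≈ y → SizeBound x q → SizeBound y q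
  bound-≈ {x} {y} {q} e b = bound-≗ {y} {x + - (x - y)} difference
    (bound-mono {x + - (x - y)} (ℚP.≤-reflexive (≡.trans (ℚP.+-comm q 0ℚ) (ℚP.+-identityˡ q)))
      (bound-+ {x} { - (x - y)} b (bound-neg {x - y} (≈-bound e))))
    where
    difference : y ≗ x + - (x - y)
    difference = pointwise (λ n → eq (seq (re x) n) (seq (re y) n)) (λ n → eq (seq (im x) n) (seq (im y) n))
      where
      eq : ∀ a b → b ≡ a ℚ.+ ℚ.- (a ℚ.- b)
      eq = solve 2 (λ a b → b := a :+ :- (a :- b)) ≡.refl

  bound-closed : ∀ {x q} → (∀ δ → 0ℚ ℚ.< δ → SizeBound x (q ℚ.+ δ)) → SizeBound x q
  bound-closed {x} {q} h = size≤ λ δ 0<δ → weaken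
    (λ n s → ℚP.≤-trans s (ℚP.≤-reflexive (solve 2 (λ q d → (q :+ con ½ :* d) :+ con ½ :* d := q :+ d) ≡.refl q δ)))
    (eventually (h (½ ℚ.* δ) (½pos 0<δ)) (½ ℚ.* δ) (½pos 0<δ))

  bound-0⇒≈0 : ∀ {x} → SizeBound x 0ℚ → x ≈ fromℤ (+ 0)
  bound-0⇒≈0 {x} b = ≈-by (bound-≗ {x - fromℤ (+ 0)} {x}
    (pointwise (λ n → ℚP.+-identityʳ (seq (re x) n)) (λ n → ℚP.+-identityʳ (seq (im x) n))) b)

  cauchy-converges : ∀ (s : ℕ → ℂ) →
    (∀ ε → 0ℚ ℚ.< ε → ∃ λ N → ∀ m n → N ℕ.≤ m → N ℕ.≤ n → SizeBound (s m + (- s n)) ε) →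
    ∃ λ l → ∀ ε → 0ℚ ℚ.< ε → Eventually λ n → SizeBound (s n + (- l)) ε
  cauchy-converges s c = (lim (λ n → re (s n)) cr +i lim (λ n → im (s n)) ci) ,
    parts-bound s (lim (λ n → re (s n)) cr) (lim (λ n → im (s n)) ci) (lim (λ n → re (s n)) cr +i lim (λ n → im (s n)) ci) ≡.refl
      (lim-converges (λ n → re (s n)) cr) (lim-converges (λ n → im (s n)) ci)
    where
    cr : IsCauchyᵣ (λ n → re (s n))
    cr ε 0<ε = let N , h = c ε 0<ε in N , λ m n N≤m N≤n δ 0<δ →
      weaken (λ p → ℚP.≤-trans (re≤size (s m - s n) p)) (eventually (h m n N≤m N≤n) δ 0<δ)
    ci : IsCauchyᵣ (λ n → im (s n))
    ci ε 0<ε = let N , h = c ε 0<ε in N , λ m n N≤m N≤n δ 0<δ →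
      weaken (λ p → ℚP.≤-trans (im≤size (s m - s n) p)) (eventually (h m n N≤m N≤n) δ 0<δ)

  isNormedRing : IsNormedRing _≈_ _+_ _*_ (-_) (fromℤ (+ 0)) (fromℤ (+ 1)) (λ q → fromℝ (fromℚ q)) SizeBound
  isNormedRing = record
    { isCommutativeRing = +-*-isCommutativeRing
    ; ι-+ = ι-+-≈
    ; ι-* = ι-*-≈
    ; ι-neg = ι-neg-≈
    ; ι-0 = E.refl {fromℝ (fromℚ 0ℚ)}
    ; ι-1 = E.refl {fromℝ (fromℚ 1ℚ)}
    ; ‖‖-cong = bound-≈
    ; ‖‖-mono = bound-mono
    ; ‖‖-nonneg = bound-nonneg′
    ; ‖‖-+ = bound-+
    ; ‖‖-* = bound-*
    ; ‖ι‖ = ‖ι‖-bound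
    ; ‖‖-closed = bound-closed
    ; ‖‖-zero = bound-0⇒≈0
    ; bounded = bounded-by
    ; complete = cauchy-converges
    }

  conj : ℂ → ℂ
  conj z = re z +i (-ᵣ im z)

  conj-bound : ∀ {z q} → SizeBound z q → SizeBound (conj z) q
  conj-bound {z} = bound-map {conj z} {z} (λ n → ℚP.≤-reflexive (cong (ℚ.∣ seq (re z) n ∣ ℚ.+_) (ℚP.∣-p∣≡∣p∣ (seq (im z) n)))) ℚP.≤-refl

  square-≤⇒≤ : ∀ {s t} → 0ℚ ℚ.< t → s ℚ.* s ℚ.≤ t ℚ.* t → s ℚ.≤ t
  square-≤⇒≤ {s} {t} 0<t h with ℚP.≤-total s t
  ... | inj₁ s≤t = s≤t
  ... | inj₂ t≤s = ℚP.*-cancelˡ-≤-pos t {{ℚ.positive 0<t}}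
    (ℚP.≤-trans (ℚP.*-monoʳ-≤-nonNeg s {{ℚ.nonNegative (ℚP.≤-trans (ℚP.<⇒≤ 0<t) t≤s)}} t≤s) h)

  -- The real part of z times its conjugate is re² + im², so each square is at most 1 + δ, which is
  -- below (1 + δ/2)².
  bound-from-conj : ∀ z → SizeBound (z * conj z) 1ℚ → SizeBound z (+ 2 ℚ./ 1)
  bound-from-conj z b .eventually δ 0<δ = weaken (λ n s →
      let a = seq (re z) n
          c = seq (im z) n
          a²+c²≤ : a ℚ.* a ℚ.+ c ℚ.* c ℚ.≤ 1ℚ ℚ.+ δ
          a²+c²≤ = begin
            a ℚ.* a ℚ.+ c ℚ.* c                ≡⟨ solve 2 (λ a c → a :* a :+ c :* c := a :* a :- c :* (:- c)) ≡.refl a c ⟩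
            a ℚ.* a ℚ.- c ℚ.* (ℚ.- c)          ≤⟨ p≤∣p∣ _ ⟩
            ℚ.∣ a ℚ.* a ℚ.- c ℚ.* (ℚ.- c) ∣    ≤⟨ re≤size (z * conj z) n ⟩
            size (z * conj z) n                ≤⟨ s ⟩
            1ℚ ℚ.+ δ                           ∎
      in begin
        ℚ.∣ a ∣ ℚ.+ ℚ.∣ c ∣
          ≤⟨ ℚP.+-mono-≤ (side a (ℚP.≤-trans (p≤p+q (square-nonneg c)) a²+c²≤)) (side c (ℚP.≤-trans (p≤q+p (square-nonneg a)) a²+c²≤)) ⟩
        t ℚ.+ t
          ≡⟨ solve 1 (λ d → (con 1ℚ :+ con ½ :* d) :+ (con 1ℚ :+ con ½ :* d) := con (+ 2 ℚ./ 1) :+ d) ≡.refl δ ⟩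
        (+ 2 ℚ./ 1) ℚ.+ δ ∎)
    (eventually b δ 0<δ)
    where
    t = 1ℚ ℚ.+ ½ ℚ.* δ
    0<t : 0ℚ ℚ.< t
    0<t = ℚP.<-≤-trans 0<1 (p≤p+q (ℚP.<⇒≤ (½pos 0<δ)))
    side : ∀ a → a ℚ.* a ℚ.≤ 1ℚ ℚ.+ δ → ℚ.∣ a ∣ ℚ.≤ t
    side a h = square-≤⇒≤ 0<t (begin
      ℚ.∣ a ∣ ℚ.* ℚ.∣ a ∣                ≡⟨ ≡.trans (≡.sym (ℚP.∣p*q∣≡∣p∣*∣q∣ a a)) (∣p∣≡p (square-nonneg a)) ⟩
      a ℚ.* a                            ≤⟨ h ⟩
      1ℚ ℚ.+ δ                           ≤⟨ p≤p+q (square-nonneg (½ ℚ.* δ)) ⟩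
      1ℚ ℚ.+ δ ℚ.+ ½ ℚ.* δ ℚ.* (½ ℚ.* δ) ≡⟨ solve 1 (λ d → con 1ℚ :+ d :+ con ½ :* d :* (con ½ :* d) :=
                                              (con 1ℚ :+ con ½ :* d) :* (con 1ℚ :+ con ½ :* d)) ≡.refl δ ⟩
      t ℚ.* t                            ∎)

  -- A real is the limit of its own approximants regarded as constants. For `π` these are the
  -- Riemann sums, as `Π-limit` demands.
  fromℝ-limit : ∀ x ρ → seq x ≡ ρ →
    ∀ ε → 0ℚ ℚ.< ε → Eventually λ n → SizeBound (fromℝ (fromℚ (ρ n)) + (- fromℝ x)) ε
  fromℝ-limit x _ ≡.refl ε 0<ε =
    let N , near = cauchy x ε 0<ε
    in N , λ n N≤n → size≤ λ δ 0<δ → N , λ p N≤p → ℚP.≤-trans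
         (ℚP.≤-reflexive (ℚP.+-identityʳ ℚ.∣ seq x n ℚ.- seq x p ∣))
         (ℚP.≤-trans (near n p N≤n N≤p) (p≤p+q (ℚP.<⇒≤ 0<δ)))

  re-im-parts : ∀ z → z ≈ fromℝ (re z) + i * fromℝ (im z)
  re-im-parts z = ≗⇒≈ {z} {fromℝ (re z) + i * fromℝ (im z)} (pointwise
    (λ n → solve 2 (λ a b → a := a :+ (con 0ℚ :* b :- con 1ℚ :* con 0ℚ)) ≡.refl (seq (re z) n) (seq (im z) n))
    (λ n → solve 1 (λ b → b := con 0ℚ :+ (con 0ℚ :* con 0ℚ :+ con 1ℚ :* b)) ≡.refl (seq (im z) n)))

  expTerm-0 : ∀ z → expTerm z 0 ≈ fromℤ (+ 1)
  expTerm-0 z = ≗⇒≈ {expTerm z 0} {fromℤ (+ 1)} (pointwise (λ _ → ≡.refl) (λ _ → ≡.refl))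

  expTerm-suc : ∀ z k → expTerm z (suc k) ≈ fromℝ (fromℚ (recip k)) * (z * expTerm z k)
  expTerm-suc z k = ≗⇒≈ {expTerm z (suc k)} {fromℝ (fromℚ (recip k)) * (z * expTerm z k)} (pointwise
    (λ n → ≡.trans (cong (λ c → c ℚ.* R n ℚ.- 0ℚ ℚ.* I n) (1/!-suc k))
      (solve 6 (λ r f a b u v → let o = con 0ℚ in
          (r :* f) :* (a :* u :- b :* v) :- o :* (a :* v :+ b :* u) :=
          r :* (a :* (f :* u :- o :* v) :- b :* (f :* v :+ o :* u)) :- o :* (a :* (f :* v :+ o :* u) :+ b :* (f :* u :- o :* v)))
        ≡.refl (recip k) (1/ k !) (seq (re z) n) (seq (im z) n) (seq (re (z ^ k)) n) (seq (im (z ^ k)) n)))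
    (λ n → ≡.trans (cong (λ c → c ℚ.* I n ℚ.+ 0ℚ ℚ.* R n) (1/!-suc k))
      (solve 6 (λ r f a b u v → let o = con 0ℚ in
          (r :* f) :* (a :* v :+ b :* u) :+ o :* (a :* u :- b :* v) :=
          r :* (a :* (f :* v :+ o :* u) :+ b :* (f :* u :- o :* v)) :+ o :* (a :* (f :* u :- o :* v) :- b :* (f :* v :+ o :* u)))
        ≡.refl (recip k) (1/ k !) (seq (re z) n) (seq (im z) n) (seq (re (z ^ k)) n) (seq (im (z ^ k)) n))))
    where
    R I : ℕ → ℚ
    R n = seq (re z) n ℚ.* seq (re (z ^ k)) n ℚ.- seq (im z) n ℚ.* seq (im (z ^ k)) n
    I n = seq (re z) n ℚ.* seq (im (z ^ k)) n ℚ.+ seq (im z) n ℚ.* seq (re (z ^ k)) n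

  exp-limit : ∀ z ε → 0ℚ ℚ.< ε → Eventually λ n → SizeBound (expPartialSum z n + (- exp z)) ε
  exp-limit z = parts-bound (expPartialSum z) (lim (λ n → re (expPartialSum z n)) (ExpLemmas.re-cauchy z))
    (lim (λ n → im (expPartialSum z n)) (ExpLemmas.im-cauchy z)) (exp z) ≡.refl
    (lim-converges (λ n → re (expPartialSum z n)) (ExpLemmas.re-cauchy z))
    (lim-converges (λ n → im (expPartialSum z n)) (ExpLemmas.im-cauchy z))

  conj-cong : ∀ {x y} → x ≈ y → conj x ≈ conj y
  conj-cong {x} {y} e = ≈-by (bound-≗ {conj x - conj y} {conj (x - y)} (pointwise (λ _ → ≡.refl)
    (λ n → solve 2 (λ a b → :- a :- :- b := :- (a :- b)) ≡.refl (seq (im x) n) (seq (im y) n)))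
    (conj-bound {x - y} (≈-bound e)))

  conj-+ : ∀ x y → conj (x + y) ≈ conj x + conj y
  conj-+ x y = ≗⇒≈ {conj (x + y)} {conj x + conj y} (pointwise (λ _ → ≡.refl)
    (λ n → solve 2 (λ a b → :- (a :+ b) := :- a :+ :- b) ≡.refl (seq (im x) n) (seq (im y) n)))

  conj-* : ∀ x y → conj (x * y) ≈ conj x * conj y
  conj-* x y = ≗⇒≈ {conj (x * y)} {conj x * conj y} (pointwise
    (λ n → solve 4 (λ a b c d → a :* c :- b :* d := a :* c :- (:- b) :* (:- d)) ≡.refl
      (seq (re x) n) (seq (im x) n) (seq (re y) n) (seq (im y) n))
    (λ n → solve 4 (λ a b c d → :- (a :* d :+ b :* c) := a :* (:- d) :+ (:- b) :* c) ≡.refl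
      (seq (re x) n) (seq (im x) n) (seq (re y) n) (seq (im y) n)))

  conj-ι : ∀ p → conj (fromℝ (fromℚ p)) ≈ fromℝ (fromℚ p)
  conj-ι p = ≗⇒≈ {conj (fromℝ (fromℚ p))} {fromℝ (fromℚ p)} (pointwise (λ _ → ≡.refl) (λ _ → ≡.refl))

  conj-i : conj i ≈ - i
  conj-i = ≗⇒≈ {conj i} { - i} (pointwise (λ _ → ≡.refl) (λ _ → ≡.refl))

  i*i : i * i ≈ - fromℤ (+ 1)
  i*i = ≗⇒≈ {i * i} { - fromℤ (+ 1)} (pointwise (λ _ → ≡.refl) (λ _ → ≡.refl))

  approximable : ∀ x → ∃ λ (ρ : ℕ → ℚ) →
    (∀ ε → 0ℚ ℚ.< ε → Eventually λ n → SizeBound (fromℝ (fromℚ (ρ n)) + (- fromℝ x)) ε) ×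
    ∃ λ L → Eventually λ n → ℚ.∣ ρ n ∣ ℚ.≤ L
  approximable x = let B , _ , ev = cauchy-bounded (seq x) (cauchy x) in seq x , fromℝ-limit x (seq x) ≡.refl , B , ev

  isComplexField : IsComplexField _≈_ _+_ _*_ (-_) (fromℤ (+ 0)) (fromℤ (+ 1)) (λ q → fromℝ (fromℚ q)) SizeBound exp i (fromℝ π)
  isComplexField = record
    { isNormedRing = isNormedRing
    ; expTerm = expTerm
    ; expPartialSum = expPartialSum
    ; expTerm-0 = expTerm-0
    ; expTerm-suc = expTerm-suc
    ; expPartialSum-0 = λ z → E.refl {fromℤ (+ 0)}
    ; expPartialSum-suc = λ z n → E.refl {expPartialSum z n + expTerm z n}
    ; exp-limit = exp-limit
    ; J*J = i*i
    ; ‖J‖ = bound-const {i} λ _ → ℚP.≤-refl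
    ; Π-limit = fromℝ-limit π riemannSum ≡.refl
    ; conj = conj
    ; conj-cong = conj-cong
    ; conj-+ = conj-+
    ; conj-* = conj-*
    ; conj-ι = conj-ι
    ; conj-J = conj-i
    ; ‖conj‖ = conj-bound
    ; ‖‖-conj-1 = bound-from-conj
    ; parts = λ z → fromℝ (re z) , fromℝ (im z) , re-im-parts z , approximable (re z) , approximable (im z)
    }

  3π/3 : π/3 * fromℝ (fromℚ (+ 3 ℚ./ 1)) ≈ fromℝ π
  3π/3 = ≗⇒≈ {π/3 * fromℝ (fromℚ (+ 3 ℚ./ 1))} {fromℝ π} (pointwise
    (λ n → solve 1 (λ p → (p :* con (+ 1 ℚ./ 3)) :* con (+ 3 ℚ./ 1) :- con 0ℚ :* con 0ℚ := p) ≡.refl (seq π n))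
    (λ n → solve 1 (λ p → (p :* con (+ 1 ℚ./ 3)) :* con 0ℚ :+ con 0ℚ :* con (+ 3 ℚ./ 1) := con 0ℚ) ≡.refl (seq π n)))

  ≡⇒≈ : ∀ z w → z ≡ w → z ≈ w
  ≡⇒≈ z _ ≡.refl = E.refl {z}

  -- Explicit endpoints confine each `≡.refl` below to the subterm that changes.
  congruence : ∀ {A : Set} (f : A → ℂ) x y → x ≡ y → f x ≡ f y
  congruence f x y = cong f

  2i-≡ : 2i ≡ fromℝ (fromℚ (+ 2 ℚ./ 1)) * i
  2i-≡ = congruence (λ t → t * i) (fromℤ (+ 2)) (fromℝ (fromℚ (+ 2 ℚ./ 1))) ≡.refl

  fromℤ-≡ : ∀ n → fromℤ n ≡ fromℝ (fromℚ (fromℤ/1 n))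
  fromℤ-≡ n = congruence (λ r → fromℝ (fromℚ r)) (n ℚ./ 1) (fromℤ/1 n) ≡.refl

  cube-≡ : ∀ z → z ^ 3 ≡ z * (z * (z * fromℤ (+ 1)))
  cube-≡ z = congruence (λ t → z * t) (z ^ 2) (z * (z * fromℤ (+ 1)))
    (congruence (λ t → z * t) (z ^ 1) (z * fromℤ (+ 1)) (congruence (λ t → z * t) (z ^ 0) (fromℤ (+ 1)) ≡.refl))

  C-term-≡ : ∀ τ x y k l → C-term τ x y (k , l) ≡
    exp (fromℝ π * i * fromℝ (fromℚ (C-exponent k l)) * τ) * exp (2i * x * fromℤ (+ 2 ℤ.* l ℤ.+ k)) * exp (2i * y * fromℤ (+ 2 ℤ.* k ℤ.+ l))
  C-term-≡ τ x y k l = congruence (λ t → t * exp (2i * x * fromℤ (+ 2 ℤ.* l ℤ.+ k)) * exp (2i * y * fromℤ (+ 2 ℤ.* k ℤ.+ l)))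
    (q^ τ (fromℚ (C-exponent k l))) (exp (fromℝ π * i * fromℝ (fromℚ (C-exponent k l)) * τ)) ≡.refl

  module Main (τ : ℂ) = MainTheorem isComplexField
    _-_ (λ x y → E.refl {x + (- y)})
    2i (≡⇒≈ 2i (fromℝ (fromℚ (+ 2 ℚ./ 1)) * i) 2i-≡)
    fromℤ (λ n → ≡⇒≈ (fromℤ n) (fromℝ (fromℚ (fromℤ/1 n))) (fromℤ-≡ n))
    (λ z → z ^ 3) (λ z → ≡⇒≈ (z ^ 3) (z * (z * (z * fromℤ (+ 1)))) (cube-≡ z))
    π/3 3π/3
    Σ-over (λ f → E.refl {fromℤ (+ 0)}) (λ f a as → E.refl {f a + Σ-over f as})
    τ (C-term τ) (λ x y k l → ≡⇒≈ (C-term τ x y (k , l)) _ (C-term-≡ τ x y k l))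

  module _ (τ : ℂ) {A : Set} {f : A → ℂ} {s : ℂ} where

    near⇒bound : ∀ z ε → (∣ re z -ᵣ re s ∣ᵣ ≤ᵣ fromℚ (½ ℚ.* ε) × ∣ im z -ᵣ im s ∣ᵣ ≤ᵣ fromℚ (½ ℚ.* ε)) → SizeBound (z + (- s)) ε
    near⇒bound z ε (h , k) = join-parts {z} {s} {ε} h k

    bound⇒near : ∀ z ε → SizeBound (z + (- s)) ε → ∣ re z -ᵣ re s ∣ᵣ ≤ᵣ fromℚ ε × ∣ im z -ᵣ im s ∣ᵣ ≤ᵣ fromℚ ε
    bound⇒near z ε b =
      (λ δ 0<δ → weaken (λ n → ℚP.≤-trans (re≤size (z - s) n)) (eventually b δ 0<δ)) ,
      (λ δ 0<δ → weaken (λ n → ℚP.≤-trans (im≤size (z - s) n)) (eventually b δ 0<δ))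

    -- `HasSum` tests the real and imaginary parts separately while the norm adds them, so this
    -- direction asks for ½ε from each.
    hasSum⇒ : HasSum f s → Main.HasSum τ f s
    hasSum⇒ h ε 0<ε = proj₁ (h (½ ℚ.* ε) (½pos 0<ε)) , λ G uG F⊆G →
      near⇒bound (Σ-over f G) ε (proj₂ (h (½ ℚ.* ε) (½pos 0<ε)) G uG F⊆G)

    hasSum⇐ : Main.HasSum τ f s → HasSum f s
    hasSum⇐ h ε 0<ε = proj₁ (h ε 0<ε) , λ G uG F⊆G → bound⇒near (Σ-over f G) ε (proj₂ (h ε 0<ε) G uG F⊆G)

open ComplexInstance using (module Main; fromℝ-limit; re-im-parts; hasSum⇒; hasSum⇐; ≈⇒≃; ≃⇒≈; ≃-refl)

theorem3p1 : (τ : ℂ) → 0ᵣ <ᵣ im τ →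
    (∃ λ (C : ℂ → ℂ → ℂ) → IsC τ C) ×
    ((C : ℂ → ℂ → ℂ) → IsC τ C → (x y : ℂ) →
      C x y ^ 3 - C (- x) (- y) ^ 3 ≃ C (x + π/3) y ^ 3 - C (- x - π/3) (- y) ^ 3)
theorem3p1 τ (c , 0<c , N , c≤im) =
  ((λ x y → exp (2i * x) * exp (2i * y) * proj₁ (sums x y)) , λ x y →
    proj₁ (sums x y) , hasSum⇐ τ {f = C-term τ x y} {proj₁ (sums x y)} (proj₂ (sums x y)) , ≃-refl (exp (2i * x) * exp (2i * y) * proj₁ (sums x y))) ,
  λ C isC x y →
    let S₁ , h₁ , e₁ = isC x y
        S₂ , h₂ , e₂ = isC (- x) (- y)
        S₃ , h₃ , e₃ = isC (x + π/3) y
        S₄ , h₄ , e₄ = isC (- x - π/3) (- y)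
    in ≈⇒≃ {C x y ^ 3 - C (- x) (- y) ^ 3} {C (x + π/3) y ^ 3 - C (- x - π/3) (- y) ^ 3}
         (Main.identity τ (fromℝ (re τ)) (fromℝ (im τ)) (re-im-parts τ) re-approx (seq (im τ)) (fromℝ-limit (im τ) (seq (im τ)) ≡.refl) c 0<c c≤ρ x y
         {C x y} {C (- x) (- y)} {C (x + π/3) y} {C (- x - π/3) (- y)} {S₁} {S₂} {S₃} {S₄}
         (hasSum⇒ τ {f = C-term τ x y} {S₁} h₁) (≃⇒≈ {C x y} {exp (2i * x) * exp (2i * y) * S₁} e₁) (hasSum⇒ τ {f = C-term τ (- x) (- y)} {S₂} h₂) (≃⇒≈ {C (- x) (- y)} {exp (2i * (- x)) * exp (2i * (- y)) * S₂} e₂) (hasSum⇒ τ {f = C-term τ (x + π/3) y} {S₃} h₃) (≃⇒≈ {C (x + π/3) y} {exp (2i * (x + π/3)) * exp (2i * y) * S₃} e₃) (hasSum⇒ τ {f = C-term τ (- x - π/3) (- y)} {S₄} h₄) (≃⇒≈ {C (- x - π/3) (- y)} {exp (2i * (- x - π/3)) * exp (2i * (- y)) * S₄} e₄))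
  where
  re-approx = ComplexInstance.approximable (re τ)
  -- The rational c contained in the proof that Im τ is positive is the lower bound on which
  -- convergence rests.
  c≤ρ : Eventually λ n → c ℚ.≤ seq (im τ) n
  c≤ρ = N , λ n h → ℚP.≤-trans (ℚP.≤-reflexive (≡.sym (ℚP.+-identityˡ c))) (c≤im n h)
  sums = Main.sum-exists τ (fromℝ (re τ)) (fromℝ (im τ)) (re-im-parts τ) re-approx (seq (im τ)) (fromℝ-limit (im τ) (seq (im τ)) ≡.refl) c 0<c c≤ρ
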